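{- Let $\Lambda_f$ be a uniformly random numerical semigroup with Frobenius number $f$, and $g(\Lambda_f)$ its genus. There are constants $\gamma_0$ and $\gamma_1$ such that, as $f \to \infty$, $\mathbb{E}[g(\Lambda_f)] - \frac{3f}{4}$ converges to $\gamma_0$ along even $f$ and to $\gamma_1$ along odd $f$.
   Context: A numerical semigroup is a subset $\Lambda \subseteq \mathbb{N}_0$ containing $0$, closed under addition, with finite complement. Its genus is $g(\Lambda) = \#(\mathbb{N}_0 \setminus \Lambda)$, its conductor is the least $c$ with $c + \mathbb{N}_0 \subseteq \Lambda$, and its Frobenius number is the conductor minus $1$. -}

module Defs where

open import Data.Bool using (Bool; true; false; T)
open import Data.Bool.Properties using (T?)
open import Data.Empty using (⊥; ⊥-elim)
open import Data.Fin using (Fin; toℕ; fromℕ<)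
open import Data.Fin.Properties using (all?; toℕ-fromℕ<; toℕ<n)
open import Data.Integer using (+_)
open import Data.List using (List; []; _∷_; map; _++_; filter; upTo; length)
open import Data.List.Membership.Propositional using (_∈_)
open import Data.List.Membership.Propositional.Properties using (∈-map⁺; ∈-map⁻; ∈-++⁺ˡ; ∈-++⁺ʳ; ∈-filter⁺; ∈-filter⁻; ∈-upTo⁺)
open import Data.List.Relation.Unary.All using (All; []; _∷_; reduce)
open import Data.List.Relation.Unary.All.Properties using (all-filter)
open import Data.List.Relation.Unary.AllPairs using (AllPairs; []; _∷_)
open import Data.List.Relation.Unary.Any using (Any; here; there)
open import Data.List.Relation.Unary.Unique.Propositional using (Unique)
import Data.List.Relation.Unary.Unique.Propositional.Properties as Unique
open import Data.Nat using (ℕ; zero; suc; _+_; _∸_; _≤_; _<_; _≥_; s≤s; NonZero)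
open import Data.Nat.Divisibility using (_∣_)
open import Data.Nat.ListAction using (sum)
open import Data.Nat.Properties using (≤-trans; ≤-refl; ≮⇒≥; m≤m+n; m≤n+m; m+[n∸m]≡n; +-identityʳ; +-suc; <-irrefl; _≤?_; _<?_)
open import Data.Product using (_×_; _,_; proj₁; proj₂; ∃; ∃-syntax)
open import Data.Rational using (ℚ; 0ℚ; _/_) renaming (_+_ to _+ℚ_; _-_ to _-ℚ_; _<_ to _<ℚ_)
open import Data.Sum using (_⊎_)
open import Data.Unit using (tt)
open import Data.Vec using (Vec; []; _∷_; tabulate; replicate)
open import Data.Vec.Properties using (∷-injectiveʳ)
open import Function using (_∘_; _⇔_; mk⇔)
open import Level using (0ℓ)
open import Relation.Binary.PropositionalEquality using (_≡_; _≢_; refl; sym; cong; subst)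
open import Relation.Nullary using (¬_; yes; no; does)
open import Relation.Nullary.Decidable using (_×-dec_; _→-dec_; ¬?; decidable-stable; map′)
open import Relation.Unary using (Pred; Decidable; _≐_)

-- Subsets of ℕ are decidable predicates. Finiteness of the complement is
-- witnessed by a list of the gaps, each occurring once.
record NumericalSemigroup : Set₁ where
  field
    Carrier      : Pred ℕ 0ℓ
    _∈Λ?         : Decidable Carrier
    0∈Λ          : Carrier 0
    +-closed     : ∀ {a b} → Carrier a → Carrier b → Carrier (a + b)
    gaps         : List ℕ
    gaps-unique  : Unique gaps
    gaps-correct : ∀ n → n ∈ gaps ⇔ (¬ Carrier n)

  genus : ℕ
  genus = length gaps

open NumericalSemigroup public using (Carrier; genus)

-- Equality as subsets of ℕ: the recorded proofs and the order in which the
-- gaps are listed are irrelevant.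
_≈_ : NumericalSemigroup → NumericalSemigroup → Set
Λ ≈ Λ′ = Carrier Λ ≐ Carrier Λ′

ContainsFrom : NumericalSemigroup → ℕ → Set
ContainsFrom Λ c = ∀ n → Carrier Λ (c + n)

IsConductor : NumericalSemigroup → ℕ → Set
IsConductor Λ c = ContainsFrom Λ c × (∀ c′ → ContainsFrom Λ c′ → c ≤ c′)

HasFrobeniusNumber : ℕ → NumericalSemigroup → Set
HasFrobeniusNumber f Λ = IsConductor Λ (suc f)

record Enumeration (P : NumericalSemigroup → Set) : Set₁ where
  field
    elements : List NumericalSemigroup
    sound    : All P elements
    complete : ∀ Λ → P Λ → Any (Λ ≈_) elements
    distinct : AllPairs (λ Λ Λ′ → ¬ (Λ ≈ Λ′)) elements

allVecs : ∀ n → List (Vec Bool n)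
allVecs zero    = [] ∷ []
allVecs (suc n) = map (true ∷_) (allVecs n) ++ map (false ∷_) (allVecs n)

allVecs-complete : ∀ {n} (v : Vec Bool n) → v ∈ allVecs n
allVecs-complete []          = here refl
allVecs-complete (true ∷ v)  = ∈-++⁺ˡ (∈-map⁺ _ (allVecs-complete v))
allVecs-complete (false ∷ v) = ∈-++⁺ʳ _ (∈-map⁺ _ (allVecs-complete v))

allVecs-unique : ∀ n → Unique (allVecs n)
allVecs-unique zero    = [] ∷ []
allVecs-unique (suc n) = Unique.++⁺
  (Unique.map⁺ ∷-injectiveʳ (allVecs-unique n))
  (Unique.map⁺ ∷-injectiveʳ (allVecs-unique n))
  disjoint
  where
  disjoint : ∀ {v} → ¬ (v ∈ map (true ∷_) (allVecs n) × v ∈ map (false ∷_) (allVecs n))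
  disjoint (p , q) with ∈-map⁻ _ p | ∈-map⁻ _ q
  ... | _ , _ , refl | _ , _ , ()

-- The subset of ℕ with indicator v on {0, …, n - 1} that contains every m ≥ n.
Extend : ∀ {n} → Vec Bool n → Pred ℕ 0ℓ
Extend []      _       = T true
Extend (b ∷ v) zero    = T b
Extend (b ∷ v) (suc m) = Extend v m

extend? : ∀ {n} (v : Vec Bool n) → Decidable (Extend v)
extend? []      _       = yes tt
extend? (b ∷ v) zero    = T? b
extend? (b ∷ v) (suc m) = extend? v m

-- Extend v is a numerical semigroup with Frobenius number f, tested on the
-- initial segment {0, …, f} only.
record Valid (f : ℕ) (v : Vec Bool (suc f)) : Set where
  constructor mkValid
  field
    zero∈  : Extend v 0
    closed : ∀ (i j : Fin (suc f)) →
             Extend v (toℕ i) → Extend v (toℕ j) → Extend v (toℕ i + toℕ j)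
    f∉     : ¬ Extend v f

valid? : ∀ f → Decidable (Valid f)
valid? f v = map′
  (λ (z , c , n) → mkValid z c n)
  (λ (mkValid z c n) → z , c , n)
  (extend? v 0
    ×-dec all? (λ i → all? λ j →
            extend? v (toℕ i) →-dec (extend? v (toℕ j) →-dec extend? v (toℕ i + toℕ j)))
    ×-dec ¬? (extend? v f))

extend-≥ : ∀ {n} (v : Vec Bool n) {m} → n ≤ m → Extend v m
extend-≥ []      _         = tt
extend-≥ (_ ∷ v) (s≤s n≤m) = extend-≥ v n≤m

extend-injective : ∀ {n} (v w : Vec Bool n) → Extend v ≐ Extend w → v ≡ w
extend-injective []          []          _       = refl
extend-injective (true ∷ v)  (true ∷ w)  (p , q) =
  cong (true ∷_) (extend-injective v w ((λ {m} → p {suc m}) , (λ {m} → q {suc m})))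
extend-injective (false ∷ v) (false ∷ w) (p , q) =
  cong (false ∷_) (extend-injective v w ((λ {m} → p {suc m}) , (λ {m} → q {suc m})))
extend-injective (true ∷ v)  (false ∷ w) (p , q) = ⊥-elim (p {0} tt)
extend-injective (false ∷ v) (true ∷ w)  (p , q) = ⊥-elim (q {0} tt)

extend-closed : ∀ f (v : Vec Bool (suc f)) → Valid f v →
                ∀ {a b} → Extend v a → Extend v b → Extend v (a + b)
extend-closed f v (mkValid _ closed _) {a} {b} a∈ b∈ with a <? suc f | b <? suc f
... | no a≮ | _      = extend-≥ v (≤-trans (≮⇒≥ a≮) (m≤m+n a b))
... | yes _ | no b≮  = extend-≥ v (≤-trans (≮⇒≥ b≮) (m≤n+m b a))
... | yes a< | yes b<
  with fromℕ< a< | toℕ-fromℕ< a< | fromℕ< b< | toℕ-fromℕ< b<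
... | i | refl | j | refl = closed i j a∈ b∈

toSemigroup : ∀ {f} {v : Vec Bool (suc f)} → Valid f v → NumericalSemigroup
toSemigroup {f} {v} valid = record
  { Carrier      = Extend v
  ; _∈Λ?         = extend? v
  ; 0∈Λ          = Valid.zero∈ valid
  ; +-closed     = λ {a} {b} → extend-closed f v valid {a} {b}
  ; gaps         = filter gap? (upTo (suc f))
  ; gaps-unique  = Unique.filter⁺ gap? (Unique.upTo⁺ (suc f))
  ; gaps-correct = λ n → mk⇔ (proj₂ ∘ ∈-filter⁻ gap? {xs = upTo (suc f)})
                             (λ n∉ → ∈-filter⁺ gap? (∈-upTo⁺ (below n∉)) n∉)
  }
  where
  gap? : Decidable (λ n → ¬ Extend v n)
  gap? n = ¬? (extend? v n)

  below : ∀ {n} → ¬ Extend v n → n < suc f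
  below {n} n∉ = decidable-stable (n <? suc f) (λ n≮ → n∉ (extend-≥ v (≮⇒≥ n≮)))

toSemigroup-frobenius : ∀ {f} {v : Vec Bool (suc f)} (p : Valid f v) →
                        HasFrobeniusNumber f (toSemigroup p)
toSemigroup-frobenius {f} {v} (mkValid _ _ f∉) =
  (λ n → extend-≥ v (m≤m+n (suc f) n)) ,
  (λ c′ from → decidable-stable (suc f ≤? c′) λ ≰ →
    f∉ (subst (Extend v) (m+[n∸m]≡n (≮⇒≥ ≰)) (from (f ∸ c′))))

restrict : {P : Pred ℕ 0ℓ} → Decidable P → ∀ n → Vec Bool n
restrict P? n = tabulate (λ i → does (P? (toℕ i)))

restrict-≐ : {P : Pred ℕ 0ℓ} (P? : Decidable P) → ∀ n → (∀ m → P (n + m)) →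
             P ≐ Extend (restrict P? n)
restrict-≐ {P} P? n from = (λ {m} → fwd P? n m) , (λ {m} → bwd P? n from m)
  where
  fwd : {P : Pred ℕ 0ℓ} (P? : Decidable P) → ∀ n m → P m → Extend (restrict P? n) m
  fwd P? zero    m       p = tt
  fwd P? (suc n) zero    p with P? 0
  ... | yes _ = tt
  ... | no ¬p = ¬p p
  fwd P? (suc n) (suc m) p = fwd (P? ∘ suc) n m p

  bwd : {P : Pred ℕ 0ℓ} (P? : Decidable P) → ∀ n → (∀ m → P (n + m)) →
        ∀ m → Extend (restrict P? n) m → P m
  bwd P? zero    from m       _ = from m
  bwd P? (suc n) from zero    e with P? 0
  ... | yes p = p
  ... | no _  = ⊥-elim e
  bwd P? (suc n) from (suc m) e = bwd (P? ∘ suc) n from m e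

restrict-valid : ∀ f Λ → HasFrobeniusNumber f Λ →
                 Valid f (restrict (NumericalSemigroup._∈Λ? Λ) (suc f))
restrict-valid f Λ (from , least) = mkValid
  (to {0} 0∈Λ)
  (λ i j i∈ j∈ → to {toℕ i + toℕ j} (+-closed (of {toℕ i} i∈) (of {toℕ j} j∈)))
  (λ f∈ → <-irrefl refl (least f (fromf (of {f} f∈))))
  where
  open NumericalSemigroup Λ using (_∈Λ?; 0∈Λ; +-closed)
  same = restrict-≐ _∈Λ? (suc f) from
  to = proj₁ same
  of = proj₂ same

  fromf : Carrier Λ f → ContainsFrom Λ f
  fromf f∈ zero    = subst (Carrier Λ) (sym (+-identityʳ f)) f∈
  fromf f∈ (suc n) = subst (Carrier Λ) (sym (+-suc f n)) (from n)

module _ {A : Set} {P : Pred A 0ℓ} {B : Set₁} (h : ∀ {x} → P x → B) where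

  reduce-all : {Q : Pred B 0ℓ} → (∀ {x} (p : P x) → Q (h p)) →
               ∀ {xs} (ps : All P xs) → All Q (reduce h ps)
  reduce-all q []       = []
  reduce-all q (p ∷ ps) = q p ∷ reduce-all q ps

  reduce-any : {Q : Pred B 0ℓ} {x : A} → (∀ (p : P x) → Q (h p)) →
               ∀ {xs} (ps : All P xs) → x ∈ xs → Any Q (reduce h ps)
  reduce-any q (p ∷ ps) (here refl) = here (q p)
  reduce-any q (p ∷ ps) (there x∈)  = there (reduce-any q ps x∈)

  reduce-pairs : {R : B → B → Set} →
                 (∀ {x y} (p : P x) (q : P y) → x ≢ y → R (h p) (h q)) →
                 ∀ {xs} (ps : All P xs) → Unique xs → AllPairs R (reduce h ps)
  reduce-pairs r []       []       = []
  reduce-pairs {R} r (p ∷ ps) (u ∷ us) = row ps u ∷ reduce-pairs r ps us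
    where
    row : ∀ {ys} (qs : All P ys) → All (_ ≢_) ys → All (R (h p)) (reduce h qs)
    row []       []       = []
    row (q ∷ qs) (n ∷ ns) = r p q n ∷ row qs ns

semigroupsWithFrobenius : ∀ f → Enumeration (HasFrobeniusNumber f)
semigroupsWithFrobenius f = record
  { elements = reduce toSemigroup valids
  ; sound    = reduce-all toSemigroup toSemigroup-frobenius valids
  ; complete = λ Λ frob →
      reduce-any toSemigroup
        (λ _ → restrict-≐ (NumericalSemigroup._∈Λ? Λ) (suc f) (proj₁ frob))
        valids
        (∈-filter⁺ (valid? f) (allVecs-complete _) (restrict-valid f Λ frob))
  ; distinct = reduce-pairs toSemigroup
      (λ {v} {w} _ _ v≢w same → v≢w (extend-injective v w same))
      valids (Unique.filter⁺ (valid? f) (allVecs-unique (suc f)))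
  }
  where
  valids : All (Valid f) (filter (valid? f) (allVecs (suc f)))
  valids = all-filter (valid? f) (allVecs (suc f))

mean : List ℕ → ℚ
mean []       = 0ℚ
mean (x ∷ xs) = + sum (x ∷ xs) / length (x ∷ xs)

-- For f ≥ 1 the average is over a nonempty set (see below); no numerical
-- semigroup has Frobenius number 0, so there the value is junk.
expectedGenus : ℕ → ℚ
expectedGenus f = mean (map genus (Enumeration.elements (semigroupsWithFrobenius f)))

semigroups-nonempty : ∀ f → .{{NonZero f}} →
                      Enumeration.elements (semigroupsWithFrobenius f) ≢ []
semigroups-nonempty (suc k) eq =
  absurd (subst (Any (toSemigroup valid ≈_)) eq
    (Enumeration.complete (semigroupsWithFrobenius (suc k)) (toSemigroup valid)
      (toSemigroup-frobenius {suc k} {v} valid)))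
  where
  absurd : ∀ {P : Pred NumericalSemigroup 0ℓ} → Any P [] → ⊥
  absurd ()

  v : Vec Bool (suc (suc k))
  v = true ∷ replicate (suc k) false

  low : ∀ n m → m < n → ¬ Extend (replicate n false) m
  low (suc n) zero    _         e = e
  low (suc n) (suc m) (s≤s m<n) e = low n m m<n e

  closed : ∀ a b → a < suc (suc k) → b < suc (suc k) → Extend v a → Extend v b → Extend v (a + b)
  closed zero    b _        _ _  b∈ = b∈
  closed (suc a) b (s≤s a<) _ a∈ _  = ⊥-elim (low (suc k) a a< a∈)

  valid : Valid (suc k) v
  valid = mkValid tt
    (λ i j → closed (toℕ i) (toℕ j) (toℕ<n i) (toℕ<n j))
    (low (suc k) k ≤-refl)

record ℝ : Set₁ where
  field
    Lower Upper   : Pred ℚ 0ℓ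
    lower-inhab   : ∃ Lower
    upper-inhab   : ∃ Upper
    lower-rounded : ∀ q → Lower q ⇔ (∃[ r ] q <ℚ r × Lower r)
    upper-rounded : ∀ q → Upper q ⇔ (∃[ r ] r <ℚ q × Upper r)
    disjoint      : ∀ q → ¬ (Lower q × Upper q)
    located       : ∀ q r → q <ℚ r → Lower q ⊎ Upper r

-- A two-sided Dedekind real is compared with rationals through its cuts:
-- ∣ q - γ ∣ < ε, that is, q - ε < γ < q + ε.
∣_-_∣<_ : ℚ → ℝ → ℚ → Set
∣ q - γ ∣< ε = ℝ.Lower γ (q -ℚ ε) × ℝ.Upper γ (q +ℚ ε)

ConvergesAlong : Pred ℕ 0ℓ → (ℕ → ℚ) → ℝ → Set
ConvergesAlong P a γ =
  ∀ ε → 0ℚ <ℚ ε → ∃[ N ] (∀ n → n ≥ N → P n → ∣ a n - γ ∣< ε)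

Even Odd : Pred ℕ 0ℓ
Even n = 2 ∣ n
Odd  n = ¬ (2 ∣ n)

{-# OPTIONS --safe #-}
module Submission where

-- Comparing f with f + 2: a semigroup Λ with Frobenius number f and no element in
-- {1, …, a}, where a ≈ 3f/8, keeps its structure when one gap is inserted below a
-- and one free bit in the middle of the upper half, because sums of two nonzero
-- elements exceed 2a and hence lie above the free bit. This doubles the number of
-- such Λ and adds 3/2 to the mean genus, so 3f/4 is compensated exactly. The other
-- semigroups are an exponentially small fraction, so the deviations at f and f + 2
-- differ by O(1/f²) and the deviations form a Cauchy sequence along each parity.
--
-- To bound the exceptional semigroups, record for 0 < z < f whether z ∈ Λ, f - z ∈ Λ
-- or neither. For p ∈ Λ this side is monotone along z, z + p, z + 2p, …, so a chain
-- of length N has O(N²) instead of 2ᴺ codes, a gain of 15/16 once N ≥ 4, that is for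
-- p ≤ f/4. If the multiplicity m exceeds f/4, chains of step m have length at most 4
-- and the minimality of m restricts their ends; length 2 or 3 gives exactly 4 or 8
-- codes without gain. A further element m + e below f/2 links chains of length 3 in
-- pairs (53 codes instead of 64), and if there is no such element the middle side
-- is never L (6 codes instead of 8).

-- The yardstick is 2^(f/2). About f/2 sides determine Λ, and a priori they have 3^(f/2) values; on
-- the other hand every subset of the upper half of {1, ..., f - 1} gives a semigroup, so there are
-- at least 2^⌊f/2⌋ / 2 of them. A chain of length N must therefore be coded by at most 2^N words,
-- and a number of chains proportional to f must do better by a constant factor. The fraction 3/8
-- lies strictly between two constraints. For the insertion, sums of two elements of the middle
-- block must fall into the upper block and sums of an upper and another nonzero element must exceed
-- f, which forces a to be at least about f/3. For rarity, a must stay below f/2 by a fixed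
-- proportion of f: for f/3 < m < f/2 the gain comes from chains of length 3, and these come from
-- only about f - 2m residues mod m. A fraction that decays exponentially is needed only as 1/f⁵: f²
-- pays for the choice of the small element and of the link, f for the size of the genus, and f² for
-- a summable difference between f and f + 2.

module Counting where

  open import Defs
  open import Data.Bool using (Bool; true; false; _∧_; not; if_then_else_; T)
  open import Data.Empty using (⊥; ⊥-elim)
  open import Data.Fin using (toℕ)
  open import Data.List using (List; []; _∷_; map; _++_; length; cartesianProduct; filter; filterᵇ; applyUpTo)
  open import Data.List.Membership.Propositional using (_∈_)
  open import Data.List.Membership.Propositional.Properties using (∈-∃++; ∈-++⁻; ∈-++⁺ˡ; ∈-++⁺ʳ; ∈-map⁺; ∈-cartesianProduct⁺)
  open import Data.List.Properties using (length-map; length-++; map-++; map-∘)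
  open import Data.List.Relation.Unary.All as All using (All; reduce) renaming ([] to []ᵃ; _∷_ to _∷ᵃ_)
  open import Data.List.Relation.Unary.All.Properties using (all-filter)
  open import Data.List.Relation.Unary.AllPairs using () renaming ([] to []ᵘ; _∷_ to _∷ᵘ_)
  open import Data.List.Relation.Unary.Any using (here; there)
  open import Data.List.Relation.Unary.Unique.Propositional using (Unique)
  import Data.List.Relation.Unary.Unique.Propositional.Properties as Unique
  open import Data.Nat
  open import Data.Nat.DivMod using (m≡m%n+[m/n]*n; m%n<n)
  open import Data.Nat.ListAction using (sum)
  open import Data.Nat.ListAction.Properties using (sum-++)
  open import Data.Nat.Properties
  open import Data.Nat.Tactic.RingSolver using (solve; solve-∀)
  open import Data.Product using (_×_; _,_; proj₁; proj₂; ∃-syntax)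
  open import Data.Sum using (_⊎_; inj₁; inj₂)
  open import Data.Unit using (⊤; tt)
  open import Data.Vec using (Vec; replicate) renaming ([] to []ᵛ; _∷_ to _∷ᵛ_; _++_ to _++ᵛ_)
  open import Data.Vec.Properties using (++-injective)
  open import Function using (_∘_; id; const)
  open import Relation.Binary.Definitions using (tri<; tri≈; tri>)
  open import Relation.Binary.PropositionalEquality
  open import Relation.Nullary using (¬_; yes; no; does; Dec)
  open import Relation.Nullary.Decidable using (¬?; T?; dec-true)
  open import Relation.Unary using (Decidable)

  -- Linear inequalities are proved by Farkas certificates: X ≤ Y is a nonnegative
  -- combination of the hypotheses and k is the remaining slack.
  linear-≤ : ∀ {X Y L R} k → X ≤ Y → L + Y + k ≡ R + X → L ≤ R
  linear-≤ {X} {Y} {L} {R} k X≤Y eq = +-cancelʳ-≤ X L R (begin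
    L + X     ≤⟨ +-monoʳ-≤ L X≤Y ⟩
    L + Y     ≤⟨ m≤m+n (L + Y) k ⟩
    L + Y + k ≡⟨ eq ⟩
    R + X     ∎)
    where open ≤-Reasoning

  infixl 6 _⊹_
  infixr 7 _⊛_

  _⊹_ : ∀ {a b c d} → a ≤ b → c ≤ d → a + c ≤ b + d
  _⊹_ = +-mono-≤

  _⊛_ : ∀ k {a b} → a ≤ b → k * a ≤ k * b
  k ⊛ a≤b = *-monoʳ-≤ k a≤b

  -- Cardinality bounds by codes

  module _ {A : Set} where

    unique-⊆⇒length≤ : ∀ {xs : List A} → Unique xs → ∀ ys → (∀ {x} → x ∈ xs → x ∈ ys) →
                       length xs ≤ length ys
    unique-⊆⇒length≤ []ᵘ ys ⊆ys = z≤n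
    unique-⊆⇒length≤ {x ∷ xs} (x∉ ∷ᵘ u) ys ⊆ys with ∈-∃++ (⊆ys (here refl))
    ... | as , bs , refl = begin
      suc (length xs)             ≤⟨ s≤s (unique-⊆⇒length≤ u (as ++ bs) avoid) ⟩
      suc (length (as ++ bs))     ≡⟨ cong suc (length-++ as) ⟩
      suc (length as + length bs) ≡⟨ +-suc (length as) (length bs) ⟨
      length as + suc (length bs) ≡⟨ length-++ as ⟨
      length (as ++ x ∷ bs)       ∎
      where
      open ≤-Reasoning
      avoid : ∀ {y} → y ∈ xs → y ∈ as ++ bs
      avoid y∈ with ∈-++⁻ as (⊆ys (there y∈))
      ... | inj₁ y∈as         = ∈-++⁺ˡ y∈as
      ... | inj₂ (here refl)  = ⊥-elim (All.lookup x∉ y∈ refl)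
      ... | inj₂ (there y∈bs) = ∈-++⁺ʳ as y∈bs

    -- The bound #Q ≤ K / W, stated without enumerating or deciding `Q`. The factor `W` will be a
    -- power of 16, kept on the left so that everything stays in ℕ.
    Bounded : ℕ → (A → Set) → ℕ → Set
    Bounded W Q K = ∀ xs → Unique xs → All Q xs → W * length xs ≤ K

    -- The empty list satisfies every bound, so facts about the parameters that any element of `Q`
    -- carries, such as 4p ≤ f, may be assumed while bounding `Q`.
    bounded-inhabited : ∀ {W Q K} → (∀ x → Q x → Bounded W Q K) → Bounded W Q K
    bounded-inhabited {W} {K = K} b [] u []ᵃ = ≤-trans (≤-reflexive (*-zeroʳ W)) z≤n
    bounded-inhabited b (x ∷ xs) u (q ∷ᵃ qs) = b x q (x ∷ xs) u (q ∷ᵃ qs)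

    bounded-⊆ : ∀ {W} {P Q : A → Set} {K} → (∀ x → P x → Q x) → Bounded W Q K → Bounded W P K
    bounded-⊆ P⊆Q b xs u ps = b xs u (All.map (P⊆Q _) ps)

    bounded-≤ : ∀ {W} {Q : A → Set} {K L} → K ≤ L → Bounded W Q K → Bounded W Q L
    bounded-≤ K≤L b xs u qs = ≤-trans (b xs u qs) K≤L

    module _ {P Q : A → Set} where

      lefts rights : ∀ {xs} → All (λ x → P x ⊎ Q x) xs → List A
      lefts []ᵃ                    = []
      lefts {x ∷ _} (inj₁ _ ∷ᵃ ps) = x ∷ lefts ps
      lefts (inj₂ _ ∷ᵃ ps)         = lefts ps
      rights []ᵃ                    = []
      rights (inj₁ _ ∷ᵃ ps)         = rights ps
      rights {x ∷ _} (inj₂ _ ∷ᵃ ps) = x ∷ rights ps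

      lefts-all : ∀ {R : A → Set} {xs} (ps : All (λ x → P x ⊎ Q x) xs) → All R xs → All R (lefts ps)
      lefts-all []ᵃ            []ᵃ       = []ᵃ
      lefts-all (inj₁ _ ∷ᵃ ps) (r ∷ᵃ rs) = r ∷ᵃ lefts-all ps rs
      lefts-all (inj₂ _ ∷ᵃ ps) (r ∷ᵃ rs) = lefts-all ps rs

      rights-all : ∀ {R : A → Set} {xs} (ps : All (λ x → P x ⊎ Q x) xs) → All R xs → All R (rights ps)
      rights-all []ᵃ            []ᵃ       = []ᵃ
      rights-all (inj₁ _ ∷ᵃ ps) (r ∷ᵃ rs) = rights-all ps rs
      rights-all (inj₂ _ ∷ᵃ ps) (r ∷ᵃ rs) = r ∷ᵃ rights-all ps rs

      lefts-unique : ∀ {xs} (ps : All (λ x → P x ⊎ Q x) xs) → Unique xs → Unique (lefts ps)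
      lefts-unique []ᵃ            []ᵘ       = []ᵘ
      lefts-unique (inj₁ _ ∷ᵃ ps) (u ∷ᵘ us) = lefts-all ps u ∷ᵘ lefts-unique ps us
      lefts-unique (inj₂ _ ∷ᵃ ps) (u ∷ᵘ us) = lefts-unique ps us

      rights-unique : ∀ {xs} (ps : All (λ x → P x ⊎ Q x) xs) → Unique xs → Unique (rights ps)
      rights-unique []ᵃ            []ᵘ       = []ᵘ
      rights-unique (inj₁ _ ∷ᵃ ps) (u ∷ᵘ us) = rights-unique ps us
      rights-unique (inj₂ _ ∷ᵃ ps) (u ∷ᵘ us) = rights-all ps u ∷ᵘ rights-unique ps us

      lefts-P : ∀ {xs} (ps : All (λ x → P x ⊎ Q x) xs) → All P (lefts ps)
      lefts-P []ᵃ            = []ᵃ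
      lefts-P (inj₁ p ∷ᵃ ps) = p ∷ᵃ lefts-P ps
      lefts-P (inj₂ _ ∷ᵃ ps) = lefts-P ps

      rights-Q : ∀ {xs} (ps : All (λ x → P x ⊎ Q x) xs) → All Q (rights ps)
      rights-Q []ᵃ            = []ᵃ
      rights-Q (inj₁ _ ∷ᵃ ps) = rights-Q ps
      rights-Q (inj₂ q ∷ᵃ ps) = q ∷ᵃ rights-Q ps

      length-split : ∀ {xs} (ps : All (λ x → P x ⊎ Q x) xs) →
                     length xs ≡ length (lefts ps) + length (rights ps)
      length-split []ᵃ            = refl
      length-split (inj₁ _ ∷ᵃ ps) = cong suc (length-split ps)
      length-split (inj₂ _ ∷ᵃ ps) = trans (cong suc (length-split ps)) (sym (+-suc _ _))

      bounded-⊎ : ∀ {W K L} → Bounded W P K → Bounded W Q L → Bounded W (λ x → P x ⊎ Q x) (K + L)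
      bounded-⊎ {W} {K} {L} bP bQ xs u ps = begin
        W * length xs                                    ≡⟨ cong (W *_) (length-split ps) ⟩
        W * (length (lefts ps) + length (rights ps))     ≡⟨ *-distribˡ-+ W (length (lefts ps)) _ ⟩
        W * length (lefts ps) + W * length (rights ps)   ≤⟨ +-mono-≤ (bP _ (lefts-unique ps u) (lefts-P ps)) (bQ _ (rights-unique ps u) (rights-Q ps)) ⟩
        K + L                                            ∎
        where open ≤-Reasoning

    bounded-∃ : ∀ {W K} {Q : ℕ → A → Set} n → (∀ i → Bounded W (Q i) K) →
                Bounded W (λ x → ∃[ i ] i < n × Q i x) (n * K)
    bounded-∃ {W} zero b =
      bounded-inhabited {W = W} λ { _ (_ , () , _) }
    bounded-∃ {W} {K} {Q} (suc n) b =
      bounded-⊆ {W = W} split (bounded-⊎ {W = W} (b n) (bounded-∃ {W} n b))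
      where
      split : ∀ x → (∃[ i ] i < suc n × Q i x) → Q n x ⊎ (∃[ i ] i < n × Q i x)
      split x (i , s≤s i≤n , q) with m≤n⇒m<n∨m≡n i≤n
      ... | inj₁ i<n  = inj₂ (i , i<n , q)
      ... | inj₂ refl = inj₁ q

  length-cartesianProduct : ∀ {A B : Set} (xs : List A) (ys : List B) →
                            length (cartesianProduct xs ys) ≡ length xs * length ys
  length-cartesianProduct []       ys = refl
  length-cartesianProduct (x ∷ xs) ys = trans (length-++ (map (x ,_) ys))
    (cong₂ _+_ (length-map (x ,_) ys) (length-cartesianProduct xs ys))

  -- k ≤ (15/16)ⁿ 2ᵉ
  Rate : ℕ → ℕ → ℕ → Set
  Rate n e k = 16 ^ n * k ≤ 15 ^ n * 2 ^ e

  rate-* : ∀ {n e k n′ e′ k′} → Rate n e k → Rate n′ e′ k′ → Rate (n + n′) (e + e′) (k * k′)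
  rate-* {n} {e} {k} {n′} {e′} {k′} r r′ = begin
    16 ^ (n + n′) * (k * k′)               ≡⟨ cong (_* (k * k′)) (^-distribˡ-+-* 16 n n′) ⟩
    16 ^ n * 16 ^ n′ * (k * k′)            ≡⟨ [m*n]*[o*p]≡[m*o]*[n*p] (16 ^ n) (16 ^ n′) k k′ ⟩
    (16 ^ n * k) * (16 ^ n′ * k′)          ≤⟨ *-mono-≤ r r′ ⟩
    (15 ^ n * 2 ^ e) * (15 ^ n′ * 2 ^ e′)  ≡⟨ [m*n]*[o*p]≡[m*o]*[n*p] (15 ^ n) (2 ^ e) (15 ^ n′) (2 ^ e′) ⟩
    15 ^ n * 15 ^ n′ * (2 ^ e * 2 ^ e′)    ≡⟨ cong₂ _*_ (^-distribˡ-+-* 15 n n′) (^-distribˡ-+-* 2 e e′) ⟨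
    15 ^ (n + n′) * 2 ^ (e + e′)           ∎
    where open ≤-Reasoning

  rate-weaken : ∀ {n n′ e e′ k} → n′ ≤ n → e ≤ e′ → Rate n e k → Rate n′ e′ k
  rate-weaken {n} {n′} {e} {e′} {k} n′≤n e≤e′ r with m≤n⇒∃[o]m+o≡n n′≤n
  ... | d , refl = *-cancelˡ-≤ (16 ^ d) (begin
    16 ^ d * (16 ^ n′ * k)        ≡⟨ *-assoc (16 ^ d) (16 ^ n′) k ⟨
    16 ^ d * 16 ^ n′ * k          ≡⟨ cong (_* k) (trans (*-comm (16 ^ d) (16 ^ n′)) (sym (^-distribˡ-+-* 16 n′ d))) ⟩
    16 ^ (n′ + d) * k             ≤⟨ r ⟩
    15 ^ (n′ + d) * 2 ^ e         ≡⟨ cong (_* 2 ^ e) (trans (^-distribˡ-+-* 15 n′ d) (*-comm (15 ^ n′) (15 ^ d))) ⟩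
    15 ^ d * 15 ^ n′ * 2 ^ e      ≡⟨ *-assoc (15 ^ d) (15 ^ n′) (2 ^ e) ⟩
    15 ^ d * (15 ^ n′ * 2 ^ e)    ≤⟨ *-mono-≤ (^-monoˡ-≤ d (n≤1+n 15)) (*-monoʳ-≤ (15 ^ n′) (^-monoʳ-≤ 2 e≤e′)) ⟩
    16 ^ d * (15 ^ n′ * 2 ^ e′)   ∎)
    where
    open ≤-Reasoning
    instance
      16^d≢0 : NonZero (16 ^ d)
      16^d≢0 = m^n≢0 16 d

  -- Code words need only determine an element up to O, so that codes for
  -- different parts of a semigroup can be combined.
  record Code {A : Set} (Q : A → Set) (O : A → A → Set) (n e : ℕ) : Set₁ where
    field
      {Word}  : Set
      encode  : A → Word
      words   : List Word
      encode∈ : ∀ {x} → Q x → encode x ∈ words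
      decode  : ∀ {x y} → Q x → Q y → encode x ≡ encode y → O x y
      few     : Rate n e (length words)

  open Code

  module _ {A : Set} {Q : A → Set} where

    code-weaken : ∀ {O O′ : A → A → Set} {n e} → (∀ {x y} → Q x → Q y → O x y → O′ x y) →
                  Code Q O n e → Code Q O′ n e
    code-weaken f c = record
      { encode = encode c ; words = words c ; encode∈ = encode∈ c
      ; decode = λ qx qy eq → f qx qy (decode c qx qy eq) ; few = few c }

    code-relax : ∀ {O : A → A → Set} {n e n′ e′} → n′ ≤ n → e ≤ e′ → Code Q O n e → Code Q O n′ e′
    code-relax {n = n} {e} {n′} {e′} n′≤n e≤e′ c = record
      { encode = encode c ; words = words c ; encode∈ = encode∈ c ; decode = decode c
      ; few = rate-weaken {n} {n′} {e} {e′} n′≤n e≤e′ (few c) }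

    code-× : ∀ {O O′ : A → A → Set} {n e n′ e′} → Code Q O n e → Code Q O′ n′ e′ →
             Code Q (λ x y → O x y × O′ x y) (n + n′) (e + e′)
    code-× {n = n} {e} {n′} {e′} c d = record
      { encode  = λ x → encode c x , encode d x
      ; words   = cartesianProduct (words c) (words d)
      ; encode∈ = λ q → ∈-cartesianProduct⁺ (encode∈ c q) (encode∈ d q)
      ; decode  = λ qx qy eq → decode c qx qy (cong proj₁ eq) , decode d qx qy (cong proj₂ eq)
      ; few     = subst (Rate (n + n′) (e + e′)) (sym (length-cartesianProduct (words c) (words d)))
                    (rate-* {n} {e} {_} {n′} {e′} (few c) (few d))
      }

    code-⊤ : Code Q (λ _ _ → ⊤) 0 0
    code-⊤ = record
      { encode = λ _ → tt ; words = tt ∷ [] ; encode∈ = λ _ → here refl ; decode = λ _ _ _ → tt ; few = ≤-refl }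

    code-∀ : ∀ {O : ℕ → A → A → Set} {n e} k → (∀ i → i < k → Code Q (O i) n e) →
             Code Q (λ x y → ∀ i → i < k → O i x y) (k * n) (k * e)
    code-∀ zero    c = code-weaken (λ _ _ _ i ()) code-⊤
    code-∀ {O} (suc k) c = code-weaken combine (code-× (c k ≤-refl) (code-∀ k (λ i i<k → c i (m<n⇒m<1+n i<k))))
      where
      combine : ∀ {x y} → Q x → Q y → O k x y × (∀ i → i < k → O i x y) → ∀ i → i < suc k → O i x y
      combine _ _ (o , os) i (s≤s i≤k) with m≤n⇒m<n∨m≡n i≤k
      ... | inj₁ i<k  = os i i<k
      ... | inj₂ refl = o

    -- For a concrete finite `all` the number of words that pass the test is found by evaluation,
    -- which settles the `Rate` hypothesis.
    code-test : ∀ {X : Set} {n e} (obs : A → X) (all : List X) → (∀ x → x ∈ all) → (test : X → Bool) →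
                (∀ {v} → Q v → test (obs v) ≡ true) → Rate n e (length (filterᵇ test all)) →
                Code Q (λ v w → obs v ≡ obs w) n e
    code-test {X} obs all complete test ok r = record
      { encode = obs ; words = filterᵇ test all ; encode∈ = λ {v} q → keep all (complete (obs v)) (ok q)
      ; decode = λ _ _ eq → eq ; few = r }
      where
      keep : ∀ xs {x} → x ∈ xs → test x ≡ true → x ∈ filterᵇ test xs
      keep (y ∷ xs) (here refl) t with test y | t
      ... | true | _ = here refl
      keep (y ∷ xs) (there x∈) t with test y
      ... | true  = there (keep xs x∈ t)
      ... | false = keep xs x∈ t

    code⇒bounded : ∀ {n e n′ e′} → Code Q _≡_ n e → n′ ≤ n → e ≤ e′ → Bounded (16 ^ n′) Q (15 ^ n′ * 2 ^ e′)
    code⇒bounded {n} {e} {n′} {e′} c n′≤n e≤e′ xs u qs = begin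
      16 ^ n′ * length xs           ≤⟨ *-monoʳ-≤ (16 ^ n′) length≤ ⟩
      16 ^ n′ * length (words c)    ≤⟨ rate-weaken {n} {n′} {e} {e′} n′≤n e≤e′ (few c) ⟩
      15 ^ n′ * 2 ^ e′              ∎
      where
      open ≤-Reasoning
      row : ∀ {x ys} → Q x → All Q ys → All (x ≢_) ys → All (encode c x ≢_) (map (encode c) ys)
      row qx []ᵃ       []ᵃ       = []ᵃ
      row qx (q ∷ᵃ qs) (n ∷ᵃ ns) = (λ eq → n (decode c qx q eq)) ∷ᵃ row qx qs ns
      codes-unique : ∀ {ys} → All Q ys → Unique ys → Unique (map (encode c) ys)
      codes-unique []ᵃ       []ᵘ       = []ᵘ
      codes-unique (q ∷ᵃ qs) (u ∷ᵘ us) = row q qs u ∷ᵘ codes-unique qs us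
      codes-∈ : ∀ {ys} → All Q ys → ∀ {w} → w ∈ map (encode c) ys → w ∈ words c
      codes-∈ (q ∷ᵃ qs) (here refl) = encode∈ c q
      codes-∈ (q ∷ᵃ qs) (there w∈)  = codes-∈ qs w∈
      length≤ : length xs ≤ length (words c)
      length≤ = subst (_≤ length (words c)) (length-map (encode c) xs)
                  (unique-⊆⇒length≤ (codes-unique qs u) (words c) (codes-∈ qs))

  ⌊/2⌋-lower : ∀ n → 2 * ⌊ n /2⌋ ≤ n
  ⌊/2⌋-lower zero          = z≤n
  ⌊/2⌋-lower (suc zero)    = z≤n
  ⌊/2⌋-lower (suc (suc n)) = ≤-trans (≤-reflexive (step ⌊ n /2⌋)) (s≤s (s≤s (⌊/2⌋-lower n)))
    where
    step : ∀ h → 2 * suc h ≡ suc (suc (2 * h))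
    step = solve-∀

  ⌊/2⌋-upper : ∀ n → n ≤ 2 * ⌊ n /2⌋ + 1
  ⌊/2⌋-upper zero          = z≤n
  ⌊/2⌋-upper (suc zero)    = ≤-refl
  ⌊/2⌋-upper (suc (suc n)) = ≤-trans (s≤s (s≤s (⌊/2⌋-upper n))) (≤-reflexive (step ⌊ n /2⌋))
    where
    step : ∀ h → suc (suc (2 * h + 1)) ≡ 2 * suc h + 1
    step = solve-∀

  2*≤⇒≤⌊/2⌋ : ∀ k {n} → 2 * k ≤ n → k ≤ ⌊ n /2⌋
  2*≤⇒≤⌊/2⌋ k le = subst (_≤ _) (trans (cong ⌊_/2⌋ (cong (k +_) (+-identityʳ k))) (sym (n≡⌊n+n/2⌋ k))) (⌊n/2⌋-mono le)

  below-or-above : ∀ j x → j < x ⊎ ∃[ d ] j ≡ x + d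
  below-or-above j x with j <? x
  ... | yes j<x = inj₁ j<x
  ... | no j≮x with m≤n⇒∃[o]m+o≡n (≮⇒≥ j≮x)
  ...   | d , refl = inj₂ (d , refl)

  ∸-suc-involutive : ∀ {d n} → d < n → n ∸ suc (n ∸ suc d) ≡ d
  ∸-suc-involutive {d} d<n with m≤n⇒∃[o]m+o≡n d<n
  ... | k , refl rewrite m+n∸m≡n d k = m+n∸n≡m d k

  least : (b : ℕ → Bool) → ∀ N →
          (∃[ z ] z < N × b z ≡ true × (∀ y → y < z → b y ≡ false)) ⊎ (∀ z → z < N → b z ≡ false)
  least b zero = inj₂ λ z ()
  least b (suc N) with least b N
  ... | inj₁ (z , z<N , b≡ , low) = inj₁ (z , m<n⇒m<1+n z<N , b≡ , low)
  ... | inj₂ none with b N in eq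
  ...   | true  = inj₁ (N , ≤-refl , eq , none)
  ...   | false = inj₂ λ z z≤N → case (m≤n⇒m<n∨m≡n (≤-pred z≤N))
    where
    case : ∀ {z} → z < N ⊎ z ≡ N → b z ≡ false
    case (inj₁ z<N)  = none _ z<N
    case (inj₂ refl) = eq

  -- Sides and chains

  -- The side of z is L (lower) if z ∈ Λ, U (upper) if f - z ∈ Λ, and O if neither
  -- holds; both cannot hold since f ∉ Λ.
  data Side : Set where
    U O L : Side

  isL isU : Side → Bool
  isL L = true
  isL _ = false
  isU U = true
  isU _ = false

  _≼_ : Side → Side → Bool
  U ≼ _ = true
  O ≼ t = not (isU t)
  L ≼ t = isL t

  side : Bool → Bool → Side
  side true  _     = L
  side false true  = U
  side false false = O

  record Semigroup (f : ℕ) (χ : ℕ → Bool) : Set where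
    field
      zero∈ : χ 0 ≡ true
      add   : ∀ {x y} → χ x ≡ true → χ y ≡ true → χ (x + y) ≡ true
      f∉    : χ f ≡ false

    exclusive : ∀ {x y} → x + y ≡ f → χ x ≡ true → χ y ≡ false
    exclusive {x} {y} refl x∈ with χ y in eq
    ... | false = refl
    ... | true with trans (sym (add {x} {y} x∈ eq)) f∉
    ...   | ()

    multiple : ∀ {x} → χ x ≡ true → ∀ k → χ (k * x) ≡ true
    multiple x∈ zero    = zero∈
    multiple x∈ (suc k) = add x∈ (multiple x∈ k)

  true≢false : ∀ {b} → b ≡ true → b ≡ false → ⊥
  true≢false refl ()

  -- `side` ignores its second argument once the first is `true`; the exclusivity hypotheses recover
  -- it.
  side-injective : ∀ {a b c d} → (a ≡ true → b ≡ false) → (c ≡ true → d ≡ false) →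
                   side a b ≡ side c d → a ≡ c × b ≡ d
  side-injective {true}  {true}  {_}     {_}     h k eq = ⊥-elim (true≢false refl (h refl))
  side-injective {_}     {_}     {true}  {true}  h k eq = ⊥-elim (true≢false refl (k refl))
  side-injective {true}  {false} {true}  {false} h k eq = refl , refl
  side-injective {true}  {false} {false} {true}  h k ()
  side-injective {true}  {false} {false} {false} h k ()
  side-injective {false} {true}  {true}  {false} h k ()
  side-injective {false} {false} {true}  {false} h k ()
  side-injective {false} {true}  {false} {true}  h k eq = refl , refl
  side-injective {false} {true}  {false} {false} h k ()
  side-injective {false} {false} {false} {true}  h k ()
  side-injective {false} {false} {false} {false} h k eq = refl , refl

  module Sides (f : ℕ) where

    sideAt : (ℕ → Bool) → ℕ → Side
    sideAt χ z = side (χ z) (χ (f ∸ z))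

    module _ (χ : ℕ → Bool) where

      sideAt-notL : ∀ {z} → χ z ≡ false → not (isL (sideAt χ z)) ≡ true
      sideAt-notL {z} z∉ with χ z | χ (f ∸ z)
      sideAt-notL z∉ | false | true  = refl
      sideAt-notL z∉ | false | false = refl

      sideAt-notU : ∀ {z} → χ (f ∸ z) ≡ false → not (isU (sideAt χ z)) ≡ true
      sideAt-notU {z} y∉ with χ z | χ (f ∸ z)
      sideAt-notU y∉ | true  | false = refl
      sideAt-notU y∉ | false | false = refl

      sideAt-L : ∀ {z} → isL (sideAt χ z) ≡ true → χ z ≡ true
      sideAt-L {z} l with χ z | χ (f ∸ z)
      sideAt-L l  | true  | _     = refl
      sideAt-L () | false | true
      sideAt-L () | false | false

    module _ {χ : ℕ → Bool} (Λ : Semigroup f χ) where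
      open Semigroup Λ

      -- Adding p keeps z in Λ, so L persists upwards. Dually f - (z + p) ∈ Λ gives f - z ∈ Λ, so U
      -- persists downwards.
      sideAt-≼ : ∀ {p z} → χ p ≡ true → z + p ≤ f → (sideAt χ z ≼ sideAt χ (z + p)) ≡ true
      sideAt-≼ {p} {z} p∈ z+p≤f with χ z in z∈ | χ (f ∸ z) in y∈ | χ (z + p) in zp∈ | χ (f ∸ (z + p)) in yp∈
      ... | true  | _     | true  | _     = refl
      ... | true  | _     | false | _     = ⊥-elim (true≢false (add {z} z∈ p∈) zp∈)
      ... | false | true  | _     | _     = refl
      ... | false | false | true  | _     = refl
      ... | false | false | false | false = refl
      ... | false | false | false | true  =
        ⊥-elim (true≢false (subst (λ t → χ t ≡ true) eq (add yp∈ p∈)) y∈)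
        where
        eq : f ∸ (z + p) + p ≡ f ∸ z
        eq = trans (cong (_+ p) (sym (∸-+-assoc f z p))) (m∸n+n≡m (m+n≤o⇒n≤o∸m z z+p≤f))
          where
          m+n≤o⇒n≤o∸m : ∀ m {n o} → m + n ≤ o → n ≤ o ∸ m
          m+n≤o⇒n≤o∸m m {n} le = subst (_≤ _ ∸ m) (m+n∸m≡n m n) (∸-monoˡ-≤ m le)

      sideAt-U : ∀ {z} → z ≤ f → χ (f ∸ z) ≡ true → isU (sideAt χ z) ≡ true
      sideAt-U {z} z≤f y∈ with χ z in z∈ | χ (f ∸ z) in eq
      ... | false | true = refl
      ... | true  | true = ⊥-elim (true≢false eq (exclusive {z} (m+[n∸m]≡n z≤f) z∈))
      sideAt-U z≤f () | _ | false

    module _ {χ ψ : ℕ → Bool} (Λ : Semigroup f χ) (Λ′ : Semigroup f ψ) where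

      sideAt-agree : ∀ {z y} → z + y ≡ f → sideAt χ z ≡ sideAt ψ z → χ z ≡ ψ z × χ y ≡ ψ y
      sideAt-agree {z} {y} refl eq rewrite m+n∸m≡n z y =
        side-injective (Semigroup.exclusive Λ refl) (Semigroup.exclusive Λ′ refl) eq

    chain : (ℕ → Bool) → ℕ → ℕ → ∀ N → Vec Side N
    chain χ p i zero    = []ᵛ
    chain χ p i (suc N) = sideAt χ i ∷ᵛ chain χ p (i + p) N

    chain-agree : ∀ {χ ψ} {p} i N → chain χ p i N ≡ chain ψ p i N →
                  ∀ t → t < N → sideAt χ (i + t * p) ≡ sideAt ψ (i + t * p)
    chain-agree i (suc N) eq zero    _ rewrite +-identityʳ i = cong (λ { (x ∷ᵛ _) → x }) eq
    chain-agree {χ} {ψ} {p} i (suc N) eq (suc t) (s≤s t<N) =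
      subst (λ z → sideAt χ z ≡ sideAt ψ z) (+-assoc i p (t * p))
        (chain-agree (i + p) N (cong (λ { (_ ∷ᵛ xs) → xs }) eq) t t<N)

    -- Every residue class mod p, or its reflection under z ↦ f - z, has a
    -- representative i with 0 < 2i ≤ r or 2r < 2i ≤ p + r, except for the classes
    -- of 0 and of f, which lie inside and outside the semigroup.
    module _ {χ ψ : ℕ → Bool} (Λ : Semigroup f χ) (Λ′ : Semigroup f ψ)
             {p q r : ℕ} (p∈ : χ p ≡ true) (p∈′ : ψ p ≡ true)
             (r<p : r < p) (f≡ : f ≡ r + q * p) where

      chains-determine :
        (∀ i → 0 < i → 2 * i ≤ r → chain χ p i (suc q) ≡ chain ψ p i (suc q)) →
        (∀ i → r < i → 2 * i ≤ p + r → chain χ p i q ≡ chain ψ p i q) →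
        ∀ z → z ≤ f → χ z ≡ ψ z
      chains-determine low high z z≤f = subst (λ z → χ z ≡ ψ z) (sym z≡)
          (go (z % p) (z / p) (m%n<n z p) (subst (_≤ f) z≡ z≤f))
        where
        instance
          p≢0 : NonZero p
          p≢0 = >-nonZero (≤-<-trans z≤n r<p)
        z≡ : z ≡ z % p + z / p * p
        z≡ = m≡m%n+[m/n]*n z p

        -- A residue at most r has q + 1 members up to f, a larger one only q; hence the two chain
        -- lengths.
        t≤q : ∀ i t → i + t * p ≤ f → t ≤ q
        t≤q i t le = ≤-pred (*-cancelʳ-< p t (suc q) (begin-strict
          t * p     ≤⟨ m≤n+m (t * p) i ⟩
          i + t * p ≤⟨ le ⟩
          f         ≡⟨ f≡ ⟩
          r + q * p <⟨ +-monoˡ-< (q * p) r<p ⟩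
          p + q * p ∎))
          where open ≤-Reasoning

        t<q : ∀ i t → r < i → i + t * p ≤ f → t < q
        t<q i t r<i le = *-cancelʳ-< p t q (+-cancelˡ-< i _ _ (begin-strict
          i + t * p ≤⟨ le ⟩
          f         ≡⟨ f≡ ⟩
          r + q * p <⟨ +-monoˡ-< (q * p) r<i ⟩
          i + q * p ∎))
          where open ≤-Reasoning

        reflected : ∀ {i j t u N} → j + u * p + (i + t * p) ≡ f → chain χ p j N ≡ chain ψ p j N → u < N →
                    χ (i + t * p) ≡ ψ (i + t * p)
        reflected {j = j} {u = u} {N} eq same u<N =
          proj₂ (sideAt-agree Λ Λ′ {j + u * p} eq (chain-agree j N same u u<N))

        outside : ∀ {χ} → Semigroup f χ → χ p ≡ true → ∀ t → t ≤ q → χ (r + t * p) ≡ false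
        outside Λ p∈ t t≤q with m≤n⇒∃[o]m+o≡n t≤q
        ... | u , refl = Semigroup.exclusive Λ {u * p}
          (trans reorder (sym f≡)) (Semigroup.multiple Λ p∈ u)
          where
          reorder : u * p + (r + t * p) ≡ r + (t + u) * p
          reorder = solve (u ∷ p ∷ r ∷ t ∷ [])

        go : ∀ i t → i < p → i + t * p ≤ f → χ (i + t * p) ≡ ψ (i + t * p)
        go zero t _ _ = trans (Semigroup.multiple Λ p∈ t) (sym (Semigroup.multiple Λ′ p∈′ t))
        go i@(suc _) t i<p le with <-cmp i r
        ... | tri≈ _ refl _ = trans (outside Λ p∈ t (t≤q i t le)) (sym (outside Λ′ p∈′ t (t≤q i t le)))
        ... | tri< i<r _ _ with 2 * i ≤? r
        ...   | yes 2i≤r = proj₁ (sideAt-agree Λ Λ′ {i + t * p} (m+[n∸m]≡n le)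
                  (chain-agree i (suc q) (low i (s≤s z≤n) 2i≤r) t (s≤s (t≤q i t le))))
        ...   | no 2i≰r with m≤n⇒∃[o]m+o≡n (<⇒≤ i<r) | m≤n⇒∃[o]m+o≡n (t≤q i t le)
        ...     | j , eq | u , refl = reflected {i} {j} {t} {u} (trans (reorder {i} {j} eq) (sym f≡))
                    (low j (0<j eq) (half {i} {j} eq (≰⇒> 2i≰r))) (s≤s (m≤n+m u t))
          where
          reorder : ∀ {i j} → i + j ≡ r → j + u * p + (i + t * p) ≡ r + (t + u) * p
          reorder {i} {j} refl = solve (i ∷ j ∷ t ∷ u ∷ p ∷ [])
          0<j : ∀ {j} → i + j ≡ r → 0 < j
          0<j {zero}  eq = ⊥-elim (<-irrefl (trans (sym (+-identityʳ i)) eq) i<r)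
          0<j {suc j} _  = s≤s z≤n
          half : ∀ {i j} → i + j ≡ r → r < 2 * i → 2 * j ≤ r
          half {i} {j} refl r<2i = linear-≤ 1 r<2i (solve (i ∷ j ∷ []))
        go i@(suc _) t i<p le | tri> _ _ r<i with 2 * i ≤? p + r
        ...   | yes 2i≤ = proj₁ (sideAt-agree Λ Λ′ {i + t * p} (m+[n∸m]≡n le)
                  (chain-agree i q (high i r<i 2i≤) t (t<q i t r<i le)))
        ...   | no 2i≰ with m≤n⇒∃[o]m+o≡n (≤-trans (<⇒≤ i<p) (m≤m+n p r)) | m≤n⇒∃[o]m+o≡n (t<q i t r<i le)
        ...     | j , eq | u , refl = reflected {i} {j} {t} {u} (trans (reorder {i} {j} eq) (sym f≡))
                    (high j (r<j {i} {j} eq i<p) (half {i} {j} eq (≰⇒> 2i≰))) (s≤s (m≤n+m u t))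
          where
          reorder : ∀ {i j} → i + j ≡ p + r → j + u * p + (i + t * p) ≡ r + suc (t + u) * p
          reorder {i} {j} eq = begin
            j + u * p + (i + t * p) ≡⟨ solve (i ∷ j ∷ t ∷ u ∷ p ∷ []) ⟩
            i + j + (t + u) * p     ≡⟨ cong (_+ (t + u) * p) eq ⟩
            p + r + (t + u) * p     ≡⟨ solve (r ∷ t ∷ u ∷ p ∷ []) ⟩
            r + (p + (t + u) * p)   ∎
            where open ≡-Reasoning
          r<j : ∀ {i j} → i + j ≡ p + r → i < p → r < j
          r<j {i} {j} eq i<p = linear-≤ 0 (i<p ⊹ ≤-reflexive (sym eq)) (solve (i ∷ j ∷ p ∷ r ∷ []))
          half : ∀ {i j} → i + j ≡ p + r → p + r < 2 * i → 2 * j ≤ p + r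
          half {i} {j} eq lt = linear-≤ 1 (lt ⊹ 2 ⊛ ≤-reflexive eq) (solve (i ∷ j ∷ p ∷ r ∷ []))

  -- The weakly increasing words for U < O < L whose letters are all at least the named side; there
  -- are 1, N + 1 and (N + 1)(N + 2)/2 of them.
  ascendingL ascendingO ascendingU : ∀ N → List (Vec Side N)
  ascendingL zero    = []ᵛ ∷ []
  ascendingL (suc N) = map (L ∷ᵛ_) (ascendingL N)
  ascendingO zero    = []ᵛ ∷ []
  ascendingO (suc N) = map (O ∷ᵛ_) (ascendingO N) ++ ascendingL (suc N)
  ascendingU zero    = []ᵛ ∷ []
  ascendingU (suc N) = map (U ∷ᵛ_) (ascendingU N) ++ ascendingO (suc N)

  ascending : Side → ∀ N → List (Vec Side N)
  ascending U = ascendingU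
  ascending O = ascendingO
  ascending L = ascendingL

  length-ascending-L : ∀ N → length (ascendingL N) ≡ 1
  length-ascending-L zero    = refl
  length-ascending-L (suc N) = trans (length-map _ (ascendingL N)) (length-ascending-L N)

  length-ascending-O : ∀ N → length (ascendingO (suc N)) ≡ length (ascendingO N) + 1
  length-ascending-O N = trans (length-++ (map (O ∷ᵛ_) (ascendingO N)))
    (cong₂ _+_ (length-map _ (ascendingO N)) (length-ascending-L (suc N)))

  length-ascending-U : ∀ N → length (ascendingU (suc N)) ≡ length (ascendingU N) + length (ascendingO (suc N))
  length-ascending-U N = trans (length-++ (map (U ∷ᵛ_) (ascendingU N))) (cong (_+ length (ascendingO (suc N))) (length-map _ (ascendingU N)))

  -- Length 4 is the first at which the count drops below 2^N, namely 15 against 16 (10 against 8 at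
  -- length 3). From there on each step at most doubles the counts.
  ascending-bound : ∀ N → length (ascendingO (4 + N)) ≤ 5 * 2 ^ N × length (ascendingU (4 + N)) ≤ 15 * 2 ^ N
  ascending-bound zero    = ≤-refl , ≤-refl
  ascending-bound (suc N) with ascending-bound N
  ... | bO , bU = bO′ , (begin
      length (ascendingU (5 + N))                                ≡⟨ length-ascending-U (4 + N) ⟩
      length (ascendingU (4 + N)) + length (ascendingO (5 + N)) ≤⟨ bU ⊹ bO′ ⟩
      15 * 2 ^ N + 5 * (2 * 2 ^ N)                                ≤⟨ m≤m+n _ (5 * 2 ^ N) ⟩
      15 * 2 ^ N + 5 * (2 * 2 ^ N) + 5 * 2 ^ N                    ≡⟨ collect (2 ^ N) ⟩
      15 * (2 * 2 ^ N)                                            ∎)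
    where
    open ≤-Reasoning
    collect : ∀ x → 15 * x + 5 * (2 * x) + 5 * x ≡ 15 * (2 * x)
    collect = solve-∀
    bO′ : length (ascendingO (5 + N)) ≤ 5 * 2 ^ suc N
    bO′ = begin
      length (ascendingO (5 + N))     ≡⟨ length-ascending-O (4 + N) ⟩
      length (ascendingO (4 + N)) + 1 ≤⟨ bO ⊹ ≤-trans (m^n>0 2 N) (m≤n*m (2 ^ N) 5) ⟩
      5 * 2 ^ N + 5 * 2 ^ N            ≡⟨ double (2 ^ N) ⟩
      5 * (2 * 2 ^ N)                  ∎
      where
      double : ∀ x → 5 * x + 5 * x ≡ 5 * (2 * x)
      double = solve-∀

  ascending-rate : ∀ N → 4 ≤ N → Rate 1 N (length (ascendingU N))
  ascending-rate N 4≤N with m≤n⇒∃[o]m+o≡n 4≤N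
  ... | k , refl = begin
    16 * length (ascendingU (4 + k)) ≤⟨ 16 ⊛ proj₂ (ascending-bound k) ⟩
    16 * (15 * 2 ^ k)                 ≡⟨ shuffle (2 ^ k) ⟩
    15 * (2 * (2 * (2 * (2 * 2 ^ k)))) ∎
    where
    open ≤-Reasoning
    shuffle : ∀ x → 16 * (15 * x) ≡ 15 * (2 * (2 * (2 * (2 * x))))
    shuffle = solve-∀

  module Chains (f : ℕ) where
    open Sides f public

    -- The bound i + N p ≤ f + p says, without subtraction, that the last position i + (N - 1) p is
    -- at most f.
    chain∈ascending : ∀ {χ p} → Semigroup f χ → χ p ≡ true → ∀ N i s → (s ≼ sideAt χ i) ≡ true →
                      i + N * p ≤ f + p → chain χ p i N ∈ ascending s N
    chain∈ascending Λ p∈ zero    i U s≼ le = here refl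
    chain∈ascending Λ p∈ zero    i O s≼ le = here refl
    chain∈ascending Λ p∈ zero    i L s≼ le = here refl
    chain∈ascending {χ} {p} Λ p∈ (suc N) i s s≼ le = place s (sideAt χ i) s≼ (tail N le)
      where
      placeO : ∀ {xs} t → (O ≼ t) ≡ true → xs ∈ ascending t N → (t ∷ᵛ xs) ∈ ascendingO (suc N)
      placeO O _ xs∈ = ∈-++⁺ˡ (∈-map⁺ (O ∷ᵛ_) xs∈)
      placeO L _ xs∈ = ∈-++⁺ʳ (map (O ∷ᵛ_) (ascendingO N)) (∈-map⁺ (L ∷ᵛ_) xs∈)
      place : ∀ {xs} s t → (s ≼ t) ≡ true → xs ∈ ascending t N → (t ∷ᵛ xs) ∈ ascending s (suc N)
      place U U _  xs∈ = ∈-++⁺ˡ (∈-map⁺ (U ∷ᵛ_) xs∈)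
      place U O _  xs∈ = ∈-++⁺ʳ (map (U ∷ᵛ_) (ascendingU N)) (placeO O refl xs∈)
      place U L _  xs∈ = ∈-++⁺ʳ (map (U ∷ᵛ_) (ascendingU N)) (placeO L refl xs∈)
      place O t s≼ xs∈ = placeO t s≼ xs∈
      place L L _  xs∈ = ∈-map⁺ (L ∷ᵛ_) xs∈
      []∈ : ∀ t → []ᵛ ∈ ascending t 0
      []∈ U = here refl
      []∈ O = here refl
      []∈ L = here refl
      tail : ∀ N → i + suc N * p ≤ f + p → chain χ p (i + p) N ∈ ascending (sideAt χ i) N
      tail zero    _  = []∈ (sideAt χ i)
      tail (suc M) le = chain∈ascending Λ p∈ (suc M) (i + p) (sideAt χ i) (sideAt-≼ Λ p∈ i+p≤f)
                          (≤-trans (≤-reflexive (+-assoc i p (suc M * p))) le)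
        where
        i+p≤f : i + p ≤ f
        i+p≤f = linear-≤ (M * p) le (solve (i ∷ M ∷ p ∷ f ∷ []))

    module Family {A : Set} (χ : A → ℕ → Bool)
                  (determined : ∀ {v w} → (∀ z → z ≤ f → χ v z ≡ χ w z) → v ≡ w) where

      SameChain : ℕ → ℕ → ℕ → A → A → Set
      SameChain p N i v w = chain (χ v) p i N ≡ chain (χ w) p i N

      module _ {Q : A → Set} {p q r : ℕ} (Q⇒Λ : ∀ {v} → Q v → Semigroup f (χ v)) (Q⇒p∈ : ∀ {v} → Q v → χ v p ≡ true)
               (r<p : r < p) (f≡ : f ≡ r + q * p) where

        code-of-chains : ∀ {n e n′ e′} →
          Code Q (λ v w → ∀ i → i < ⌊ r /2⌋ → SameChain p (suc q) (1 + i) v w) n e →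
          Code Q (λ v w → ∀ i → i < ⌊ p ∸ r /2⌋ → SameChain p q (suc r + i) v w) n′ e′ →
          Code Q _≡_ (n + n′) (e + e′)
        code-of-chains c d = code-weaken (λ {v} {w} qv qw (low , high) → determined {v} {w}
          (chains-determine (Q⇒Λ qv) (Q⇒Λ qw) (Q⇒p∈ qv) (Q⇒p∈ qw) r<p f≡
            (λ { (suc i) _ 2i≤r → low i (2*≤⇒≤⌊/2⌋ (suc i) 2i≤r) })
            (λ i r<i 2i≤ → subst (λ i → SameChain p q i v w) (m+[n∸m]≡n r<i) (high (i ∸ suc r) (gap-half i r<i 2i≤)))))
          (code-× c d)
          where
          gap-half : ∀ i → r < i → 2 * i ≤ p + r → i ∸ suc r < ⌊ p ∸ r /2⌋
          gap-half i r<i 2i≤ with m≤n⇒∃[o]m+o≡n r<i | m≤n⇒∃[o]m+o≡n (<⇒≤ r<p)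
          ... | j , refl | k , refl rewrite m+n∸m≡n (suc r) j | m+n∸m≡n r k =
            2*≤⇒≤⌊/2⌋ (suc j) (linear-≤ 0 2i≤ (solve (r ∷ j ∷ k ∷ [])))

      ascending-code : ∀ {Q : A → Set} {p N i} → (∀ {v} → Q v → Semigroup f (χ v)) → (∀ {v} → Q v → χ v p ≡ true) →
                       4 ≤ N → i + N * p ≤ f + p → Code Q (SameChain p N i) 1 N
      ascending-code {Q} {p} {N} {i} Q⇒Λ Q⇒p∈ 4≤N le = record
        { encode  = λ v → chain (χ v) p i N
        ; words   = ascendingU N
        ; encode∈ = λ qv → chain∈ascending (Q⇒Λ qv) (Q⇒p∈ qv) N i U refl le
        ; decode  = λ _ _ eq → eq
        ; few     = ascending-rate N 4≤N
        }

  allSides : ∀ N → List (Vec Side N)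
  allSides zero    = []ᵛ ∷ []
  allSides (suc N) = map (U ∷ᵛ_) (allSides N) ++ map (O ∷ᵛ_) (allSides N) ++ map (L ∷ᵛ_) (allSides N)

  allSides-complete : ∀ {N} (v : Vec Side N) → v ∈ allSides N
  allSides-complete []ᵛ      = here refl
  allSides-complete (U ∷ᵛ v) = ∈-++⁺ˡ (∈-map⁺ _ (allSides-complete v))
  allSides-complete (O ∷ᵛ v) = ∈-++⁺ʳ (map (U ∷ᵛ_) (allSides _)) (∈-++⁺ˡ (∈-map⁺ _ (allSides-complete v)))
  allSides-complete (L ∷ᵛ v) = ∈-++⁺ʳ (map (U ∷ᵛ_) (allSides _)) (∈-++⁺ʳ (map (O ∷ᵛ_) (allSides _)) (∈-map⁺ _ (allSides-complete v)))

  _implies_ : Bool → Bool → Bool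
  true  implies b = b
  false implies _ = true

  implies-true : ∀ a {b} → (a ≡ true → b ≡ true) → (a implies b) ≡ true
  implies-true true  h = h refl
  implies-true false h = refl

  _∧ᵗ_ : ∀ {a b} → a ≡ true → b ≡ true → a ∧ b ≡ true
  refl ∧ᵗ refl = refl
  infixr 6 _∧ᵗ_

  -- In these tests the first side is that of some 0 < z < m and the last that of
  -- some z with 0 < f - z < m, where m is the multiplicity.
  pairTest : Vec Side 2 → Bool
  pairTest (x ∷ᵛ y ∷ᵛ []ᵛ) = not (isL x) ∧ not (isU y)

  tripleTest : Side → Side → Side → Bool
  tripleTest x y z = not (isL x) ∧ (x ≼ y) ∧ (y ≼ z) ∧ not (isU z)

  tripleTest′ sparseTest : Vec Side 3 → Bool
  tripleTest′ (x ∷ᵛ y ∷ᵛ z ∷ᵛ []ᵛ) = tripleTest x y z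
  sparseTest (x ∷ᵛ y ∷ᵛ z ∷ᵛ []ᵛ) = not (isL y) ∧ tripleTest x y z

  quadrupleTest : Vec Side 4 → Bool
  quadrupleTest (x ∷ᵛ y ∷ᵛ z ∷ᵛ w ∷ᵛ []ᵛ) = not (isL x) ∧ (x ≼ y) ∧ (y ≼ z) ∧ (z ≼ w) ∧ not (isU w)

  linkedTest : Vec Side 6 → Bool
  linkedTest (x ∷ᵛ y ∷ᵛ z ∷ᵛ x′ ∷ᵛ y′ ∷ᵛ z′ ∷ᵛ []ᵛ) =
    (isL y implies isU x′) ∧ (isL y′ implies isU x) ∧ tripleTest x y z ∧ tripleTest x′ y′ z′

  -- One residue class from each reflected pair is coded, so the chains together have at most f/2
  -- positions. With 2^N words for each chain of length N this is exactly the yardstick 2^⌊f/2⌋.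
  chains-length : ∀ {f p q r} → r < p → f ≡ r + q * p → ⌊ r /2⌋ * suc q + ⌊ p ∸ r /2⌋ * q ≤ ⌊ f /2⌋
  chains-length {p = p} {q} {r} r<p refl with m≤n⇒∃[o]m+o≡n (<⇒≤ r<p)
  ... | d , refl rewrite m+n∸m≡n r d = 2*≤⇒≤⌊/2⌋ (⌊ r /2⌋ * suc q + ⌊ d /2⌋ * q) (begin
    2 * (⌊ r /2⌋ * suc q + ⌊ d /2⌋ * q)         ≡⟨ expand ⌊ r /2⌋ ⌊ d /2⌋ q ⟩
    (2 * ⌊ r /2⌋) * suc q + (2 * ⌊ d /2⌋) * q   ≤⟨ *-monoˡ-≤ (suc q) (⌊/2⌋-lower r) ⊹ *-monoˡ-≤ q (⌊/2⌋-lower d) ⟩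
    r * suc q + d * q                           ≡⟨ solve (r ∷ d ∷ q ∷ []) ⟩
    r + q * (r + d)                             ∎)
    where
    open ≤-Reasoning
    expand : ∀ a b q → 2 * (a * suc q + b * q) ≡ (2 * a) * suc q + (2 * b) * q
    expand = solve-∀

  divide : ∀ f {p} → 0 < p → ∃[ q ] ∃[ r ] r < p × f ≡ r + q * p
  divide f {p} 0<p = f / p , f % p , m%n<n f p , m≡m%n+[m/n]*n f p
    where
    instance
      p≢0 : NonZero p
      p≢0 = >-nonZero 0<p

  module _ {f p q r : ℕ} (r<p : r < p) (f≡ : f ≡ r + q * p) where
    open ≤-Reasoning

    low-fits : ∀ i → i < ⌊ r /2⌋ → suc i + suc q * p ≤ f + p
    low-fits i i< = begin
      suc i + (p + q * p)   ≤⟨ ≤-trans i< (⌊n/2⌋≤n r) ⊹ ≤-refl ⟩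
      r + (p + q * p)       ≡⟨ solve (r ∷ p ∷ q ∷ []) ⟩
      (r + q * p) + p       ≡⟨ cong (_+ p) f≡ ⟨
      f + p                 ∎

    high-fits : ∀ i → i < ⌊ p ∸ r /2⌋ → suc r + i + q * p ≤ f + p
    high-fits i i< = begin
      suc r + i + q * p   ≡⟨ cong (_+ q * p) (+-suc r i) ⟨
      r + suc i + q * p   ≤⟨ (≤-refl {r} ⊹ ≤-trans i< (≤-trans (⌊n/2⌋≤n (p ∸ r)) (m∸n≤m p r))) ⊹ ≤-refl ⟩
      r + p + q * p       ≡⟨ solve (r ∷ p ∷ q ∷ []) ⟩
      (r + q * p) + p     ≡⟨ cong (_+ p) f≡ ⟨
      f + p               ∎

  -- Semigroups with a small element

  -- `n` is the number of gains of 15/16 to be collected. The tightest demand on `large` is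
  -- `arith₃`, which uses 38 of the 40 multiples of n.
  module Sparse (f : ℕ) {A : Set} (χ : A → ℕ → Bool)
                (determined : ∀ {v w} → (∀ z → z ≤ f → χ v z ≡ χ w z) → v ≡ w)
                (n : ℕ) (large : 40 + 40 * n ≤ f) where
    open Chains f
    open Family χ determined

    Few : (A → Set) → Set
    Few Q = Bounded (16 ^ n) Q (15 ^ n * 2 ^ ⌊ f /2⌋)

    SmallElement : ℕ → A → Set
    SmallElement p v = Semigroup f (χ v) × χ v p ≡ true × f ≤ 8 * p × 4 * p ≤ f

    -- 4p ≤ f makes every chain at least 4 long, so each one gains; f ≤ 8p guarantees enough of
    -- them, since there are at least p/2 - 1 chains.
    few-smallElement : ∀ p → Few (SmallElement p)
    few-smallElement p = bounded-inhabited {W = 16 ^ n} λ _ (_ , _ , f≤8p , 4p≤f) →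
      let q , r , r<p , f≡ = divide f (0<p f≤8p) in go {q} r<p f≡ f≤8p 4p≤f
      where
      0<p : f ≤ 8 * p → 0 < p
      0<p f≤8p = *-cancelˡ-< 8 0 p (<-≤-trans (≤-trans (s≤s z≤n) large) f≤8p)
      go : ∀ {q r} → r < p → f ≡ r + q * p → f ≤ 8 * p → 4 * p ≤ f → Few (SmallElement p)
      go {q} {r} r<p f≡ f≤8p 4p≤f = code⇒bounded
        (code-of-chains {q = q} proj₁ (proj₁ ∘ proj₂) r<p f≡
          (code-∀ ⌊ r /2⌋ (λ i i< → ascending-code proj₁ (proj₁ ∘ proj₂) (m≤n⇒m≤1+n 4≤q) (low-fits {q = q} r<p f≡ i i<)))
          (code-∀ ⌊ p ∸ r /2⌋ (λ i i< → ascending-code proj₁ (proj₁ ∘ proj₂) 4≤q (high-fits {q = q} r<p f≡ i i<))))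
        enough (chains-length r<p f≡)
        where
        4≤q : 4 ≤ q
        4≤q = ≤-pred (*-cancelʳ-< p 4 (suc q) (begin-strict
          4 * p     ≤⟨ 4p≤f ⟩
          f         ≡⟨ f≡ ⟩
          r + q * p <⟨ +-monoˡ-< (q * p) r<p ⟩
          p + q * p ∎))
          where open ≤-Reasoning
        arith : ∀ a b r d → r ≤ 2 * a + 1 → d ≤ 2 * b + 1 → f ≤ 8 * (r + d) → 16 * n ≤ 16 * (a + b)
        arith a b r d hr hd h = linear-≤ (24 * n + 24) (large ⊹ h ⊹ 8 ⊛ hr ⊹ 8 ⊛ hd) (solve (a ∷ b ∷ r ∷ d ∷ f ∷ n ∷ []))
        enough : n ≤ ⌊ r /2⌋ * 1 + ⌊ p ∸ r /2⌋ * 1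
        enough rewrite *-identityʳ ⌊ r /2⌋ | *-identityʳ ⌊ p ∸ r /2⌋ = *-cancelˡ-≤ 16
          (arith ⌊ r /2⌋ ⌊ p ∸ r /2⌋ r (p ∸ r) (⌊/2⌋-upper r) (⌊/2⌋-upper (p ∸ r))
            (subst (λ p → f ≤ 8 * p) (sym (m+[n∸m]≡n (<⇒≤ r<p))) f≤8p))

    record HasMultiplicity (m : ℕ) (v : A) : Set where
      field
        semigroup : Semigroup f (χ v)
        m∈        : χ v m ≡ true
        minimal   : ∀ z → 0 < z → z < m → χ v z ≡ false
        f<4m      : f < 4 * m
        8m≤3f     : 8 * m ≤ 3 * f
    open HasMultiplicity

    module _ {m : ℕ} {Q : A → Set} (Q⇒ : ∀ {v} → Q v → HasMultiplicity m v) where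

      notL : ∀ {z v} → Q v → 0 < z → z < m → not (isL (sideAt (χ v) z)) ≡ true
      notL {v = v} q 0<z z<m = sideAt-notL (χ v) (minimal (Q⇒ q) _ 0<z z<m)

      notU : ∀ {z v} → Q v → z < f → f < z + m → not (isU (sideAt (χ v) z)) ≡ true
      notU {z} {v} q z<f f<z+m = sideAt-notU (χ v) {z} (minimal (Q⇒ q) _ (m<n⇒0<n∸m z<f)
        (+-cancelˡ-< z (f ∸ z) m (subst (_< z + m) (sym (m+[n∸m]≡n (<⇒≤ z<f))) f<z+m)))

      ascends : ∀ {z v} → Q v → z + m < f → (sideAt (χ v) z ≼ sideAt (χ v) (z + m)) ≡ true
      ascends q lt = sideAt-≼ (semigroup (Q⇒ q)) (m∈ (Q⇒ q)) (<⇒≤ lt)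

      pair-code : ∀ i → 0 < i → i < m → i + m < f → f < i + m + m → Code Q (SameChain m 2 i) 0 2
      pair-code i 0<i i<m lt gt = code-test (λ v → chain (χ v) m i 2) (allSides 2) allSides-complete pairTest
        (λ q → notL q 0<i i<m ∧ᵗ notU q lt gt) (≤ᵇ⇒≤ _ _ tt)

      record Triple (i : ℕ) : Set where
        constructor triple
        field
          0<i   : 0 < i
          i<m   : i < m
          below : i + m + m < f
          above : f < i + m + m + m

        tripleTest-holds : ∀ {v} → Q v →
          tripleTest (sideAt (χ v) i) (sideAt (χ v) (i + m)) (sideAt (χ v) (i + m + m)) ≡ true
        tripleTest-holds q = notL q 0<i i<m ∧ᵗ ascends q (≤-<-trans (m≤m+n (i + m) m) below) ∧ᵗ ascends q below ∧ᵗ notU q below above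

      triple-code : ∀ {i} → Triple i → Code Q (SameChain m 3 i) 0 3
      triple-code {i} t = code-test (λ v → chain (χ v) m i 3) (allSides 3) allSides-complete tripleTest′
        (Triple.tripleTest-holds t) (≤ᵇ⇒≤ _ _ tt)

      sparse-code : ∀ {i} → Triple i → (∀ {v} → Q v → χ v (i + m) ≡ false) → Code Q (SameChain m 3 i) 1 3
      sparse-code {i} t ∉ = code-test (λ v → chain (χ v) m i 3) (allSides 3) allSides-complete sparseTest
        (λ {v} q → sideAt-notL (χ v) (∉ q) ∧ᵗ Triple.tripleTest-holds t q) (≤ᵇ⇒≤ _ _ tt)

      quadruple-code : ∀ i → 0 < i → i < m → i + m + m + m < f → f < i + m + m + m + m → Code Q (SameChain m 4 i) 1 4
      quadruple-code i 0<i i<m lt gt = code-test (λ v → chain (χ v) m i 4) (allSides 4) allSides-complete quadrupleTest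
        (λ q → notL q 0<i i<m ∧ᵗ ascends q (≤-<-trans (m≤m+n (i + m) m) (≤-<-trans (m≤m+n (i + m + m) m) lt))
          ∧ᵗ ascends q (≤-<-trans (m≤m+n (i + m + m) m) lt) ∧ᵗ ascends q lt ∧ᵗ notU q lt gt) (≤ᵇ⇒≤ _ _ tt)

      -- If i + m ∈ Λ then f - j = (i + m) + (m + e) ∈ Λ.
      linked : ∀ {e i j v} → Q v → χ v (m + e) ≡ true → i + j + e + 2 * m ≡ f →
               (isL (sideAt (χ v) (i + m)) implies isU (sideAt (χ v) j)) ≡ true
      linked {e} {i} {j} {v} q e∈ eq = implies-true _ λ l →
        sideAt-U (semigroup (Q⇒ q)) {j} (subst (j ≤_) eq′ (m≤m+n j _))
          (subst (λ z → χ v z ≡ true) eq″ (Semigroup.add (semigroup (Q⇒ q)) (sideAt-L (χ v) {i + m} l) e∈))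
        where
        eq′ : j + (i + m + (m + e)) ≡ f
        eq′ = trans reorder eq
          where
          reorder : j + (i + m + (m + e)) ≡ i + j + e + 2 * m
          reorder = solve (i ∷ j ∷ e ∷ m ∷ [])
        eq″ : i + m + (m + e) ≡ f ∸ j
        eq″ = trans (sym (m+n∸m≡n j _)) (cong (_∸ j) eq′)

      -- The relation is symmetric in i and j, so the middle of each chain constrains the start of
      -- the other. A middle L occurs in ULL and OLL and a start other than U in three of the eight
      -- words, so 2 · 3 pairs violate each constraint and one pair violates both: 64 - 6 - 6 + 1 =
      -- 53.
      linked-code : ∀ {e i j} → Triple i → Triple j → i + j + e + 2 * m ≡ f → (∀ {v} → Q v → χ v (m + e) ≡ true) →
                    Code Q (λ v w → SameChain m 3 i v w × SameChain m 3 j v w) 1 6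
      linked-code {e} {i} {j} t t′ eq e∈ = code-weaken
        (λ {v} {w} _ _ same → ++-injective (chain (χ v) m i 3) (chain (χ w) m i 3) same)
        (code-test (λ v → chain (χ v) m i 3 ++ᵛ chain (χ v) m j 3) (allSides 6) allSides-complete linkedTest
        (λ q → linked {e} {i} {j} q (e∈ q) eq
          ∧ᵗ linked {e} {j} {i} q (e∈ q) (trans (cong (λ s → s + e + 2 * m) (+-comm j i)) eq)
          ∧ᵗ Triple.tripleTest-holds t q ∧ᵗ Triple.tripleTest-holds t′ q) (≤ᵇ⇒≤ _ _ tt))

    -- Treats the chains of length 3 for both quotients at once; they start at a + 1, ..., a + g.
    -- For f = r + 2m they are the low residues, with a = 0 and ℓ = r; for f = r + 3m they are the
    -- high ones, with a = r and ℓ = m + r.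
    module Group {m a g ℓ : ℕ} (f≡ : f ≡ ℓ + 2 * m) (ℓ≥ : 2 * (a + g) ≤ ℓ) (ℓ≤ : ℓ ≤ 2 * (a + g) + 1)
                 (f≤ : f ≤ a + 3 * m) (f<4m : f < 4 * m) where

      SameTriples : A → A → Set
      SameTriples v w = ∀ j → j < g → SameChain m 3 (suc a + j) v w

      module _ {Q : A → Set} (Q⇒ : ∀ {v} → Q v → HasMultiplicity m v) where

        triples : ∀ j → j < g → Triple Q⇒ (suc a + j)
        triples j j<g = record
          { 0<i   = s≤s z≤n
          ; i<m   = *-cancelˡ-< 2 (suc a + j) m (linear-≤ 0
                      (2 ⊛ j<g ⊹ ℓ≥ ⊹ f<4m ⊹ ≤-reflexive (sym f≡)) (solve (a ∷ j ∷ g ∷ m ∷ ℓ ∷ f ∷ [])))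
          ; below = linear-≤ (a + j) (2 ⊛ j<g ⊹ ℓ≥ ⊹ ≤-reflexive (sym f≡)) (solve (a ∷ j ∷ g ∷ m ∷ ℓ ∷ f ∷ []))
          ; above = linear-≤ j f≤ (solve (a ∷ j ∷ m ∷ f ∷ []))
          }

        sparse-group : ∀ k l → g ≡ k + l → n ≤ l → (∀ {v} → Q v → ∀ j → k ≤ j → j < g → χ v (suc a + j + m) ≡ false) →
                       Code Q SameTriples n (g * 3)
        sparse-group k l refl n≤l ∉ = code-relax gain (≤-reflexive (sym (*-distribʳ-+ 3 k l)))
          (code-weaken combine (code-×
            (code-∀ k (λ j j<k → triple-code Q⇒ (triples j (≤-trans j<k (m≤m+n k l)))))
            (code-∀ l (λ j j<l → sparse-code Q⇒ (triples (k + j) (+-monoʳ-< k j<l))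
                         (λ q → ∉ q (k + j) (m≤m+n k j) (+-monoʳ-< k j<l))))))
          where
          gain : n ≤ k * 0 + l * 1
          gain rewrite *-zeroʳ k | *-identityʳ l = n≤l
          combine : ∀ {v w} → Q v → Q w → (∀ j → j < k → SameChain m 3 (suc a + j) v w) ×
                    (∀ j → j < l → SameChain m 3 (suc a + (k + j)) v w) → SameTriples v w
          combine _ _ (lo , hi) j j<g with below-or-above j k
          ... | inj₁ j<k        = lo j j<k
          ... | inj₂ (d , refl) = hi d (+-cancelˡ-< k d l j<g)

        -- For the element m + e with e = a + 1 + j₀, the chains at i and j are linked when i + j =
        -- ℓ - e, so the indices of linked chains have a fixed sum. The excess u = ℓ - e - (a + g)
        -- is nonnegative because j₀ < g and is at most g - j₀; hence j₀ ≥ a + 2n + 2 leaves room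
        -- for n disjoint pairs.
        linked-group : ∀ j₀ → a + 2 * n + 2 ≤ j₀ → j₀ < g → (∀ {v} → Q v → χ v (m + (suc a + j₀)) ≡ true) →
                       Code Q SameTriples n (g * 3)
        linked-group j₀ k≤j₀ j₀<g e∈ =
          let u , ℓ≡ = m≤n⇒∃[o]m+o≡n {a + g + (suc a + j₀)} {ℓ} (linear-≤ 0 (j₀<g ⊹ ℓ≥) (solve (a ∷ g ∷ j₀ ∷ ℓ ∷ [])))
              w , g≡ = m≤n⇒∃[o]m+o≡n (fits u ℓ≡)
          in go u w ℓ≡ g≡
          where
          fits : ∀ u → a + g + (suc a + j₀) + u ≡ ℓ → u + n + n + suc a ≤ g
          fits u ℓ≡ = linear-≤ 1 (k≤j₀ ⊹ ℓ≤ ⊹ ≤-reflexive ℓ≡) (solve (a ∷ g ∷ j₀ ∷ ℓ ∷ u ∷ n ∷ []))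
          go : ∀ u w → a + g + (suc a + j₀) + u ≡ ℓ → u + n + n + suc a + w ≡ g → Code Q SameTriples n (g * 3)
          -- The indices below g are cut into blocks of lengths u, n, w, n and a + 1. The second
          -- block is paired with the mirror image of the fourth, which keeps the sum of the two
          -- indices constant; the other blocks are coded chain by chain without gain.
          go u w ℓ≡ g≡ = code-relax gain length≤
            (code-weaken combine
              (code-× (code-∀ u (λ j j<u → triple-code Q⇒ (triples j (<-≤-trans j<u u≤g))))
              (code-× (code-∀ n (λ s s<n → linked-code Q⇒ (triples (u + s) (first s<n))
                                 (triples (u + n + w + (n ∸ suc s)) (second s<n)) (sums s<n) e∈))
              (code-× (code-∀ w (λ x x<w → triple-code Q⇒ (triples (u + n + x) (middle x<w))))
                      (code-∀ (suc a) (λ x x<y → triple-code Q⇒ (triples (u + n + w + n + x) (last x<y))))))))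
            where
            g≡′ : u + n + w + n + suc a ≡ g
            g≡′ = trans reorder g≡
              where
              reorder : u + n + w + n + suc a ≡ u + n + n + suc a + w
              reorder = solve (u ∷ n ∷ w ∷ a ∷ [])
            gain : n ≤ u * 0 + (n * 1 + (w * 0 + suc a * 0))
            gain = ≤-reflexive (solve (u ∷ n ∷ w ∷ a ∷ []))
            length≤ : u * 3 + (n * 6 + (w * 3 + suc a * 3)) ≤ g * 3
            length≤ = ≤-reflexive (trans collect (cong (_* 3) g≡))
              where
              collect : u * 3 + (n * 6 + (w * 3 + suc a * 3)) ≡ (u + n + n + suc a + w) * 3
              collect = solve (u ∷ n ∷ w ∷ a ∷ [])
            u≤g : u ≤ g
            u≤g = linear-≤ (n + n + suc a + w) (≤-reflexive g≡) (solve (u ∷ n ∷ w ∷ a ∷ g ∷ []))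
            first : ∀ {s} → s < n → u + s < g
            first {s} s<n = linear-≤ (n + suc a + w) (s<n ⊹ ≤-reflexive g≡) (solve (u ∷ n ∷ w ∷ a ∷ g ∷ s ∷ []))
            second : ∀ {s} → s < n → u + n + w + (n ∸ suc s) < g
            second {s} s<n with n ∸ suc s | m+[n∸m]≡n s<n
            ... | t | eq = linear-≤ (s + suc a) (≤-reflexive g≡ ⊹ ≤-reflexive eq) (solve (u ∷ n ∷ w ∷ a ∷ g ∷ s ∷ t ∷ []))
            middle : ∀ {x} → x < w → u + n + x < g
            middle {x} x<w = linear-≤ (n + suc a) (x<w ⊹ ≤-reflexive g≡) (solve (u ∷ n ∷ w ∷ a ∷ g ∷ x ∷ []))
            last : ∀ {x} → x < suc a → u + n + w + n + x < g
            last {x} x<y = linear-≤ 0 (x<y ⊹ ≤-reflexive g≡) (solve (u ∷ n ∷ w ∷ a ∷ g ∷ x ∷ []))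
            sums : ∀ {s} → s < n → (suc a + (u + s)) + (suc a + (u + n + w + (n ∸ suc s))) + (suc a + j₀) + 2 * m ≡ f
            sums {s} s<n with n ∸ suc s | m+[n∸m]≡n s<n
            ... | t | eq = begin
              (suc a + (u + s)) + (suc a + (u + n + w + t)) + (suc a + j₀) + 2 * m
                ≡⟨ solve (u ∷ n ∷ w ∷ a ∷ s ∷ t ∷ j₀ ∷ m ∷ []) ⟩
              a + (u + n + (suc s + t) + suc a + w) + (suc a + j₀) + u + 2 * m
                ≡⟨ cong (λ n′ → a + (u + n + n′ + suc a + w) + (suc a + j₀) + u + 2 * m) eq ⟩
              a + (u + n + n + suc a + w) + (suc a + j₀) + u + 2 * m
                ≡⟨ cong (λ g → a + g + (suc a + j₀) + u + 2 * m) g≡ ⟩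
              a + g + (suc a + j₀) + u + 2 * m
                ≡⟨ cong (_+ 2 * m) ℓ≡ ⟩
              ℓ + 2 * m
                ≡⟨ f≡ ⟨
              f ∎
              where open ≡-Reasoning
            assoc₃ : ∀ y → u + n + w + y ≡ u + (n + (w + y))
            assoc₃ y = solve (u ∷ n ∷ w ∷ y ∷ [])
            assoc₄ : ∀ z → u + n + w + n + z ≡ u + (n + (w + (n + z)))
            assoc₄ z = solve (u ∷ n ∷ w ∷ z ∷ [])
            Same : ℕ → A → A → Set
            Same j = SameChain m 3 (suc a + j)
            combine : ∀ {v v′} → Q v → Q v′ →
                      (∀ j → j < u → Same j v v′) ×
                      (∀ s → s < n → Same (u + s) v v′ × Same (u + n + w + (n ∸ suc s)) v v′) ×
                      (∀ x → x < w → Same (u + n + x) v v′) ×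
                      (∀ x → x < suc a → Same (u + n + w + n + x) v v′) → SameTriples v v′
            combine {v} {v′} _ _ (c₁ , c₂ , c₃ , c₄) j j<g with below-or-above j u
            ... | inj₁ j<u        = c₁ j j<u
            ... | inj₂ (d , refl) with below-or-above d n
            ...   | inj₁ d<n        = proj₁ (c₂ d d<n)
            ...   | inj₂ (x , refl) with below-or-above x w
            ...     | inj₁ x<w        = subst (λ j → Same j v v′) (+-assoc u n x) (c₃ x x<w)
            ...     | inj₂ (y , refl) with below-or-above y n
            ...       | inj₁ y<n = subst (λ j → Same j v v′)
                          (trans (cong (u + n + w +_) (∸-suc-involutive y<n)) (assoc₃ y))
                          (proj₂ (c₂ (n ∸ suc y) (pos y<n)))
              where
              pos : ∀ {y n} → y < n → n ∸ suc y < n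
              pos {y} {suc n} _ = s≤s (m∸n≤m n y)
            ...       | inj₂ (z , refl) = subst (λ j → Same j v v′) (assoc₄ z)
                          (c₄ z (+-cancelˡ-< (u + n + w + n) z (suc a)
                            (subst₂ _<_ (sym (assoc₄ z)) (sym g≡′) j<g)))

    X : ℕ
    X = 15 ^ n * 2 ^ ⌊ f /2⌋

    -- Either Λ has an element between m + 2a + 2n + 2 and f/2, which links the
    -- chains in pairs, or the chains there have no L in the middle; both save a
    -- factor on about n chains.
    few-group : ∀ {m a g ℓ l} (f≡ : f ≡ ℓ + 2 * m) (ℓ≥ : 2 * (a + g) ≤ ℓ) (ℓ≤ : ℓ ≤ 2 * (a + g) + 1)
                (f≤ : f ≤ a + 3 * m) (f<4m : f < 4 * m) → g ≡ a + 2 * n + 2 + l → n ≤ l → l ≤ f →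
                (∀ {Q} → (∀ {v} → Q v → HasMultiplicity m v) →
                   Code Q (Group.SameTriples {m} {a} {g} {ℓ} f≡ ℓ≥ ℓ≤ f≤ f<4m) n (g * 3) → Few Q) →
                Bounded (16 ^ n) (HasMultiplicity m) (f * X + X)
    few-group {m} {a} {g} {ℓ} {l} f≡ ℓ≥ ℓ≤ f≤ f<4m g≡ n≤l l≤f finish =
      bounded-≤ {W = 16 ^ n} (*-monoˡ-≤ X l≤f ⊹ ≤-refl)
        (bounded-⊆ {W = 16 ^ n} split (bounded-⊎ {W = 16 ^ n} (bounded-∃ {W = 16 ^ n} l few-linked) few-sparse))
      where
      open Group {m} {a} {g} {ℓ} f≡ ℓ≥ ℓ≤ f≤ f<4m
      k = a + 2 * n + 2

      Linked : ℕ → A → Set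
      Linked x v = HasMultiplicity m v × x < l × χ v (m + (suc a + (k + x))) ≡ true

      NoLink : A → Set
      NoLink v = HasMultiplicity m v × (∀ x → x < l → χ v (m + (suc a + (k + x))) ≡ false)

      few-linked : ∀ x → Few (Linked x)
      few-linked x = bounded-inhabited {W = 16 ^ n} λ _ (_ , x<l , _) →
        finish proj₁ (linked-group proj₁ (k + x) (m≤m+n k x) (subst (k + x <_) (sym g≡) (+-monoʳ-< k x<l)) (proj₂ ∘ proj₂))

      few-sparse : Few NoLink
      few-sparse = finish proj₁ (sparse-group proj₁ k l g≡ n≤l absent)
        where
        absent : ∀ {v} → NoLink v → ∀ j → k ≤ j → j < g → χ v (suc a + j + m) ≡ false
        absent {v} (_ , none) j k≤j j<g with m≤n⇒∃[o]m+o≡n k≤j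
        ... | x , refl = trans (cong (χ v) (+-comm _ m)) (none x (+-cancelˡ-< k x l (subst (k + x <_) g≡ j<g)))

      split : ∀ v → HasMultiplicity m v → (∃[ x ] x < l × Linked x v) ⊎ NoLink v
      split v h with least (λ x → χ v (m + (suc a + (k + x)))) l
      ... | inj₁ (x , x<l , ∈ , _) = inj₁ (x , x<l , h , x<l , ∈)
      ... | inj₂ none              = inj₂ (h , none)

    module _ {m r : ℕ} (r<m : r < m) where

      private
        g : ℕ
        g = ⌊ m ∸ r /2⌋

      gap-lower : 2 * g + r ≤ m
      gap-lower = subst (2 * g + r ≤_) (m∸n+n≡m (<⇒≤ r<m)) (⌊/2⌋-lower (m ∸ r) ⊹ ≤-refl)

      gap-upper : m ≤ 2 * g + 1 + r
      gap-upper = subst (_≤ 2 * g + 1 + r) (m∸n+n≡m (<⇒≤ r<m)) (⌊/2⌋-upper (m ∸ r) ⊹ ≤-refl)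

      gap-index : ∀ {i} → i < g → 2 * suc i + r ≤ m
      gap-index i< = ≤-trans (2 ⊛ i< ⊹ ≤-refl) gap-lower

      -- The high residues give pairs and no gain, so everything rests on the ⌊r/2⌋ triples; m ≤
      -- 3f/8 gives r = f - 2m ≥ f/4, hence enough of them.
      few-q=2 : f ≡ r + 2 * m → 8 * m ≤ 3 * f → f < 4 * m → Bounded (16 ^ n) (HasMultiplicity m) (f * X + X)
      few-q=2 f≡ 8m≤3f f<4m = let l , g≡ = m≤n⇒∃[o]m+o≡n {2 * n + 2 + n} {⌊ r /2⌋} (room ⌊ r /2⌋ (⌊/2⌋-upper r)) in
        few-group {m} {0} {⌊ r /2⌋} {r} {n + l} f≡ (⌊/2⌋-lower r) (⌊/2⌋-upper r) f≤ f<4m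
          (trans (sym g≡) (+-assoc (2 * n + 2) n l)) (m≤m+n n l)
          (≤-trans (≤-trans (≤-trans (m≤n+m (n + l) (2 * n + 2)) (≤-reflexive (trans (sym (+-assoc (2 * n + 2) n l)) g≡)))
            (⌊n/2⌋≤n r)) (≤-trans (m≤m+n r (2 * m)) (≤-reflexive (sym f≡))))
          (λ Q⇒ c → code⇒bounded
            (code-of-chains {p = m} {2} {r} (semigroup ∘ Q⇒) (m∈ ∘ Q⇒) r<m f≡ c
              (code-∀ g λ i i< → pair-code Q⇒ (suc r + i) (s≤s z≤n) (i<m i<) (below i<) (above {i})))
            (m≤m+n n _) (chains-length r<m f≡))
        where
        room : ∀ h → r ≤ 2 * h + 1 → 2 * n + 2 + n ≤ h
        room h r≤ = *-cancelˡ-≤ 8 (linear-≤ (16 * n + 20) (large ⊹ 4 ⊛ r≤ ⊹ 4 ⊛ ≤-reflexive f≡ ⊹ 8m≤3f)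
          (solve (n ∷ h ∷ r ∷ m ∷ f ∷ [])))
        f≤ : f ≤ 3 * m
        f≤ = linear-≤ 1 (≤-reflexive f≡ ⊹ r<m) (solve (f ∷ r ∷ m ∷ []))
        i<m : ∀ {i} → i < g → suc r + i < m
        i<m {i} i< = linear-≤ i (gap-index i<) (solve (r ∷ i ∷ m ∷ []))
        below : ∀ {i} → i < g → suc r + i + m < f
        below {i} i< = linear-≤ r (i<m i< ⊹ ≤-reflexive (sym f≡)) (solve (r ∷ i ∷ f ∷ m ∷ []))
        above : ∀ {i} → f < suc r + i + m + m
        above {i} = linear-≤ i (≤-reflexive f≡) (solve (r ∷ i ∷ f ∷ m ∷ []))

      module _ (f≡ : f ≡ r + 3 * m) (f<4m : f < 4 * m) where

        private
          f≡′ : f ≡ m + r + 2 * m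
          f≡′ = trans f≡ reorder
            where
            reorder : r + 3 * m ≡ m + r + 2 * m
            reorder = solve (r ∷ m ∷ [])
          arith₁ : ∀ {g} → 2 * g + r ≤ m → 2 * (r + g) ≤ m + r
          arith₁ {g} le = linear-≤ 0 le (solve (r ∷ m ∷ g ∷ []))
          arith₂ : ∀ {g} → m ≤ 2 * g + 1 + r → m + r ≤ 2 * (r + g) + 1
          arith₂ {g} le = linear-≤ 0 le (solve (r ∷ m ∷ g ∷ []))
          arith₃ : ∀ {g} → r < 2 * n → m ≤ 2 * g + 1 + r → r + 2 * n + 2 + n ≤ g
          arith₃ {g} r< le = *-cancelˡ-≤ 6 (linear-≤ (2 * n + 35) (large ⊹ ≤-reflexive f≡ ⊹ 3 ⊛ le ⊹ 10 ⊛ r<)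
            (solve (r ∷ m ∷ g ∷ n ∷ f ∷ [])))
          2i≤r : ∀ {i} → i < ⌊ r /2⌋ → 2 * suc i ≤ r
          2i≤r i< = ≤-trans (2 ⊛ i<) (⌊/2⌋-lower r)
          i<m : ∀ {i} → 2 * suc i ≤ r → suc i < m
          i<m {i} le = linear-≤ (suc i) (le ⊹ r<m) (solve (i ∷ r ∷ m ∷ []))
          below : ∀ {i} → 2 * suc i ≤ r → suc i + m + m + m < f
          below {i} le = linear-≤ i (le ⊹ ≤-reflexive (sym f≡)) (solve (i ∷ r ∷ m ∷ f ∷ []))
          above : ∀ {i} → f < suc i + m + m + m + m
          above {i} = linear-≤ (suc i) f<4m (solve (i ∷ m ∷ f ∷ []))

        open Group {m} {r} {g} {m + r} f≡′ (arith₁ gap-lower) (arith₂ gap-upper) (≤-reflexive f≡) f<4m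

        quadruples : ∀ {Q} → (∀ {v} → Q v → HasMultiplicity m v) →
                     Code Q (λ v w → ∀ i → i < ⌊ r /2⌋ → SameChain m 4 (1 + i) v w) (⌊ r /2⌋ * 1) (⌊ r /2⌋ * 4)
        quadruples Q⇒ = code-∀ ⌊ r /2⌋ λ i i< →
          quadruple-code Q⇒ (suc i) (s≤s z≤n) (i<m (2i≤r i<)) (below (2i≤r i<)) (above {i})

        -- If r ≥ 2n, the low residues supply n chains of length 4, and these gain. Otherwise the
        -- offset a = r of the triples is below 2n, and the roughly (m - r)/2 triples leave room for
        -- the dichotomy of `few-group`.
        few-q=3 : Bounded (16 ^ n) (HasMultiplicity m) (f * X + X)
        few-q=3 with 2 * n ≤? r
        ... | yes 2n≤r = bounded-≤ {W = 16 ^ n} (m≤n+m X (f * X)) (code⇒bounded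
              (code-of-chains {p = m} {3} {r} semigroup m∈ r<m f≡ (quadruples (λ h → h))
                (code-∀ g (λ i i< → triple-code (λ h → h) (triples (λ h → h) i i<))))
              (≤-trans (2*≤⇒≤⌊/2⌋ n 2n≤r) (≤-trans (≤-reflexive (sym (*-identityʳ _))) (m≤m+n _ _)))
              (chains-length r<m f≡))
        ... | no 2n≰r = let l , g≡ = m≤n⇒∃[o]m+o≡n {r + 2 * n + 2 + n} {g} (arith₃ (≰⇒> 2n≰r) gap-upper) in
          few-group {m} {r} {g} {m + r} {n + l} f≡′ (arith₁ gap-lower) (arith₂ gap-upper) (≤-reflexive f≡) f<4m
            (trans (sym g≡) (+-assoc (r + 2 * n + 2) n l)) (m≤m+n n l)
            (≤-trans (≤-trans (≤-trans (m≤n+m (n + l) (r + 2 * n + 2)) (≤-reflexive (trans (sym (+-assoc (r + 2 * n + 2) n l)) g≡)))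
              (≤-trans (⌊n/2⌋≤n (m ∸ r)) (m∸n≤m m r))) (linear-≤ (r + 2 * m) (≤-reflexive (sym f≡)) (solve (r ∷ m ∷ f ∷ []))))
            (λ Q⇒ c → code⇒bounded
              (code-of-chains {p = m} {3} {r} (semigroup ∘ Q⇒) (m∈ ∘ Q⇒) r<m f≡ (quadruples Q⇒) c)
              (m≤n+m n _) (chains-length r<m f≡))

    few-multiplicity : ∀ m → Bounded (16 ^ n) (HasMultiplicity m) (f * X + X)
    few-multiplicity m = bounded-inhabited {W = 16 ^ n} λ _ h →
      let q , r , r<m , f≡ = divide f (0<m (f<4m h)) in
      go q r r<m f≡ (f<4m h) (8m≤3f h)
      where
      0<m : f < 4 * m → 0 < m
      0<m f<4m = *-cancelˡ-< 4 0 m (≤-<-trans z≤n f<4m)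
      go : ∀ q r → r < m → f ≡ r + q * m → f < 4 * m → 8 * m ≤ 3 * f → Bounded (16 ^ n) (HasMultiplicity m) (f * X + X)
      go 0 r r<m f≡ f<4m 8m≤3f = ⊥-elim (<⇒≱ {3 * f} {8 * m}
        (linear-≤ (5 * m + 2) (3 ⊛ r<m ⊹ 3 ⊛ ≤-reflexive f≡) (solve (f ∷ r ∷ m ∷ []))) 8m≤3f)
      go 1 r r<m f≡ f<4m 8m≤3f = ⊥-elim (<⇒≱ {3 * f} {8 * m}
        (linear-≤ (2 * m + 2) (3 ⊛ r<m ⊹ 3 ⊛ ≤-reflexive f≡) (solve (f ∷ r ∷ m ∷ []))) 8m≤3f)
      go 2 r r<m f≡ f<4m 8m≤3f = few-q=2 r<m f≡ 8m≤3f f<4m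
      go 3 r r<m f≡ f<4m 8m≤3f = few-q=3 r<m f≡ f<4m
      go (suc (suc (suc (suc q)))) r r<m f≡ f<4m 8m≤3f = ⊥-elim (<⇒≱ f<4m
        (linear-≤ (r + q * m) (≤-reflexive (sym f≡)) (solve (f ∷ r ∷ m ∷ q ∷ []))))

    HasSmall : A → Set
    HasSmall v = Semigroup f (χ v) × ∃[ x ] 0 < x × 8 * x ≤ 3 * f × χ v x ≡ true

    -- One factor f is the choice of p or of the multiplicity m, the other the choice of the linking
    -- element.
    few-hasSmall : Bounded (16 ^ n) HasSmall (3 * (f * f * X))
    few-hasSmall = bounded-≤ {W = 16 ^ n} total (bounded-⊆ {W = 16 ^ n} classify (bounded-⊎ {W = 16 ^ n}
      (bounded-∃ {W = 16 ^ n} f few-smallElement) (bounded-∃ {W = 16 ^ n} f few-multiplicity)))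
      where
      0<f : 0 < f
      0<f = ≤-trans (s≤s z≤n) large
      total : f * X + f * (f * X + X) ≤ 3 * (f * f * X)
      total = linear-≤ 0 (2 ⊛ *-monoˡ-≤ X (*-monoʳ-≤ f 0<f)) (collect f X)
        where
        collect : ∀ f X → f * X + f * (f * X + X) + 2 * (f * f * X) + 0 ≡ 3 * (f * f * X) + 2 * (f * 1 * X)
        collect = solve-∀

      -- Doubling an element below f/8 keeps it below f/4, so some multiple lands between f/8 and
      -- f/4. Each doubling adds at least 1 to p, which makes `t` sufficient fuel.
      enlarge : ∀ {ψ} → Semigroup f ψ → ∀ t p → f ≤ p + t → 0 < p → ψ p ≡ true → 4 * p ≤ f →
                ∃[ p′ ] ψ p′ ≡ true × f ≤ 8 * p′ × 4 * p′ ≤ f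
      enlarge Λ zero    p f≤ 0<p p∈ 4p≤f = p , p∈ , linear-≤ (7 * p) f≤ (solve (f ∷ p ∷ [])) , 4p≤f
      enlarge Λ (suc t) p f≤ 0<p p∈ 4p≤f with f ≤? 8 * p
      ... | yes f≤8p = p , p∈ , f≤8p , 4p≤f
      ... | no f≰8p = enlarge Λ t (p + p) (linear-≤ 0 (f≤ ⊹ 0<p) (solve (f ∷ p ∷ t ∷ [])))
                        (≤-trans 0<p (m≤m+n p p)) (Semigroup.add Λ p∈ p∈)
                        (linear-≤ 1 (≰⇒> f≰8p) (solve (f ∷ p ∷ [])))

      classify : ∀ v → HasSmall v → (∃[ p ] p < f × SmallElement p v) ⊎ (∃[ m ] m < f × HasMultiplicity m v)
      classify v (Λ , suc x , _ , 8x≤3f , x∈) with least (λ z → χ v (suc z)) (suc x)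
      ... | inj₂ none = ⊥-elim (true≢false x∈ (none x ≤-refl))
      ... | inj₁ (m , s≤s m≤x , sm∈ , low) with 4 * suc m ≤? f
      ...   | no 4m≰f = inj₂ (suc m , m<f , record
              { semigroup = Λ ; m∈ = sm∈ ; f<4m = ≰⇒> 4m≰f ; 8m≤3f = 8m≤
              ; minimal = λ { (suc z) _ (s≤s z<m) → low z z<m } })
        where
        8m≤ : 8 * suc m ≤ 3 * f
        8m≤ = ≤-trans (8 ⊛ s≤s m≤x) 8x≤3f
        m<f : suc m < f
        m<f = *-cancelˡ-< 3 (suc m) f (linear-≤ (5 * m + 4) 8m≤ (solve (m ∷ f ∷ [])))
      ...   | yes 4m≤f with enlarge Λ f (suc m) (m≤n+m f (suc m)) (s≤s z≤n) sm∈ 4m≤f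
      ...     | p , p∈ , f≤8p , 4p≤f = inj₁ (p , *-cancelˡ-< 4 p f p<f , Λ , p∈ , f≤8p , 4p≤f)
        where
        p<f : 4 * p < 4 * f
        p<f = linear-≤ 2 (4p≤f ⊹ 3 ⊛ 0<f) (solve (p ∷ f ∷ []))

  -- Semigroups as bit vectors

  bit : ∀ {n} → Vec Bool n → ℕ → Bool
  bit []ᵛ      _       = true
  bit (b ∷ᵛ v) zero    = b
  bit (b ∷ᵛ v) (suc x) = bit v x

  extend⇒bit : ∀ {n} (v : Vec Bool n) x → Extend v x → bit v x ≡ true
  extend⇒bit []ᵛ         x       e = refl
  extend⇒bit (true ∷ᵛ v) zero    e = refl
  extend⇒bit (b ∷ᵛ v)    (suc x) e = extend⇒bit v x e

  bit⇒extend : ∀ {n} (v : Vec Bool n) x → bit v x ≡ true → Extend v x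
  bit⇒extend []ᵛ         x       e = tt
  bit⇒extend (true ∷ᵛ v) zero    e = tt
  bit⇒extend (b ∷ᵛ v)    (suc x) e = bit⇒extend v x e

  bit-≥ : ∀ {n} (v : Vec Bool n) {x} → n ≤ x → bit v x ≡ true
  bit-≥ v n≤x = extend⇒bit v _ (extend-≥ v n≤x)

  bit-determines : ∀ {n} (v w : Vec Bool n) → (∀ x → x < n → bit v x ≡ bit w x) → v ≡ w
  bit-determines []ᵛ      []ᵛ      h = refl
  bit-determines (b ∷ᵛ v) (c ∷ᵛ w) h = cong₂ _∷ᵛ_ (h 0 (s≤s z≤n)) (bit-determines v w (λ x x< → h (suc x) (s≤s x<)))

  bit-++ˡ : ∀ {m n} (u : Vec Bool m) (w : Vec Bool n) {x} → x < m → bit (u ++ᵛ w) x ≡ bit u x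
  bit-++ˡ (b ∷ᵛ u) w {zero}  _         = refl
  bit-++ˡ (b ∷ᵛ u) w {suc x} (s≤s x<m) = bit-++ˡ u w x<m

  bit-++ʳ : ∀ {m n} (u : Vec Bool m) (w : Vec Bool n) x → bit (u ++ᵛ w) (m + x) ≡ bit w x
  bit-++ʳ []ᵛ      w x = refl
  bit-++ʳ (b ∷ᵛ u) w x = bit-++ʳ u w x

  falses : ∀ n → Vec Bool n
  falses n = replicate n false

  bit-falses : ∀ {n x} → x < n → bit (falses n) x ≡ false
  bit-falses {suc n} {zero}  _         = refl
  bit-falses {suc n} {suc x} (s≤s x<n) = bit-falses x<n

  valid⇒semigroup : ∀ {f} {v : Vec Bool (suc f)} → Valid f v → Semigroup f (bit v)
  valid⇒semigroup {f} {v} valid = record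
    { zero∈ = extend⇒bit v 0 (Valid.zero∈ valid)
    ; add   = λ {x} {y} x∈ y∈ → extend⇒bit v (x + y)
                (extend-closed f v valid {x} {y} (bit⇒extend v x x∈) (bit⇒extend v y y∈))
    ; f∉    = not-true (λ f∈ → Valid.f∉ valid (bit⇒extend v f f∈))
    }
    where
    not-true : ∀ {b} → ¬ (b ≡ true) → b ≡ false
    not-true {true}  h = ⊥-elim (h refl)
    not-true {false} h = refl

  semigroup⇒valid : ∀ {f} {v : Vec Bool (suc f)} → Semigroup f (bit v) → Valid f v
  semigroup⇒valid {f} {v} Λ = mkValid (bit⇒extend v 0 zero∈)
    (λ i j i∈ j∈ → bit⇒extend v (toℕ i + toℕ j) (add (extend⇒bit v (toℕ i) i∈) (extend⇒bit v (toℕ j) j∈)))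
    (λ f∈ → true≢false (extend⇒bit v f f∈) f∉)
    where open Semigroup Λ

  abstract
    valid : ∀ f → Vec Bool (suc f) → Bool
    valid f v = does (valid? f v)

    valid-does : ∀ {f} v → does (valid? f v) ≡ valid f v
    valid-does v = refl

    valid-true : ∀ {f} {v : Vec Bool (suc f)} → Semigroup f (bit v) → valid f v ≡ true
    valid-true {f} {v} Λ = dec-true (valid? f v) (semigroup⇒valid Λ)

    valid-semigroup : ∀ {f} {v : Vec Bool (suc f)} → valid f v ≡ true → Semigroup f (bit v)
    valid-semigroup {f} {v} eq = valid⇒semigroup (does-true (valid? f v) eq)
      where
      does-true : ∀ {P : Set} (P? : Dec P) → does P? ≡ true → P
      does-true (yes p) _ = p

  valid-cong : ∀ {f f′} {v : Vec Bool (suc f)} {w : Vec Bool (suc f′)} →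
               (Semigroup f (bit v) → Semigroup f′ (bit w)) → (Semigroup f′ (bit w) → Semigroup f (bit v)) →
               valid f v ≡ valid f′ w
  valid-cong {f} {f′} {v} {w} to from with valid f v in eq | valid f′ w in eq′
  ... | true  | true  = refl
  ... | false | false = refl
  ... | true  | false = ⊥-elim (true≢false (valid-true (to (valid-semigroup eq))) eq′)
  ... | false | true  = ⊥-elim (true≢false (valid-true (from (valid-semigroup eq′))) eq)

  -- Sums over all bit vectors

  Σᵛ : ∀ n → (Vec Bool n → ℕ) → ℕ
  Σᵛ zero    F = F []ᵛ
  Σᵛ (suc n) F = Σᵛ n (F ∘ (true ∷ᵛ_)) + Σᵛ n (F ∘ (false ∷ᵛ_))

  Σᵛ-cong : ∀ n {F G} → (∀ v → F v ≡ G v) → Σᵛ n F ≡ Σᵛ n G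
  Σᵛ-cong zero    h = h []ᵛ
  Σᵛ-cong (suc n) h = cong₂ _+_ (Σᵛ-cong n (h ∘ (true ∷ᵛ_))) (Σᵛ-cong n (h ∘ (false ∷ᵛ_)))

  Σᵛ-mono : ∀ n {F G} → (∀ v → F v ≤ G v) → Σᵛ n F ≤ Σᵛ n G
  Σᵛ-mono zero    h = h []ᵛ
  Σᵛ-mono (suc n) h = +-mono-≤ (Σᵛ-mono n (h ∘ (true ∷ᵛ_))) (Σᵛ-mono n (h ∘ (false ∷ᵛ_)))

  Σᵛ-0 : ∀ n → Σᵛ n (const 0) ≡ 0
  Σᵛ-0 zero    = refl
  Σᵛ-0 (suc n) = cong₂ _+_ (Σᵛ-0 n) (Σᵛ-0 n)

  Σᵛ-1 : ∀ n → Σᵛ n (const 1) ≡ 2 ^ n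
  Σᵛ-1 zero    = refl
  Σᵛ-1 (suc n) = cong₂ _+_ (Σᵛ-1 n) (trans (Σᵛ-1 n) (sym (+-identityʳ (2 ^ n))))

  Σᵛ-+ : ∀ n F G → Σᵛ n (λ v → F v + G v) ≡ Σᵛ n F + Σᵛ n G
  Σᵛ-+ zero    F G = refl
  Σᵛ-+ (suc n) F G = trans (cong₂ _+_ (Σᵛ-+ n _ _) (Σᵛ-+ n _ _))
    (interchange (Σᵛ n (F ∘ (true ∷ᵛ_))) (Σᵛ n (G ∘ (true ∷ᵛ_))) (Σᵛ n (F ∘ (false ∷ᵛ_))) (Σᵛ n (G ∘ (false ∷ᵛ_))))
    where
    interchange : ∀ a b c d → (a + b) + (c + d) ≡ (a + c) + (b + d)
    interchange = solve-∀

  Σᵛ-* : ∀ n k F → Σᵛ n (λ v → k * F v) ≡ k * Σᵛ n F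
  Σᵛ-* zero    k F = refl
  Σᵛ-* (suc n) k F = trans (cong₂ _+_ (Σᵛ-* n k _) (Σᵛ-* n k _)) (sym (*-distribˡ-+ k (Σᵛ n (F ∘ (true ∷ᵛ_))) _))

  Σᵛ-++ : ∀ m n F → Σᵛ (m + n) F ≡ Σᵛ m (λ u → Σᵛ n (λ w → F (u ++ᵛ w)))
  Σᵛ-++ zero    n F = refl
  Σᵛ-++ (suc m) n F = cong₂ _+_ (Σᵛ-++ m n (F ∘ (true ∷ᵛ_))) (Σᵛ-++ m n (F ∘ (false ∷ᵛ_)))

  sum-allVecs : ∀ n F → sum (map F (allVecs n)) ≡ Σᵛ n F
  sum-allVecs zero    F = +-identityʳ (F []ᵛ)
  sum-allVecs (suc n) F = begin
    sum (map F (ts ++ fs))             ≡⟨ cong sum (map-++ F ts fs) ⟩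
    sum (map F ts ++ map F fs)         ≡⟨ sum-++ (map F ts) (map F fs) ⟩
    sum (map F ts) + sum (map F fs)    ≡⟨ cong₂ _+_ (half true) (half false) ⟩
    Σᵛ (suc n) F                       ∎
    where
    open ≡-Reasoning
    ts = map (true ∷ᵛ_) (allVecs n)
    fs = map (false ∷ᵛ_) (allVecs n)
    half : ∀ b → sum (map F (map (b ∷ᵛ_) (allVecs n))) ≡ Σᵛ n (F ∘ (b ∷ᵛ_))
    half b = trans (cong sum (sym (map-∘ (allVecs n)))) (sum-allVecs n (F ∘ (b ∷ᵛ_)))

  _when_ : ℕ → Bool → ℕ
  x when b = if b then x else 0

  when-≤ : ∀ {x y} → x ≤ y → ∀ b → x when b ≤ y * (1 when b)
  when-≤ {y = y} x≤y true  = ≤-trans x≤y (≤-reflexive (sym (*-identityʳ y)))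
  when-≤         x≤y false = z≤n

  sum-filter : ∀ {A : Set} {P : A → Set} (P? : Decidable P) (g : A → ℕ) xs →
               sum (map g (filter P? xs)) ≡ sum (map (λ x → g x when does (P? x)) xs)
  sum-filter P? g [] = refl
  sum-filter P? g (x ∷ xs) with does (P? x)
  ... | true  = cong (g x +_) (sum-filter P? g xs)
  ... | false = sum-filter P? g xs

  length-as-sum : ∀ {A : Set} (xs : List A) → length xs ≡ sum (map (const 1) xs)
  length-as-sum []       = refl
  length-as-sum (x ∷ xs) = cong suc (length-as-sum xs)

  Σᵛ-filter : ∀ {n} {P : Vec Bool n → Set} (P? : Decidable P) g →
              sum (map g (filter P? (allVecs n))) ≡ Σᵛ n (λ v → g v when does (P? v))
  Σᵛ-filter {n} P? g = trans (sum-filter P? g (allVecs n)) (sum-allVecs n _)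

  length-filter-allVecs : ∀ {n} {P : Vec Bool n → Set} (P? : Decidable P) →
              length (filter P? (allVecs n)) ≡ Σᵛ n (λ v → 1 when does (P? v))
  length-filter-allVecs P? = trans (length-as-sum (filter P? (allVecs _))) (Σᵛ-filter P? (const 1))

  total : ∀ f → (Vec Bool (suc f) → ℕ) → ℕ
  total f g = Σᵛ (suc f) (λ v → g v when valid f v)

  gapCount : ∀ {n} → Vec Bool n → ℕ
  gapCount []ᵛ          = 0
  gapCount (true ∷ᵛ v)  = gapCount v
  gapCount (false ∷ᵛ v) = suc (gapCount v)

  gapCount≤ : ∀ {n} (v : Vec Bool n) → gapCount v ≤ n
  gapCount≤ []ᵛ          = z≤n
  gapCount≤ (true ∷ᵛ v)  = m≤n⇒m≤1+n (gapCount≤ v)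
  gapCount≤ (false ∷ᵛ v) = s≤s (gapCount≤ v)

  gapCount-++ : ∀ {m n} (u : Vec Bool m) (w : Vec Bool n) → gapCount (u ++ᵛ w) ≡ gapCount u + gapCount w
  gapCount-++ []ᵛ          w = refl
  gapCount-++ (true ∷ᵛ u)  w = gapCount-++ u w
  gapCount-++ (false ∷ᵛ u) w = cong suc (gapCount-++ u w)

  number gapTotal : ℕ → ℕ
  number   f = total f (const 1)
  gapTotal f = total f gapCount

  length-filter-gaps : ∀ {n} (v : Vec Bool n) {P : ℕ → Set} (P? : Decidable P) (h : ℕ → ℕ) →
                       (∀ x → does (P? (h x)) ≡ not (bit v x)) → length (filter P? (applyUpTo h n)) ≡ gapCount v
  length-filter-gaps []ᵛ      P? h eq = refl
  length-filter-gaps (b ∷ᵛ v) P? h eq with does (P? (h 0)) | eq 0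
  length-filter-gaps (true ∷ᵛ v)  P? h eq | false | _ = length-filter-gaps v P? (h ∘ suc) (eq ∘ suc)
  length-filter-gaps (false ∷ᵛ v) P? h eq | true  | _ = cong suc (length-filter-gaps v P? (h ∘ suc) (eq ∘ suc))

  genus-gapCount : ∀ {f} {v : Vec Bool (suc f)} (p : Valid f v) → genus (toSemigroup p) ≡ gapCount v
  genus-gapCount {f} {v} p = length-filter-gaps v (λ x → ¬? (extend? v x)) id (does-extend v)
    where
    does-extend : ∀ {n} (v : Vec Bool n) x → does (¬? (extend? v x)) ≡ not (bit v x)
    does-extend []ᵛ          x       = refl
    does-extend (true ∷ᵛ v)  zero    = refl
    does-extend (false ∷ᵛ v) zero    = refl
    does-extend (b ∷ᵛ v)     (suc x) = does-extend v x

  genera : ∀ f → map genus (Enumeration.elements (semigroupsWithFrobenius f)) ≡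
                 map gapCount (filter (valid? f) (allVecs (suc f)))
  genera f = go (all-filter (valid? f) (allVecs (suc f)))
    where
    go : ∀ {xs} (ps : All (Valid f) xs) → map genus (reduce toSemigroup ps) ≡ map gapCount xs
    go []ᵃ       = refl
    go (p ∷ᵃ ps) = cong₂ _∷_ (genus-gapCount p) (go ps)

  sum-genera : ∀ f → sum (map genus (Enumeration.elements (semigroupsWithFrobenius f))) ≡ gapTotal f
  sum-genera f = trans (cong sum (genera f)) (trans (Σᵛ-filter (valid? f) gapCount)
    (Σᵛ-cong (suc f) λ v → cong (gapCount v when_) (valid-does v)))

  length-genera : ∀ f → length (map genus (Enumeration.elements (semigroupsWithFrobenius f))) ≡ number f
  length-genera f = trans (cong length (genera f)) (trans (length-map gapCount (filter (valid? f) (allVecs (suc f))))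
    (trans (length-filter-allVecs (valid? f)) (Σᵛ-cong (suc f) λ v → cong (1 when_) (valid-does v))))

  -- Semigroups with and without elements in {1, …, a}

  -- On a vector that is too short the value is `false`, in agreement with `bit`, which is `true`
  -- past the end.
  allFalse : ∀ (a : ℕ) {n} → Vec Bool n → Bool
  allFalse zero    v            = true
  allFalse (suc a) []ᵛ          = false
  allFalse (suc a) (true ∷ᵛ v)  = false
  allFalse (suc a) (false ∷ᵛ v) = allFalse a v

  gapsUpTo : ∀ a {n} → Vec Bool n → Bool
  gapsUpTo a []ᵛ      = true
  gapsUpTo a (_ ∷ᵛ v) = allFalse a v

  good : ∀ a k → (Vec Bool (suc (a + k)) → ℕ) → ℕ
  good a k g = Σᵛ k (λ w → g (true ∷ᵛ falses a ++ᵛ w) when valid (a + k) (true ∷ᵛ falses a ++ᵛ w))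

  bad : ∀ f a → (Vec Bool (suc f) → ℕ) → ℕ
  bad f a g = Σᵛ (suc f) (λ v → g v when (valid f v ∧ not (gapsUpTo a v)))

  Σᵛ-allFalse : ∀ a k (F : Vec Bool (a + k) → ℕ) → Σᵛ (a + k) (λ v → F v when allFalse a v) ≡ Σᵛ k (λ w → F (falses a ++ᵛ w))
  Σᵛ-allFalse zero    k F = refl
  Σᵛ-allFalse (suc a) k F = trans (cong (_+ Σᵛ (a + k) (λ v → F (false ∷ᵛ v) when allFalse a v)) (Σᵛ-0 (a + k))) (Σᵛ-allFalse a k (F ∘ (false ∷ᵛ_)))

  total-split : ∀ a k g → total (a + k) g ≡ good a k g + bad (a + k) a g
  total-split a k g = begin
    total f g
      ≡⟨ Σᵛ-cong (suc f) (λ v → split (g v) (valid f v) (gapsUpTo a v)) ⟩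
    Σᵛ (suc f) (λ v → F v when gapsUpTo a v + g v when (valid f v ∧ not (gapsUpTo a v)))
      ≡⟨ Σᵛ-+ (suc f) (λ v → F v when gapsUpTo a v) (λ v → g v when (valid f v ∧ not (gapsUpTo a v))) ⟩
    Σᵛ (suc f) (λ v → F v when gapsUpTo a v) + bad f a g
      ≡⟨ cong (_+ bad f a g) (begin
        Σᵛ f (λ v → F (true ∷ᵛ v) when allFalse a v) + Σᵛ f (λ v → F (false ∷ᵛ v) when allFalse a v)
          ≡⟨ cong₂ _+_ (Σᵛ-allFalse a k (F ∘ (true ∷ᵛ_))) (trans (Σᵛ-cong f vanish) (Σᵛ-0 f)) ⟩
        good a k g + 0
          ≡⟨ +-identityʳ _ ⟩
        good a k g ∎) ⟩
    good a k g + bad f a g ∎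
    where
    open ≡-Reasoning
    f = a + k
    F : Vec Bool (suc f) → ℕ
    F v = g v when valid f v
    split : ∀ x b c → x when b ≡ (x when b) when c + x when (b ∧ not c)
    split x true  true  = sym (+-identityʳ x)
    split x true  false = refl
    split x false true  = refl
    split x false false = refl
    vanish : ∀ v → F (false ∷ᵛ v) when allFalse a v ≡ 0
    vanish v with allFalse a v
    ... | false = refl
    ... | true with valid f (false ∷ᵛ v) in eq
    ...   | false = refl
    ...   | true  = ⊥-elim (true≢false (Semigroup.zero∈ (valid-semigroup {v = false ∷ᵛ v} eq)) refl)

  bad-gapCount : ∀ f a → bad f a gapCount ≤ suc f * bad f a (const 1)
  bad-gapCount f a = ≤-trans (Σᵛ-mono (suc f) (λ v → when-≤ (gapCount≤ v) (valid f v ∧ not (gapsUpTo a v))))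
    (≤-reflexive (Σᵛ-* (suc f) (suc f) (λ v → 1 when (valid f v ∧ not (gapsUpTo a v)))))

  allFalse-false : ∀ (a : ℕ) {n} (v : Vec Bool n) → allFalse a v ≡ false → a ≤ n → ∃[ x ] x < a × bit v x ≡ true
  allFalse-false (suc a) (true ∷ᵛ v)  _  _         = 0 , s≤s z≤n , refl
  allFalse-false (suc a) (false ∷ᵛ v) eq (s≤s a≤n) with allFalse-false a v eq a≤n
  ... | x , x<a , b≡ = suc x , s≤s x<a , b≡

  bad-bound : ∀ f a n → 8 * a ≤ 3 * f → a ≤ f → 40 + 40 * n ≤ f →
              16 ^ n * bad f a (const 1) ≤ 3 * (f * f * (15 ^ n * 2 ^ ⌊ f /2⌋))
  bad-bound f a n 8a≤3f a≤f large = subst (λ k → 16 ^ n * k ≤ 3 * (f * f * (15 ^ n * 2 ^ ⌊ f /2⌋)))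
    (trans (length-filter-allVecs bad?) (Σᵛ-cong (suc f) λ v → cong (1 when_) (does-T? (valid f v ∧ not (gapsUpTo a v)))))
    (few-hasSmall (filter bad? (allVecs (suc f))) (Unique.filter⁺ bad? (allVecs-unique (suc f)))
      (All.map (λ {v} → hasSmall v) (all-filter bad? (allVecs (suc f)))))
    where
    open Sparse f {Vec Bool (suc f)} bit (λ {v} {w} h → bit-determines v w (λ x x< → h x (≤-pred x<))) n large
    bad? : Decidable (λ v → T (valid f v ∧ not (gapsUpTo a v)))
    bad? v = T? (valid f v ∧ not (gapsUpTo a v))
    does-T? : ∀ b → does (T? b) ≡ b
    does-T? true  = refl
    does-T? false = refl
    hasSmall : ∀ v → T (valid f v ∧ not (gapsUpTo a v)) → HasSmall v
    hasSmall v@(_ ∷ᵛ u) t with valid f v in eq | allFalse a u in eq′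
    ... | true | false with allFalse-false a u eq′ a≤f
    ...   | x , x<a , b≡ = valid-semigroup {v = v} eq , suc x , s≤s z≤n , ≤-trans (8 ⊛ x<a) (8a≤3f) , b≡

  -- Inserting a gap and a free bit

  data Place (a b : ℕ) : ℕ → Set where
    origin : Place a b 0
    low    : ∀ {x} → x < a → Place a b (suc x)
    mid    : ∀ {y} → y < b → Place a b (suc (a + y))
    high   : ∀ z → Place a b (suc (a + (b + z)))

  place : ∀ a b x → Place a b x
  place a b zero = origin
  place a b (suc x) with below-or-above x a
  ... | inj₁ x<a = low x<a
  ... | inj₂ (y , refl) with below-or-above y b
  ...   | inj₁ y<b        = mid y<b
  ...   | inj₂ (z , refl) = high z

  -- A sum of two nonzero elements, not both of them at most a + b, exceeds f.
  closed-if-mid-closed : ∀ a b {f} {χ : ℕ → Bool} → (∀ {x} → x < a → χ (suc x) ≡ false) →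
    (∀ {x} → f < x → χ x ≡ true) → f ≤ a + a + b + 1 →
    (∀ y₁ y₂ → y₁ < b → y₂ < b → χ (suc (a + y₁)) ≡ true → χ (suc (a + y₂)) ≡ true → χ (suc (a + y₁) + suc (a + y₂)) ≡ true) →
    ∀ x y → χ x ≡ true → χ y ≡ true → χ (x + y) ≡ true
  closed-if-mid-closed a b {f} {χ} gap beyond f≤ closed x y = go (place a b x) (place a b y)
    where
    far : ∀ y z → χ (suc (a + y) + suc (a + (b + z))) ≡ true
    far y z = beyond (linear-≤ (y + z) f≤ (solve (f ∷ a ∷ b ∷ y ∷ z ∷ [])))
    go : ∀ {x y} → Place a b x → Place a b y → χ x ≡ true → χ y ≡ true → χ (x + y) ≡ true
    go origin    _         _  y∈ = y∈
    go {x} _     origin    x∈ _  = subst (λ x → χ x ≡ true) (sym (+-identityʳ x)) x∈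
    go (low x<a) _         x∈ _  = ⊥-elim (true≢false x∈ (gap x<a))
    go _         (low y<a) _  y∈ = ⊥-elim (true≢false y∈ (gap y<a))
    go (mid p)   (mid q)   x∈ y∈ = closed _ _ p q x∈ y∈
    go (mid {y} p) (high z) _ _  = far y z
    go (high z)  (mid {y} p) _ _ = subst (λ x → χ x ≡ true) (+-comm (suc (a + y)) (suc (a + (b + z)))) (far y z)
    go (high z)  (high z′) _  _  = far (b + z) z′

  module _ (a : ℕ) {b k : ℕ} (u : Vec Bool b) (w : Vec Bool k) where

    bit-low : ∀ {x} → x < a → bit (true ∷ᵛ falses a ++ᵛ (u ++ᵛ w)) (suc x) ≡ false
    bit-low x<a = trans (bit-++ˡ (falses a) (u ++ᵛ w) x<a) (bit-falses x<a)

    bit-mid : ∀ {y} → y < b → bit (true ∷ᵛ falses a ++ᵛ (u ++ᵛ w)) (suc (a + y)) ≡ bit u y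
    bit-mid {y} y<b = trans (bit-++ʳ (falses a) (u ++ᵛ w) y) (bit-++ˡ u w y<b)

    bit-high : ∀ z → bit (true ∷ᵛ falses a ++ᵛ (u ++ᵛ w)) (suc (a + (b + z))) ≡ bit w z
    bit-high z = trans (bit-++ʳ (falses a) (u ++ᵛ w) (b + z)) (bit-++ʳ u w z)

  gapCount-layout : ∀ a {k} (w : Vec Bool k) → gapCount (true ∷ᵛ falses a ++ᵛ w) ≡ a + gapCount w
  gapCount-layout zero    w = refl
  gapCount-layout (suc a) w = cong suc (gapCount-layout a w)

  -- The layout is 0, then a gaps, b middle bits and c + 1 upper bits, the last of them at f. The
  -- new gap moves the middle positions by 1; together with the new bit, put between the middle and
  -- the upper block, it moves the upper positions by 2. `b≤` sends sums of two middle elements into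
  -- the upper block, past the new bit; `c≤` sends the sum of an upper and another nonzero element
  -- beyond f.
  module Insertion (a b c : ℕ) (b≤ : b ≤ suc a) (c≤ : c ≤ a) where

    private
      f≤ : a + (b + suc c) ≤ a + a + b + 1
      f≤ = linear-≤ 0 c≤ (solve (a ∷ b ∷ c ∷ []))
      f′≤ : suc a + (b + suc (suc c)) ≤ suc a + suc a + b + 1
      f′≤ = linear-≤ 0 c≤ (solve (a ∷ b ∷ c ∷ []))

    f f′ : ℕ
    f  = a + (b + suc c)
    f′ = suc a + (b + suc (suc c))

    module _ (β : Bool) (u : Vec Bool b) (w : Vec Bool (suc c)) where

      private
        v : Vec Bool (suc f)
        v = true ∷ᵛ falses a ++ᵛ (u ++ᵛ w)
        v′ : Vec Bool (suc f′)
        v′ = true ∷ᵛ falses (suc a) ++ᵛ (u ++ᵛ (β ∷ᵛ w))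

      high-agree : ∀ z → bit v (suc (a + (b + z))) ≡ bit v′ (suc (suc a + (b + suc z)))
      high-agree z = trans (bit-high a u w z) (sym (bit-high (suc a) u (β ∷ᵛ w) (suc z)))

      mid-agree : ∀ {y} → y < b → bit v (suc (a + y)) ≡ bit v′ (suc (suc a + y))
      mid-agree y<b = trans (bit-mid a u w y<b) (sym (bit-mid (suc a) u (β ∷ᵛ w) y<b))

      -- Moving both summands by 1 moves the sum by 2, which is also the shift of the upper block.
      -- The sum has index d + y₁ + y₂ there, with d = a + 1 - b.
      sum-agree : ∀ y₁ y₂ → bit v (suc (a + y₁) + suc (a + y₂)) ≡ bit v′ (suc (suc a + y₁) + suc (suc a + y₂))
      sum-agree y₁ y₂ with m≤n⇒∃[o]m+o≡n b≤
      ... | d , eq = begin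
        bit v (suc (a + y₁) + suc (a + y₂))
          ≡⟨ cong (bit v) (trans (shift₁ a y₁ y₂) (trans (cong (λ t → suc (a + (t + y₁ + y₂))) (sym eq)) (assoc₁ a b d y₁ y₂))) ⟩
        bit v (suc (a + (b + (d + y₁ + y₂))))
          ≡⟨ high-agree (d + y₁ + y₂) ⟩
        bit v′ (suc (suc a + (b + suc (d + y₁ + y₂))))
          ≡⟨ cong (bit v′) (trans (assoc₂ a b d y₁ y₂) (trans (cong (λ t → 3 + a + (t + y₁ + y₂)) eq) (shift₂ a y₁ y₂))) ⟩
        bit v′ (suc (suc a + y₁) + suc (suc a + y₂)) ∎
        where
        open ≡-Reasoning
        shift₁ : ∀ a y₁ y₂ → suc (a + y₁) + suc (a + y₂) ≡ suc (a + (suc a + y₁ + y₂))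
        shift₁ = solve-∀
        assoc₁ : ∀ a b d y₁ y₂ → suc (a + (b + d + y₁ + y₂)) ≡ suc (a + (b + (d + y₁ + y₂)))
        assoc₁ = solve-∀
        assoc₂ : ∀ a b d y₁ y₂ → suc (suc a + (b + suc (d + y₁ + y₂))) ≡ 3 + a + (b + d + y₁ + y₂)
        assoc₂ = solve-∀
        shift₂ : ∀ a y₁ y₂ → 3 + a + (suc a + y₁ + y₂) ≡ suc (suc a + y₁) + suc (suc a + y₂)
        shift₂ = solve-∀

      frobenius-agree : bit v f ≡ bit v′ f′
      frobenius-agree = begin
        bit v f                                ≡⟨ cong (bit v) (e₁ a b c) ⟩
        bit v (suc (a + (b + c)))              ≡⟨ high-agree c ⟩
        bit v′ (suc (suc a + (b + suc c)))     ≡⟨ cong (bit v′) (e₂ a b c) ⟩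
        bit v′ f′                              ∎
        where
        open ≡-Reasoning
        e₁ : ∀ a b c → a + (b + suc c) ≡ suc (a + (b + c))
        e₁ = solve-∀
        e₂ : ∀ a b c → suc (suc a + (b + suc c)) ≡ suc a + (b + suc (suc c))
        e₂ = solve-∀

      insert : Semigroup f (bit v) → Semigroup f′ (bit v′)
      insert Λ = record
        { zero∈ = refl
        ; add   = λ {x} {y} → closed-if-mid-closed (suc a) b {f′} {bit v′} (bit-low (suc a) u (β ∷ᵛ w)) (bit-≥ v′) f′≤
                    (λ y₁ y₂ p q p∈ q∈ → trans (sym (sum-agree y₁ y₂))
                      (Semigroup.add Λ {suc (a + y₁)} {suc (a + y₂)} (trans (mid-agree p) p∈) (trans (mid-agree q) q∈))) x y
        ; f∉    = trans (sym frobenius-agree) (Semigroup.f∉ Λ)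
        }

      delete : Semigroup f′ (bit v′) → Semigroup f (bit v)
      delete Λ = record
        { zero∈ = refl
        ; add   = λ {x} {y} → closed-if-mid-closed a b {f} {bit v} (bit-low a u w) (bit-≥ v) f≤
                    (λ y₁ y₂ p q p∈ q∈ → trans (sum-agree y₁ y₂)
                      (Semigroup.add Λ {suc (suc a + y₁)} {suc (suc a + y₂)}
                        (trans (sym (mid-agree p)) p∈) (trans (sym (mid-agree q)) q∈))) x y
        ; f∉    = trans frobenius-agree (Semigroup.f∉ Λ)
        }

      valid-insert : valid f′ v′ ≡ valid f v
      valid-insert = valid-cong {v = v′} {w = v} delete insert

    layout : Vec Bool (b + suc c) → Vec Bool (suc f)
    layout w = true ∷ᵛ falses a ++ᵛ w

    layout′ : Vec Bool (b + suc (suc c)) → Vec Bool (suc f′)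
    layout′ w = true ∷ᵛ falses (suc a) ++ᵛ w

    good-insert : ∀ g g′ h →
                  (∀ u w → g′ (layout′ (u ++ᵛ (true ∷ᵛ w))) + g′ (layout′ (u ++ᵛ (false ∷ᵛ w)))
                           ≡ 2 * g (layout (u ++ᵛ w)) + h) →
                  good (suc a) (b + suc (suc c)) g′ ≡ 2 * good a (b + suc c) g + h * good a (b + suc c) (const 1)
    good-insert g g′ h eq = begin
      good (suc a) (b + suc (suc c)) g′
        ≡⟨ Σᵛ-++ b (suc (suc c)) G′ ⟩
      Σᵛ b (λ u → Σᵛ (suc c) (λ w → G′ (u ++ᵛ (true ∷ᵛ w))) + Σᵛ (suc c) (λ w → G′ (u ++ᵛ (false ∷ᵛ w))))
        ≡⟨ Σᵛ-cong b (λ u → trans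
             (sym (Σᵛ-+ (suc c) (λ w → G′ (u ++ᵛ (true ∷ᵛ w))) (λ w → G′ (u ++ᵛ (false ∷ᵛ w)))))
             (Σᵛ-cong (suc c) (pointwise u))) ⟩
      Σᵛ b (λ u → Σᵛ (suc c) (λ w → 2 * G (u ++ᵛ w) + h * H (u ++ᵛ w)))
        ≡⟨ Σᵛ-++ b (suc c) (λ t → 2 * G t + h * H t) ⟨
      Σᵛ (b + suc c) (λ t → 2 * G t + h * H t)
        ≡⟨ Σᵛ-+ (b + suc c) (λ t → 2 * G t) (λ t → h * H t) ⟩
      Σᵛ (b + suc c) (λ t → 2 * G t) + Σᵛ (b + suc c) (λ t → h * H t)
        ≡⟨ cong₂ _+_ (Σᵛ-* (b + suc c) 2 G) (Σᵛ-* (b + suc c) h H) ⟩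
      2 * good a (b + suc c) g + h * good a (b + suc c) (const 1) ∎
      where
      open ≡-Reasoning
      G′ : Vec Bool (b + suc (suc c)) → ℕ
      G′ t = g′ (layout′ t) when valid f′ (layout′ t)
      G H : Vec Bool (b + suc c) → ℕ
      G t = g (layout t) when valid f (layout t)
      H t = 1 when valid f (layout t)
      combine : ∀ {x y z} B → x + y ≡ 2 * z + h → x when B + y when B ≡ 2 * (z when B) + h * (1 when B)
      combine true  eq = trans eq (cong (_ +_) (sym (*-identityʳ h)))
      combine false eq = sym (*-zeroʳ h)
      pointwise : ∀ u w → G′ (u ++ᵛ (true ∷ᵛ w)) + G′ (u ++ᵛ (false ∷ᵛ w)) ≡ 2 * G (u ++ᵛ w) + h * H (u ++ᵛ w)
      pointwise u w rewrite valid-insert true u w | valid-insert false u w = combine (valid f (layout (u ++ᵛ w))) (eq u w)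

    good-number : good (suc a) (b + suc (suc c)) (const 1) ≡ 2 * good a (b + suc c) (const 1)
    good-number = trans (good-insert (const 1) (const 1) 0 (λ _ _ → refl)) (+-identityʳ _)

    -- The inserted gap occurs in both extensions and the free bit is a gap in one of them, so the
    -- two extensions together have 1 + 2 new gaps.
    good-gapTotal : good (suc a) (b + suc (suc c)) gapCount ≡ 2 * good a (b + suc c) gapCount + 3 * good a (b + suc c) (const 1)
    good-gapTotal = good-insert gapCount gapCount 3 gaps
      where
      gaps : ∀ u w → gapCount (layout′ (u ++ᵛ (true ∷ᵛ w))) + gapCount (layout′ (u ++ᵛ (false ∷ᵛ w)))
                     ≡ 2 * gapCount (layout (u ++ᵛ w)) + 3
      gaps u w rewrite gapCount-layout a (u ++ᵛ w) | gapCount-layout a (u ++ᵛ (true ∷ᵛ w)) | gapCount-layout a (u ++ᵛ (false ∷ᵛ w))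
                     | gapCount-++ u w | gapCount-++ u (true ∷ᵛ w) | gapCount-++ u (false ∷ᵛ w) = arith a (gapCount u) (gapCount w)
        where
        arith : ∀ a x y → suc a + (x + y) + (suc a + (x + suc y)) ≡ 2 * (a + (x + y)) + 3
        arith = solve-∀

  -- Many semigroups, few exceptional ones

  number-lower : ∀ a k → k ≤ a → 2 ^ k ≤ number (a + (k + 1))
  number-lower a k k≤a = begin
    2 ^ k                                    ≡⟨ Σᵛ-1 k ⟨
    Σᵛ k (const 1)                           ≤⟨ Σᵛ-mono k (λ u → ≤-trans (≤-reflexive (sym (cong (1 when_) (ok u)))) (m≤n+m _ _)) ⟩
    Σᵛ k (λ u → Σᵛ 1 (λ w → F (u ++ᵛ w)))    ≡⟨ Σᵛ-++ k 1 F ⟨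
    good a (k + 1) (const 1)                 ≤⟨ m≤m+n _ _ ⟩
    good a (k + 1) (const 1) + bad f a (const 1) ≡⟨ total-split a (k + 1) (const 1) ⟨
    number f                                 ∎
    where
    open ≤-Reasoning
    f = a + (k + 1)
    f≤ : a + (k + 1) ≤ a + a + 0 + 1
    f≤ = linear-≤ 0 k≤a (solve (a ∷ k ∷ []))
    F : Vec Bool (k + 1) → ℕ
    F w = 1 when valid f (true ∷ᵛ falses a ++ᵛ w)
    -- Every u is admissible: a sum of two nonzero elements is at least 2a + 2, which exceeds f = a
    -- + k + 1. Accordingly the middle block is taken empty.
    ok : ∀ u → valid f (true ∷ᵛ falses a ++ᵛ (u ++ᵛ (false ∷ᵛ []ᵛ))) ≡ true
    ok u = valid-true {v = v} (record
      { zero∈ = refl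
      ; add   = λ {x} {y} → closed-if-mid-closed a 0 {f} {bit v} (bit-low a []ᵛ (u ++ᵛ (false ∷ᵛ []ᵛ))) (bit-≥ v) f≤ (λ _ _ ()) x y
      ; f∉    = trans (cong (bit v) (e a k)) (bit-high a u (false ∷ᵛ []ᵛ) 0)
      })
      where
      v : Vec Bool (suc f)
      v = true ∷ᵛ falses a ++ᵛ (u ++ᵛ (false ∷ᵛ []ᵛ))
      e : ∀ a k → a + (k + 1) ≡ suc (a + (k + 0))
      e = solve-∀

  ^-distribʳ-* : ∀ k m n → (m * n) ^ k ≡ m ^ k * n ^ k
  ^-distribʳ-* zero    m n = refl
  ^-distribʳ-* (suc k) m n = trans (cong (m * n *_) (^-distribʳ-* k m n)) ([m*n]*[o*p]≡[m*o]*[n*p] m n (m ^ k) (n ^ k))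

  -- Bernoulli's inequality (1 + 1/15)^j ≥ 1 + j/15 with denominators cleared; it is used as
  -- (15/16)^j ≤ 15/(j + 15).
  bernoulli : ∀ j → 15 ^ j * (j + 15) ≤ 15 * 16 ^ j
  bernoulli zero    = ≤-refl
  bernoulli (suc j) = begin
    15 * 15 ^ j * (suc j + 15)                        ≤⟨ m≤m+n _ (15 ^ j * j) ⟩
    15 * 15 ^ j * (suc j + 15) + 15 ^ j * j           ≡⟨ collect (15 ^ j) j ⟩
    16 * (15 ^ j * (j + 15))                          ≤⟨ 16 ⊛ bernoulli j ⟩
    16 * (15 * 16 ^ j)                                ≡⟨ swap (16 ^ j) ⟩
    15 * (16 * 16 ^ j)                                ∎
    where
    open ≤-Reasoning
    collect : ∀ x j → 15 * x * (suc j + 15) + x * j ≡ 16 * (x * (j + 15))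
    collect = solve-∀
    swap : ∀ x → 16 * (15 * x) ≡ 15 * (16 * x)
    swap = solve-∀

  decayOf : ℕ → ℕ → ℕ
  decayOf k e = k ^ 5 * (3 * e ^ 5)

  -- The hypotheses say that B ≤ 3 f² (x/y)⁵ P with x/y ≤ e/t and f ≤ k t.
  quintic-decay : ∀ k e {f B P t x y} → .{{NonZero f}} → .{{NonZero y}} → f ≤ k * t → x * t ≤ e * y →
                  y ^ 5 * B ≤ 3 * (f * f * (x ^ 5 * P)) → f * f * f * B ≤ decayOf k e * P
  quintic-decay k e {f} {B} {P} {t} {x} {y} f≤ xt≤ bound =
    *-cancelʳ-≤ (f * f * f * B) (k ^ 5 * (3 * e ^ 5) * P) (f * f) {{m*n≢0 f f}} (*-cancelˡ-≤ (y ^ 5) {{m^n≢0 y 5}} (begin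
      y ^ 5 * (f * f * f * B * (f * f))                  ≡⟨ s₁ (y ^ 5) f B ⟩
      f ^ 5 * (y ^ 5 * B)                                ≤⟨ *-mono-≤ (≤-trans (^-monoˡ-≤ 5 f≤) (≤-reflexive (^-distribʳ-* 5 k t))) bound ⟩
      k ^ 5 * t ^ 5 * (3 * (f * f * (x ^ 5 * P)))        ≡⟨ s₂ (k ^ 5) (t ^ 5) (f * f) (x ^ 5) P ⟩
      k ^ 5 * (3 * (f * f) * P) * (x ^ 5 * t ^ 5)        ≤⟨ *-monoʳ-≤ (k ^ 5 * (3 * (f * f) * P)) xt⁵≤ ⟩
      k ^ 5 * (3 * (f * f) * P) * (e ^ 5 * y ^ 5)        ≡⟨ s₃ (k ^ 5) (f * f) P (e ^ 5) (y ^ 5) ⟩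
      y ^ 5 * (k ^ 5 * (3 * e ^ 5) * P * (f * f))        ∎))
    where
    open ≤-Reasoning
    xt⁵≤ : x ^ 5 * t ^ 5 ≤ e ^ 5 * y ^ 5
    xt⁵≤ = ≤-trans (≤-reflexive (sym (^-distribʳ-* 5 x t))) (≤-trans (^-monoˡ-≤ 5 xt≤) (≤-reflexive (^-distribʳ-* 5 e y)))
    s₁ : ∀ y f B → y * (f * f * f * B * (f * f)) ≡ f * (f * (f * (f * (f * 1)))) * (y * B)
    s₁ = solve-∀
    s₂ : ∀ k t s x P → k * t * (3 * (s * (x * P))) ≡ k * (3 * s * P) * (x * t)
    s₂ = solve-∀
    s₃ : ∀ k s P e y → k * (3 * s * P) * (e * y) ≡ y * (k * (3 * e) * P * s)
    s₃ = solve-∀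

  abstract
    decay : ℕ
    decay = decayOf 240 15

    decay≡ : decayOf 240 15 ≡ decay
    decay≡ = refl

  -- Taking n = 5j with j = ⌊(f - 40)/200⌋ turns the gain into a fifth power of (15/16)^j, which is
  -- O(1/f). Two of the five factors cancel the f² of the union bound; the other three give f³, one
  -- f for the size of the genus and f² for the rate of convergence.
  bad-decay : ∀ f a → 40 ≤ f → 8 * a ≤ 3 * f → a ≤ f → f * f * f * bad f a (const 1) ≤ decay * 2 ^ ⌊ f /2⌋
  bad-decay f a 40≤f 8a≤3f a≤f = go ((f ∸ 40) / 200) ((f ∸ 40) % 200) (m%n<n (f ∸ 40) 200)
      (trans (sym (m+[n∸m]≡n 40≤f)) (cong (40 +_) (m≡m%n+[m/n]*n (f ∸ 40) 200)))
    where
    power : ∀ b j → b ^ (5 * j) ≡ (b ^ j) ^ 5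
    power b j = trans (cong (b ^_) (*-comm 5 j)) (sym (^-*-assoc b j 5))

    go : ∀ j r → r < 200 → f ≡ 40 + (r + j * 200) → f * f * f * bad f a (const 1) ≤ decay * 2 ^ ⌊ f /2⌋
    go j r r< f≡ = ≤-trans
      (quintic-decay 240 15 {f} {bad f a (const 1)} {2 ^ ⌊ f /2⌋} {j + 15} {15 ^ j} {16 ^ j}
        {{>-nonZero (≤-trans (s≤s z≤n) 40≤f)}} {{m^n≢0 16 j}} small (bernoulli j)
        (subst₂ (λ y x → y * bad f a (const 1) ≤ 3 * (f * f * (x * 2 ^ ⌊ f /2⌋))) (power 16 j) (power 15 j)
          (bad-bound f a (5 * j) 8a≤3f a≤f large)))
      (*-monoˡ-≤ (2 ^ ⌊ f /2⌋) (≤-reflexive decay≡))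
      where
      small : f ≤ 240 * (j + 15)
      small = linear-≤ (40 * j + 3361) (≤-reflexive f≡ ⊹ r<) (solve (j ∷ r ∷ f ∷ []))
      large : 40 + 40 * (5 * j) ≤ f
      large = linear-≤ r (≤-reflexive (sym f≡)) (solve (j ∷ r ∷ f ∷ []))

  -- `number-lower` applies with k = ⌊(f - 1)/2⌋, which is f/2 - 1 for even f; hence the factor 2.
  number-half : ∀ f → 0 < f → 2 ^ ⌊ f /2⌋ ≤ 2 * number f
  number-half (suc g) _ = go ⌊ g /2⌋ (m≤n⇒∃[o]m+o≡n (⌊n/2⌋≤n g)) (⌊/2⌋-lower g) ⌊1+/2⌋≤
    where
    open ≤-Reasoning
    ⌊1+/2⌋≤ : ⌊ suc g /2⌋ ≤ suc ⌊ g /2⌋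
    ⌊1+/2⌋≤ = ⌊n/2⌋-mono (n≤1+n (suc g))
    go : ∀ k → ∃[ a ] k + a ≡ g → 2 * k ≤ g → ⌊ suc g /2⌋ ≤ suc k → 2 ^ ⌊ suc g /2⌋ ≤ 2 * number (suc g)
    go k (a , k+a≡g) 2k≤g half≤ = begin
      2 ^ ⌊ suc g /2⌋           ≤⟨ ^-monoʳ-≤ 2 half≤ ⟩
      2 * 2 ^ k                 ≤⟨ 2 ⊛ number-lower a k k≤a ⟩
      2 * number (a + (k + 1))  ≡⟨ cong (λ f → 2 * number f) (trans (reorder a k) (cong suc k+a≡g)) ⟩
      2 * number (suc g)        ∎
      where
      k≤a : k ≤ a
      k≤a = linear-≤ 0 (2k≤g ⊹ ≤-reflexive (sym k+a≡g)) (solve (k ∷ a ∷ g ∷ []))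
      reorder : ∀ a k → a + (k + 1) ≡ suc (k + a)
      reorder = solve-∀

  -- Comparing f with f + 2

  record Frame (f : ℕ) : Set where
    field
      a b c : ℕ
      f≡    : a + (b + suc c) ≡ f
      b≤    : b ≤ suc a
      c≤    : c ≤ a
      8a≤   : 8 * a + 2 ≤ 3 * f

  -- Here a = ⌊(3f - 2)/8⌋. The 2 makes a + 1 admissible for f + 2, because 8a + 2 ≤ 3f is the same
  -- as 8(a + 1) ≤ 3(f + 2). For f ≥ 40 the rounding still leaves f ≤ 3a + 1, so halving the
  -- positions above a gives small enough b and c.
  frame : ∀ f → 40 ≤ f → Frame f
  frame f 40≤f with 3 * f ∸ 2 | m+[n∸m]≡n {2} {3 * f} (≤-trans (≤-trans (s≤s (s≤s z≤n)) 40≤f) (m≤m+n f (2 * f)))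
  ... | d | 2+d≡ with d / 8 | d % 8 | m≡m%n+[m/n]*n d 8 | m%n<n d 8
  ...   | a | r | refl | r<8 = go (f ∸ a) (m+[n∸m]≡n a≤f)
    where
    8a≤ : 8 * a + 2 ≤ 3 * f
    8a≤ = linear-≤ r (≤-reflexive 2+d≡) (solve (a ∷ r ∷ f ∷ []))
    f≤3a+1 : f ≤ 3 * a + 1
    f≤3a+1 = *-cancelˡ-≤ 8 (linear-≤ 21 (≤-reflexive (cong (3 *_) (sym 2+d≡)) ⊹ 3 ⊛ r<8 ⊹ 40≤f) (solve (a ∷ r ∷ f ∷ [])))
    a≤f : a ≤ f
    a≤f = *-cancelˡ-≤ 8 (linear-≤ (5 * f + 2) 8a≤ (solve (a ∷ f ∷ [])))
    go : ∀ k → a + k ≡ f → Frame f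
    go zero    eq = ⊥-elim (<⇒≱ {3 * f} {8 * a + 2} (linear-≤ (121 + 2 * f) (3 ⊛ 40≤f ⊹ 8 ⊛ ≤-reflexive (sym eq)) (solve (a ∷ f ∷ []))) 8a≤)
    go (suc k) eq with ⌊ suc k /2⌋ | ⌊/2⌋-lower (suc k) | ⌊/2⌋-upper (suc k)
    ... | b | lower | upper with m≤n⇒∃[o]m+o≡n {b} {k} (half b lower)
      where
      half : ∀ b → 2 * b ≤ suc k → b ≤ k
      half zero    _  = z≤n
      half (suc b) le = linear-≤ b le (solve (b ∷ k ∷ []))
    ...   | c , refl = record
      { a = a ; b = b ; c = c
      ; f≡ = trans (cong (a +_) (+-suc b c)) eq
      ; b≤ = *-cancelˡ-≤ 2 (linear-≤ 1 (lower ⊹ f≤3a+1 ⊹ ≤-reflexive eq) (solve (a ∷ b ∷ c ∷ f ∷ [])))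
      ; c≤ = *-cancelˡ-≤ 2 (linear-≤ 0 (upper ⊹ f≤3a+1 ⊹ ≤-reflexive eq) (solve (a ∷ b ∷ c ∷ f ∷ [])))
      ; 8a≤ = 8a≤
      }

  -- N = n + x, N′ = 2n + x′, S = s + y, S′ = 2s + 3n + y′ for good parts n, s and
  -- bad parts x, x′, y, y′; then S′/N′ and S/N + 3/2 differ by O(E/T).
  module Compare (n x x′ s y y′ T E d d′ : ℕ)
    (d≤d′ : d ≤ d′) (1≤d′ : 1 ≤ d′)
    (s≤ : s ≤ d * (n + x)) (y≤ : y ≤ d * x) (y′≤ : y′ ≤ d′ * x′)
    (x-small : T * (d * x) ≤ E * (n + x)) (x-small′ : T * (d * x) ≤ E * (2 * n + x′))
    (x′-small : T * (d′ * x′) ≤ E * (2 * n + x′)) where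
    open ≤-Reasoning

    N N′ S S′ : ℕ
    N  = n + x
    N′ = 2 * n + x′
    S  = s + y
    S′ = 2 * s + 3 * n + y′

    -- After cross-multiplication the products of good parts cancel. Each remaining error term has a
    -- factor x, x′, y or y′, and T times it is at most E N N′. Of the 14 such terms that the
    -- constant 7 provides, six are used here and seven in `lower`.
    upper : S′ * (N * (2 * T)) ≤ ((S * 2 + 3 * N) * T + 7 * E * (N * 2)) * N′
    upper = begin
      S′ * (N * (2 * T))
        ≤⟨ m≤m+n _ (T * (2 * (s * x′) + 2 * (y * N′) + 3 * (N * x′))) ⟩
      S′ * (N * (2 * T)) + T * (2 * (s * x′) + 2 * (y * N′) + 3 * (N * x′))
        ≡⟨ identity ⟩
      (S * 2 + 3 * N) * T * N′ + (4 * (T * (s * x)) + 2 * (T * (y′ * N)))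
        ≤⟨ +-monoʳ-≤ ((S * 2 + 3 * N) * T * N′) (4 ⊛ p₁ ⊹ 2 ⊛ p₂) ⟩
      (S * 2 + 3 * N) * T * N′ + (4 * (E * N′ * N) + 2 * (E * N′ * N))
        ≤⟨ m≤m+n _ (8 * (E * N′ * N)) ⟩
      (S * 2 + 3 * N) * T * N′ + (4 * (E * N′ * N) + 2 * (E * N′ * N)) + 8 * (E * N′ * N)
        ≡⟨ collect (S * 2 + 3 * N) T N′ E N ⟩
      ((S * 2 + 3 * N) * T + 7 * E * (N * 2)) * N′ ∎
      where
      identity : S′ * (N * (2 * T)) + T * (2 * (s * x′) + 2 * (y * N′) + 3 * (N * x′)) ≡
                 (S * 2 + 3 * N) * T * N′ + (4 * (T * (s * x)) + 2 * (T * (y′ * N)))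
      identity = lemma n x x′ s y y′ T
        where
        lemma : ∀ n x x′ s y y′ T →
          (2 * s + 3 * n + y′) * ((n + x) * (2 * T)) + T * (2 * (s * x′) + 2 * (y * (2 * n + x′)) + 3 * ((n + x) * x′)) ≡
          ((s + y) * 2 + 3 * (n + x)) * T * (2 * n + x′) + (4 * (T * (s * x)) + 2 * (T * (y′ * (n + x))))
        lemma = solve-∀
      collect : ∀ A T N′ E N →
        A * T * N′ + (4 * (E * N′ * N) + 2 * (E * N′ * N)) + 8 * (E * N′ * N) ≡ (A * T + 7 * E * (N * 2)) * N′
      collect = solve-∀
      p₁ : T * (s * x) ≤ E * N′ * N
      p₁ = begin
        T * (s * x)       ≤⟨ T ⊛ (*-monoˡ-≤ x s≤) ⟩
        T * (d * N * x)   ≡⟨ swap T d N x ⟩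
        T * (d * x) * N   ≤⟨ *-monoˡ-≤ N x-small′ ⟩
        E * N′ * N        ∎
        where
        swap : ∀ T d N x → T * (d * N * x) ≡ T * (d * x) * N
        swap = solve-∀
      p₂ : T * (y′ * N) ≤ E * N′ * N
      p₂ = begin
        T * (y′ * N)         ≤⟨ T ⊛ (*-monoˡ-≤ N y′≤) ⟩
        T * (d′ * x′ * N)    ≡⟨ *-assoc T (d′ * x′) N ⟨
        T * (d′ * x′) * N    ≤⟨ *-monoˡ-≤ N x′-small ⟩
        E * N′ * N           ∎

    lower : (S * 2 + 3 * N) * (N′ * T) ≤ (S′ * T + 7 * E * N′) * (N * 2)
    lower = begin
      (S * 2 + 3 * N) * (N′ * T)
        ≤⟨ m≤m+n _ (4 * (T * (s * x)) + 2 * (T * (y′ * N))) ⟩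
      (S * 2 + 3 * N) * (N′ * T) + (4 * (T * (s * x)) + 2 * (T * (y′ * N)))
        ≡⟨ identity ⟩
      S′ * T * (N * 2) + (2 * (T * (s * x′)) + 2 * (T * (y * N′)) + 3 * (T * (x′ * N)))
        ≤⟨ +-monoʳ-≤ (S′ * T * (N * 2)) (2 ⊛ p₁ ⊹ 2 ⊛ p₂ ⊹ 3 ⊛ p₃) ⟩
      S′ * T * (N * 2) + (2 * (E * N′ * N) + 2 * (E * N * N′) + 3 * (E * N′ * N))
        ≤⟨ m≤m+n _ (7 * (E * N′ * N)) ⟩
      S′ * T * (N * 2) + (2 * (E * N′ * N) + 2 * (E * N * N′) + 3 * (E * N′ * N)) + 7 * (E * N′ * N)
        ≡⟨ collect S′ T N′ E N ⟩
      (S′ * T + 7 * E * N′) * (N * 2) ∎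
      where
      identity : (S * 2 + 3 * N) * (N′ * T) + (4 * (T * (s * x)) + 2 * (T * (y′ * N))) ≡
                 S′ * T * (N * 2) + (2 * (T * (s * x′)) + 2 * (T * (y * N′)) + 3 * (T * (x′ * N)))
      identity = lemma n x x′ s y y′ T
        where
        lemma : ∀ n x x′ s y y′ T →
          ((s + y) * 2 + 3 * (n + x)) * ((2 * n + x′) * T) + (4 * (T * (s * x)) + 2 * (T * (y′ * (n + x)))) ≡
          (2 * s + 3 * n + y′) * T * ((n + x) * 2) + (2 * (T * (s * x′)) + 2 * (T * (y * (2 * n + x′))) + 3 * (T * (x′ * (n + x))))
        lemma = solve-∀
      collect : ∀ S′ T N′ E N →
        S′ * T * (N * 2) + (2 * (E * N′ * N) + 2 * (E * N * N′) + 3 * (E * N′ * N)) + 7 * (E * N′ * N) ≡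
        (S′ * T + 7 * E * N′) * (N * 2)
      collect = solve-∀
      p₁ : T * (s * x′) ≤ E * N′ * N
      p₁ = begin
        T * (s * x′)       ≤⟨ T ⊛ (*-monoˡ-≤ x′ (≤-trans s≤ (*-monoˡ-≤ N d≤d′))) ⟩
        T * (d′ * N * x′)  ≡⟨ swap T d′ N x′ ⟩
        T * (d′ * x′) * N  ≤⟨ *-monoˡ-≤ N x′-small ⟩
        E * N′ * N         ∎
        where
        swap : ∀ T d N x → T * (d * N * x) ≡ T * (d * x) * N
        swap = solve-∀
      p₂ : T * (y * N′) ≤ E * N * N′
      p₂ = begin
        T * (y * N′)         ≤⟨ T ⊛ (*-monoˡ-≤ N′ y≤) ⟩
        T * (d * x * N′)     ≡⟨ *-assoc T (d * x) N′ ⟨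
        T * (d * x) * N′     ≤⟨ *-monoˡ-≤ N′ x-small ⟩
        E * N * N′           ∎
      p₃ : T * (x′ * N) ≤ E * N′ * N
      p₃ = begin
        T * (x′ * N)         ≤⟨ T ⊛ (*-monoˡ-≤ N (m≤n*m x′ d′ {{>-nonZero 1≤d′}})) ⟩
        T * (d′ * x′ * N)    ≡⟨ *-assoc T (d′ * x′) N ⟨
        T * (d′ * x′) * N    ≤⟨ *-monoˡ-≤ N x′-small ⟩
        E * N′ * N           ∎

  abstract
    -- One factor 2 comes from f + 1 ≤ 2f, the other from `number-half`.
    rate : ℕ
    rate = 4 * decay

    rate≡ : rate ≡ 4 * decay
    rate≡ = refl

  total-gapCount : ∀ a k → good a k gapCount ≤ suc (a + k) * total (a + k) (const 1)
  total-gapCount a k = begin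
    good a k gapCount                        ≤⟨ m≤m+n _ _ ⟩
    good a k gapCount + bad (a + k) a gapCount ≡⟨ total-split a k gapCount ⟨
    total (a + k) gapCount                   ≤⟨ Σᵛ-mono (suc (a + k)) (λ v → when-≤ (gapCount≤ v) (valid (a + k) v)) ⟩
    Σᵛ (suc (a + k)) (λ v → suc (a + k) * (1 when valid (a + k) v)) ≡⟨ Σᵛ-* (suc (a + k)) (suc (a + k)) (λ v → 1 when valid (a + k) v) ⟩
    suc (a + k) * total (a + k) (const 1)    ∎
    where
    open ≤-Reasoning

  -- S′/N′ ≤ S/N + 3/2 + 7R/T and S/N + 3/2 ≤ S′/N′ + 7R/T, with denominators cleared.
  Near : (T R N N′ S S′ : ℕ) → Set
  Near T R N N′ S S′ = S′ * (N * (2 * T)) ≤ ((S * 2 + 3 * N) * T + 7 * R * (N * 2)) * N′ ×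
                       (S * 2 + 3 * N) * (N′ * T) ≤ (S′ * T + 7 * R * N′) * (N * 2)

  Step : ℕ → ℕ → Set
  Step T f = Near T rate (number f) (number (2 + f)) (gapTotal f) (gapTotal (2 + f))

  -- `T` is left free below f² so that it can be chosen as (n + 1)(n + 2), whose reciprocals
  -- telescope.
  step : ∀ f T → 40 ≤ f → T ≤ f * f → Step T f
  step f T 40≤f T≤ = subst (Step T) f≡ (core a b c b≤ c≤ (subst (λ f → 8 * a + 2 ≤ 3 * f) (sym f≡) 8a≤)
      (subst (40 ≤_) (sym f≡) 40≤f) (subst (λ f → T ≤ f * f) (sym f≡) T≤))
    where
    open Frame (frame f 40≤f)
    open ≤-Reasoning
    small : ∀ f₀ f₁ a → T ≤ f₀ * f₀ → 40 ≤ f₀ → f₀ ≤ f₁ → 8 * a ≤ 3 * f₀ →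
            T * (suc f₀ * bad f₀ a (const 1)) ≤ rate * number f₁
    small f₀ f₁ a T≤ 40≤ f₀≤ 8a≤ = begin
      T * (suc f₀ * x)                       ≤⟨ *-mono-≤ T≤ (*-monoˡ-≤ x suc≤) ⟩
      f₀ * f₀ * (2 * f₀ * x)                 ≡⟨ s₁ f₀ x ⟩
      2 * (f₀ * f₀ * f₀ * x)                 ≤⟨ 2 ⊛ bad-decay f₀ a 40≤ 8a≤ a≤f₀ ⟩
      2 * (decay * 2 ^ ⌊ f₀ /2⌋)             ≤⟨ 2 ⊛ (decay ⊛ ^-monoʳ-≤ 2 (⌊n/2⌋-mono f₀≤)) ⟩
      2 * (decay * 2 ^ ⌊ f₁ /2⌋)             ≤⟨ 2 ⊛ (decay ⊛ number-half f₁ (≤-trans (≤-trans (s≤s z≤n) 40≤) f₀≤)) ⟩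
      2 * (decay * (2 * number f₁))          ≡⟨ s₂ decay (number f₁) ⟩
      4 * decay * number f₁                  ≡⟨ cong (_* number f₁) rate≡ ⟨
      rate * number f₁                       ∎
      where
      x = bad f₀ a (const 1)
      s₁ : ∀ f x → f * f * (2 * f * x) ≡ 2 * (f * f * f * x)
      s₁ = solve-∀
      s₂ : ∀ d n → 2 * (d * (2 * n)) ≡ 4 * d * n
      s₂ = solve-∀
      suc≤ : suc f₀ ≤ 2 * f₀
      suc≤ = linear-≤ 39 40≤ (solve (f₀ ∷ []))
      a≤f₀ : a ≤ f₀
      a≤f₀ = *-cancelˡ-≤ 8 (linear-≤ (5 * f₀) 8a≤ (solve (a ∷ f₀ ∷ [])))

    core : ∀ a b c → b ≤ suc a → c ≤ a → 8 * a + 2 ≤ 3 * (a + (b + suc c)) → 40 ≤ a + (b + suc c) →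
           T ≤ (a + (b + suc c)) * (a + (b + suc c)) → Step T (a + (b + suc c))
    core a b c b≤ c≤ 8a≤ 40≤f T≤ = transport N≡ N′≡ S≡ S′≡ (C.upper , C.lower)
      where
      open Insertion a b c b≤ c≤ using (good-number; good-gapTotal)
      f₀ = a + (b + suc c)
      f₁ = suc a + (b + suc (suc c))
      n = good a (b + suc c) (const 1)
      s = good a (b + suc c) gapCount
      x = bad f₀ a (const 1)
      y = bad f₀ a gapCount
      x′ = bad f₁ (suc a) (const 1)
      y′ = bad f₁ (suc a) gapCount
      f₁≡ : f₁ ≡ 2 + f₀
      f₁≡ = lemma a b c
        where
        lemma : ∀ a b c → suc a + (b + suc (suc c)) ≡ 2 + (a + (b + suc c))
        lemma = solve-∀
      f₀≤f₁ : f₀ ≤ f₁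
      f₀≤f₁ = ≤-trans (m≤n+m f₀ 2) (≤-reflexive (sym f₁≡))
      transport : ∀ {N N₁ N′ N₁′ S S₁ S′ S₁′} → N ≡ N₁ → N′ ≡ N₁′ → S ≡ S₁ → S′ ≡ S₁′ →
                  Near T rate N N′ S S′ → Near T rate N₁ N₁′ S₁ S₁′
      transport refl refl refl refl h = h
      N≡ : n + x ≡ number f₀
      N≡ = sym (total-split a (b + suc c) (const 1))
      S≡ : s + y ≡ gapTotal f₀
      S≡ = sym (total-split a (b + suc c) gapCount)
      N₁≡ : 2 * n + x′ ≡ number f₁
      N₁≡ = sym (trans (total-split (suc a) (b + suc (suc c)) (const 1)) (cong (_+ x′) good-number))
      N′≡ : 2 * n + x′ ≡ number (2 + f₀)
      N′≡ = trans N₁≡ (cong number f₁≡)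
      S′≡ : 2 * s + 3 * n + y′ ≡ gapTotal (2 + f₀)
      S′≡ = trans (sym (trans (total-split (suc a) (b + suc (suc c)) gapCount) (cong (_+ y′) good-gapTotal))) (cong gapTotal f₁≡)
      d≤ : suc f₀ ≤ suc f₁
      d≤ = s≤s f₀≤f₁
      s≤ : s ≤ suc f₀ * (n + x)
      s≤ = ≤-trans (total-gapCount a (b + suc c)) (*-monoʳ-≤ (suc f₀) (≤-reflexive (sym N≡)))
      y≤ : y ≤ suc f₀ * x
      y≤ = bad-gapCount f₀ a
      y′≤ : y′ ≤ suc f₁ * x′
      y′≤ = bad-gapCount f₁ (suc a)
      8a≤₀ : 8 * a ≤ 3 * f₀
      8a≤₀ = ≤-trans (m≤m+n (8 * a) 2) 8a≤
      8a≤₁ : 8 * suc a ≤ 3 * (suc a + (b + suc (suc c)))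
      8a≤₁ = linear-≤ 0 8a≤ (solve (a ∷ b ∷ c ∷ []))
      x≤ : T * (suc f₀ * x) ≤ rate * (n + x)
      x≤ = ≤-trans (small f₀ f₀ a T≤ 40≤f ≤-refl 8a≤₀) (*-monoʳ-≤ rate (≤-reflexive (sym N≡)))
      x≤′ : T * (suc f₀ * x) ≤ rate * (2 * n + x′)
      x≤′ = ≤-trans (small f₀ f₁ a T≤ 40≤f f₀≤f₁ 8a≤₀) (*-monoʳ-≤ rate (≤-reflexive (sym N₁≡)))
      x′≤ : T * (suc f₁ * x′) ≤ rate * (2 * n + x′)
      x′≤ = ≤-trans (small f₁ f₁ (suc a) (≤-trans T≤ (*-mono-≤ f₀≤f₁ f₀≤f₁)) (≤-trans 40≤f f₀≤f₁) ≤-refl 8a≤₁)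
              (*-monoʳ-≤ rate (≤-reflexive (sym N₁≡)))
      module C = Compare n x x′ s y y′ T rate (suc f₀) (suc f₁) d≤ (s≤s z≤n) s≤ y≤ y′≤ x≤ x≤′ x′≤

open Counting using (linear-≤; number; gapTotal; sum-genera; length-genera; number-half; rate; step; Near)
open import Defs
open import Data.Empty using (⊥-elim)
open import Data.Integer using (+_)
open import Data.Integer as ℤ using (+[1+_]; -[1+_])
import Data.Integer.Properties as ℤ
open import Data.List using ([]; _∷_; length; map)
open import Data.Nat using (ℕ; _*_)
open import Data.Nat as ℕ using (zero; suc; z≤n; s≤s; _%_)
open import Data.Nat.Divisibility using (divides)
open import Data.Nat.DivMod using (m≡m%n+[m/n]*n; m%n<n)
open import Data.Nat.ListAction using (sum)
import Data.Nat.Properties as ℕ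
open import Data.Nat.Tactic.RingSolver using (solve; solve-∀)
open import Data.Product using (_×_; ∃₂)
open import Data.Product using (_,_; proj₁; proj₂; ∃-syntax)
open import Data.Rational using (_/_; _-_)
open import Data.Rational using (ℚ; mkℚ; 0ℚ; 1ℚ; _+_; _≤_; _<_; fromℚᵘ; -_)
open import Data.Rational.Properties
open import Data.Rational.Solver using (module +-*-Solver)
open import Data.Rational.Unnormalised as ℚᵘ using (mkℚᵘ; *≤*; *<*)
import Data.Rational.Unnormalised.Properties as ℚᵘ
open import Data.Sum using (_⊎_; inj₁; inj₂)
open import Function using (mk⇔)
open import Relation.Binary.PropositionalEquality
open import Relation.Nullary using (yes; no)

-- Convergence

module NestedIntervals (a w : ℕ → ℚ) (w≥0 : ∀ n → 0ℚ ≤ w n)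
  (up↓ : ∀ n → a (suc n) + w (suc n) ≤ a n + w n)
  (lo↑ : ∀ n → a n - w n ≤ a (suc n) - w (suc n))
  (w→0 : ∀ ε → 0ℚ < ε → ∃[ N ] (∀ n → N ℕ.≤ n → w n + w n < ε)) where

  lo up : ℕ → ℚ
  lo n = a n - w n
  up n = a n + w n

  lo≤up : ∀ n → lo n ≤ up n
  lo≤up n = +-monoʳ-≤ (a n) (≤-trans (neg-antimono-≤ (w≥0 n)) (w≥0 n))

  lo-mono : ∀ n k → lo n ≤ lo (k ℕ.+ n)
  lo-mono n zero    = ≤-refl
  lo-mono n (suc k) = ≤-trans (lo-mono n k) (lo↑ (k ℕ.+ n))

  up-mono : ∀ n k → up (k ℕ.+ n) ≤ up n
  up-mono n zero    = ≤-refl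
  up-mono n (suc k) = ≤-trans (up↓ (k ℕ.+ n)) (up-mono n k)

  lo≤up′ : ∀ n m → lo n ≤ up m
  lo≤up′ n m = ≤-trans (lo-mono n m) (≤-trans (lo≤up (m ℕ.+ n))
    (subst (λ k → up k ≤ up m) (ℕ.+-comm n m) (up-mono m n)))

  x-1<x : ∀ x → x - 1ℚ < x
  x-1<x x = subst (x - 1ℚ <_) (+-identityʳ x) (+-monoʳ-< x {x = - 1ℚ} {y = 0ℚ} (negative⁻¹ (- 1ℚ)))

  x<x+1 : ∀ x → x < x + 1ℚ
  x<x+1 x = subst (_< x + 1ℚ) (+-identityʳ x) (+-monoʳ-< x {x = 0ℚ} {y = 1ℚ} (positive⁻¹ 1ℚ))

  open +-*-Solver using (_:+_; _:-_; _:=_) renaming (solve to solveℚ)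

  real : ℝ
  real = record
    { Lower         = λ q → ∃[ n ] q < lo n
    ; Upper         = λ q → ∃[ n ] up n < q
    ; lower-inhab   = lo 0 - 1ℚ , 0 , x-1<x (lo 0)
    ; upper-inhab   = up 0 + 1ℚ , 0 , x<x+1 (up 0)
    ; lower-rounded = λ q → mk⇔
        (λ (n , q<) → let r , q<r , r< = <-dense q< in r , q<r , n , r<)
        (λ (r , q<r , n , r<) → n , <-trans q<r r<)
    ; upper-rounded = λ q → mk⇔
        (λ (n , <q) → let r , <r , r<q = <-dense <q in r , r<q , n , <r)
        (λ (r , r<q , n , <r) → n , <-trans <r r<q)
    ; disjoint      = λ q ((n , q<) , (m , <q)) → <-irrefl refl (<-≤-trans (<-trans <q q<) (lo≤up′ n m))
    ; located       = located
    }
    where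
    -- Once the N-th interval is shorter than r - q, a lower end at or below q forces the upper end
    -- below r; so the decidable comparison of q with `lo N` suffices.
    located : ∀ q r → q < r → (∃[ n ] q < lo n) ⊎ (∃[ n ] up n < r)
    located q r q<r with w→0 (r - q) (subst (_< r - q) (+-inverseʳ q) (+-monoˡ-< (- q) q<r))
    ... | N , small with q <? lo N
    ...   | yes q<lo = inj₁ (N , q<lo)
    ...   | no q≮lo = inj₂ (N , subst₂ _<_
              (solveℚ 2 (λ a w → (a :- w) :+ (w :+ w) := a :+ w) refl (a N) (w N))
              (solveℚ 2 (λ q r → q :+ (r :- q) := r) refl q r)
              (+-mono-≤-< (≮⇒≥ q≮lo) (small N ℕ.≤-refl)))

  close : ∀ ε → 0ℚ < ε → ∃[ N ] (∀ n → N ℕ.≤ n → ∣ a n - real ∣< ε)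
  close ε 0<ε with w→0 ε 0<ε
  ... | N , small = N , λ n N≤n →
    (n , +-monoʳ-< (a n) (neg-antimono-< (w< n N≤n))) , (n , +-monoʳ-< (a n) (w< n N≤n))
    where
    w< : ∀ n → N ℕ.≤ n → w n < ε
    w< n N≤n = ≤-<-trans (subst (_≤ w n + w n) (+-identityʳ (w n)) (+-monoʳ-≤ (w n) (w≥0 n))) (small n N≤n)

  converges : ∀ {P : ℕ → Set} (D : ℕ → ℚ) s → (∀ n → a n ≡ D (s ℕ.+ 2 * n)) →
              (∀ f → s ℕ.≤ f → P f → ∃[ n ] f ≡ s ℕ.+ 2 * n) → ConvergesAlong P D real
  converges D s a≡ index ε 0<ε with close ε 0<ε
  ... | N , near = s ℕ.+ 2 * N , λ f f≥ Pf → go f f≥ (index f (ℕ.≤-trans (ℕ.m≤m+n s (2 * N)) f≥) Pf)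
    where
    go : ∀ f → s ℕ.+ 2 * N ℕ.≤ f → (∃[ n ] f ≡ s ℕ.+ 2 * n) → ∣ D f - real ∣< ε
    go f f≥ (n , refl) = subst (λ x → ∣ x - real ∣< ε) (a≡ n) (near n (ℕ.*-cancelˡ-≤ 2 (ℕ.+-cancelˡ-≤ s _ _ f≥)))

-- Fractions and the deviation from 3f/4

fromℚᵘ-mono-≤ : ∀ {p q} → p ℚᵘ.≤ q → fromℚᵘ p ≤ fromℚᵘ q
fromℚᵘ-mono-≤ {p} {q} p≤q = toℚᵘ-cancel-≤
  (ℚᵘ.≤-respˡ-≃ (ℚᵘ.≃-sym (toℚᵘ-fromℚᵘ p)) (ℚᵘ.≤-respʳ-≃ (ℚᵘ.≃-sym (toℚᵘ-fromℚᵘ q)) p≤q))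

fromℚᵘ-homo-+ : ∀ p q → fromℚᵘ (p ℚᵘ.+ q) ≡ fromℚᵘ p + fromℚᵘ q
fromℚᵘ-homo-+ p q = toℚᵘ-injective (ℚᵘ.≃-trans (toℚᵘ-fromℚᵘ (p ℚᵘ.+ q)) (ℚᵘ.≃-sym
  (ℚᵘ.≃-trans (toℚᵘ-homo-+ (fromℚᵘ p) (fromℚᵘ q)) (ℚᵘ.+-cong (toℚᵘ-fromℚᵘ p) (toℚᵘ-fromℚᵘ q)))))

frac-+ : ∀ a b c d → (+ a / suc b) + (+ c / suc d) ≡ + (a * suc d ℕ.+ c * suc b) / (suc b * suc d)
frac-+ a b c d = trans (sym (fromℚᵘ-homo-+ (mkℚᵘ (+ a) b) (mkℚᵘ (+ c) d)))
  (cong (λ i → i / (suc b * suc d)) (cong₂ ℤ._+_ (sym (ℤ.pos-* a (suc d))) (sym (ℤ.pos-* c (suc b)))))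

frac-≤ : ∀ a b c d → a * suc d ℕ.≤ c * suc b → + a / suc b ≤ + c / suc d
frac-≤ a b c d le = fromℚᵘ-mono-≤ {mkℚᵘ (+ a) b} {mkℚᵘ (+ c) d}
  (*≤* (subst₂ ℤ._≤_ (ℤ.pos-* a (suc d)) (ℤ.pos-* c (suc b)) (ℤ.+≤+ le)))

frac-≡ : ∀ a b c d → a * suc d ≡ c * suc b → + a / suc b ≡ + c / suc d
frac-≡ a b c d eq = ≤-antisym (frac-≤ a b c d (ℕ.≤-reflexive eq)) (frac-≤ c d a b (ℕ.≤-reflexive (sym eq)))

frac-small : ∀ c ε → 0ℚ < ε → ∃[ N ] (∀ n → N ℕ.≤ n → + c / suc n < ε)
frac-small c ε@(mkℚ +[1+ k ] d _) _ = c * suc d , λ n N≤n →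
  toℚᵘ-cancel-< (ℚᵘ.<-respˡ-≃ (ℚᵘ.≃-sym (toℚᵘ-fromℚᵘ (mkℚᵘ (+ c) n)))
    (*<* (subst₂ ℤ._<_ (ℤ.pos-* c (suc d)) (ℤ.pos-* (suc k) (suc n))
      (ℤ.+<+ (ℕ.≤-trans (s≤s N≤n) (ℕ.m≤m+n (suc n) (k * suc n)))))))
frac-small c (mkℚ (+ 0) d _) (_<_.*<* (ℤ.+<+ ()))
frac-small c (mkℚ -[1+ k ] d _) (_<_.*<* ())

number-suc : ∀ f → 40 ℕ.≤ f → ∃[ d ] number f ≡ suc d
number-suc f 40≤f with number f | number-half f (ℕ.≤-trans (s≤s z≤n) 40≤f)
... | suc d | _  = d , refl
... | zero  | le = ⊥-elim (ℕ.<⇒≱ (ℕ.m^n>0 2 ℕ.⌊ f /2⌋) le)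

mean-/ : ∀ xs {s d} → sum xs ≡ s → length xs ≡ suc d → mean xs ≡ + s / suc d
mean-/ (x ∷ xs) refl refl = refl

expectedGenus-/ : ∀ {f d} → number f ≡ suc d → expectedGenus f ≡ + gapTotal f / suc d
expectedGenus-/ {f} eq = mean-/ (map genus (Enumeration.elements (semigroupsWithFrobenius f))) (sum-genera f) (trans (length-genera f) eq)

deviation : ℕ → ℚ
deviation f = expectedGenus f - (+ (3 * f) / 4)

spread : ℕ
spread = 7 * rate

shift : ∀ f → + (3 * (2 ℕ.+ f)) / 4 ≡ (+ (3 * f) / 4) + (+ 3 / 2)
shift f = trans (frac-≡ (3 * (2 ℕ.+ f)) 3 (3 * f * 2 ℕ.+ 3 * 4) 7 (solve (f ∷ []))) (sym (frac-+ (3 * f) 3 3 1))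

near⇒≤ : ∀ t R d d′ S S′ → Near (suc t) R (suc d) (suc d′) S S′ →
         (+ S′ / suc d′ ≤ (+ S / suc d + + 3 / 2) + + (7 * R) / suc t) ×
         (+ S / suc d + + 3 / 2 ≤ + S′ / suc d′ + + (7 * R) / suc t)
near⇒≤ t R d d′ S S′ (upper , lower) =
  subst (+ S′ / suc d′ ≤_) (sym (trans (cong (_+ + (7 * R) / suc t) (frac-+ S d 3 1)) (frac-+ (S * 2 ℕ.+ 3 * suc d) (1 ℕ.+ d * 2) (7 * R) t)))
    (frac-≤ S′ d′ ((S * 2 ℕ.+ 3 * suc d) * suc t ℕ.+ 7 * R * (suc d * 2)) (t ℕ.+ (1 ℕ.+ d * 2) * suc t)
      (ℕ.≤-trans (ℕ.≤-reflexive (cong (S′ *_) (ℕ.*-assoc (suc d) 2 (suc t)))) upper)) ,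
  subst₂ _≤_ (sym (frac-+ S d 3 1)) (sym (frac-+ S′ d′ (7 * R) t))
    (frac-≤ (S * 2 ℕ.+ 3 * suc d) (1 ℕ.+ d * 2) (S′ * suc t ℕ.+ 7 * R * suc d′) (t ℕ.+ d′ * suc t) lower)

module _ (A A′ B B′ h δ : ℚ) (B′≡ : B′ ≡ B + h) where
  open +-*-Solver using (_:+_; _:-_; _:=_) renaming (solve to solveℚ)

  difference-upper : A′ ≤ (A + h) + δ → A′ - B′ ≤ (A - B) + δ
  difference-upper le = subst₂ _≤_ (cong (λ b → A′ - b) (sym B′≡))
    (solveℚ 4 (λ A B h δ → ((A :+ h) :+ δ) :- (B :+ h) := (A :- B) :+ δ) refl A B h δ)
    (+-monoˡ-≤ (- (B + h)) le)

  difference-lower : A + h ≤ A′ + δ → A - B ≤ (A′ - B′) + δ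
  difference-lower le = subst₂ _≤_
    (solveℚ 3 (λ A B h → (A :+ h) :- (B :+ h) := A :- B) refl A B h)
    (trans (solveℚ 4 (λ A B h δ → (A :+ δ) :- (B :+ h) := (A :- (B :+ h)) :+ δ) refl A′ B h δ)
      (cong (λ b → (A′ - b) + δ) (sym B′≡)))
    (+-monoˡ-≤ (- (B + h)) le)

module _ (f n : ℕ) (40≤f : 40 ℕ.≤ f) (n+2≤f : suc (suc n) ℕ.≤ f) where

  private
    t : ℕ
    -- Chosen so that `suc t` is by definition (n + 1)(n + 2), the denominator that `telescope`
    -- needs.
    t = suc n ℕ.+ n * suc (suc n)

    T≤ : suc t ℕ.≤ f * f
    T≤ = ℕ.*-mono-≤ {suc n} (ℕ.≤-trans (ℕ.n≤1+n (suc n)) n+2≤f) n+2≤f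

    Close : ℚ → ℚ → Set
    Close e e′ = (e′ ≤ (e + + 3 / 2) + + spread / suc t) × (e + + 3 / 2 ≤ e′ + + spread / suc t)

    bounds : Close (expectedGenus f) (expectedGenus (2 ℕ.+ f))
    bounds = go (number-suc f 40≤f) (number-suc (2 ℕ.+ f) (ℕ.≤-trans 40≤f (ℕ.m≤n+m f 2)))
      where
      go : ∃[ d ] number f ≡ suc d → ∃[ d′ ] number (2 ℕ.+ f) ≡ suc d′ → Close (expectedGenus f) (expectedGenus (2 ℕ.+ f))
      go (d , eq) (d′ , eq′) = subst₂ Close
        (sym (expectedGenus-/ {f} {d} eq)) (sym (expectedGenus-/ {2 ℕ.+ f} {d′} eq′))
        (near⇒≤ t rate d d′ (gapTotal f) (gapTotal (2 ℕ.+ f))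
          (subst₂ (λ N N′ → Near (suc t) rate N N′ (gapTotal f) (gapTotal (2 ℕ.+ f))) eq eq′ (step f (suc t) 40≤f T≤)))

  deviation-upper : deviation (2 ℕ.+ f) ≤ deviation f + + spread / suc t
  deviation-upper = difference-upper (expectedGenus f) (expectedGenus (2 ℕ.+ f)) (+ (3 * f) / 4) (+ (3 * (2 ℕ.+ f)) / 4)
    (+ 3 / 2) (+ spread / suc t) (shift f) (proj₁ bounds)

  deviation-lower : deviation f ≤ deviation (2 ℕ.+ f) + + spread / suc t
  deviation-lower = difference-lower (expectedGenus f) (expectedGenus (2 ℕ.+ f)) (+ (3 * f) / 4) (+ (3 * (2 ℕ.+ f)) / 4)
    (+ 3 / 2) (+ spread / suc t) (shift f) (proj₂ bounds)

-- The tail of the series of step bounds: the sum of `spread` / ((k + 1)(k + 2)) over k ≥ n. With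
-- this half-width each interval contains the next one.
width : ℕ → ℚ
width n = + spread / suc n

telescope : ∀ n → (+ spread / (suc n * suc (suc n))) + width (suc n) ≡ width n
telescope n = trans (frac-+ spread (suc n ℕ.+ n * suc (suc n)) spread (suc n))
  (frac-≡ (spread * suc (suc n) ℕ.+ spread * (suc n * suc (suc n))) _ spread n (identity spread n))
  where
  identity : ∀ c n → (c * suc (suc n) ℕ.+ c * (suc n * suc (suc n))) * suc n ≡ c * (suc n * suc (suc n) * suc (suc n))
  identity = solve-∀

width≥0 : ∀ n → 0ℚ ≤ width n
width≥0 n = frac-≤ 0 0 spread n z≤n

width→0 : ∀ ε → 0ℚ < ε → ∃[ N ] (∀ n → N ℕ.≤ n → width n + width n < ε)
width→0 ε 0<ε = let N , small = frac-small (spread ℕ.+ spread) ε 0<ε in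
  N , λ n N≤n → subst (_< ε) (sym (double n)) (small n N≤n)
  where
  double : ∀ n → width n + width n ≡ + (spread ℕ.+ spread) / suc n
  double n = trans (frac-+ spread n spread n) (frac-≡ (spread * suc n ℕ.+ spread * suc n) _ (spread ℕ.+ spread) n (identity spread n))
    where
    identity : ∀ c n → (c * suc n ℕ.+ c * suc n) * suc n ≡ (c ℕ.+ c) * (suc n * suc n)
    identity = solve-∀

module _ (a a′ w w′ δ : ℚ) (w≡ : δ + w′ ≡ w) where
  open +-*-Solver using (_:+_; _:-_; _:=_) renaming (solve to solveℚ)

  interval-upper : a′ ≤ a + δ → a′ + w′ ≤ a + w
  interval-upper le = subst (a′ + w′ ≤_) (trans (+-assoc a δ w′) (cong (λ w → a + w) w≡)) (+-monoˡ-≤ w′ le)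

  interval-lower : a ≤ a′ + δ → a - w ≤ a′ - w′
  interval-lower le = subst₂ _≤_ (cong (λ w → a - w) w≡)
    (solveℚ 3 (λ a d w → (a :+ d) :- (d :+ w) := a :- w) refl a′ δ w′)
    (+-monoˡ-≤ (- (δ + w′)) le)

module Limit (D : ℕ → ℚ)
  (upper : ∀ f n → 40 ℕ.≤ f → suc (suc n) ℕ.≤ f → D (2 ℕ.+ f) ≤ D f + + spread / (suc n * suc (suc n)))
  (lower : ∀ f n → 40 ℕ.≤ f → suc (suc n) ℕ.≤ f → D f ≤ D (2 ℕ.+ f) + + spread / (suc n * suc (suc n)))
  (s : ℕ) (40≤s : 40 ℕ.≤ s) where

  term : ℕ → ℚ
  term n = D (s ℕ.+ 2 * n)

  private
    reorder : ∀ s n → 2 ℕ.+ (s ℕ.+ 2 * n) ≡ s ℕ.+ 2 * suc n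
    reorder = solve-∀
    40≤ : ∀ n → 40 ℕ.≤ s ℕ.+ 2 * n
    40≤ n = ℕ.≤-trans 40≤s (ℕ.m≤m+n s (2 * n))
    n+2≤ : ∀ n → suc (suc n) ℕ.≤ s ℕ.+ 2 * n
    n+2≤ n = linear-≤ (38 ℕ.+ n) 40≤s (solve (s ∷ n ∷ []))

  up↓ : ∀ n → term (suc n) + width (suc n) ≤ term n + width n
  up↓ n = interval-upper (term n) (term (suc n)) (width n) (width (suc n)) (+ spread / (suc n * suc (suc n))) (telescope n)
    (subst (λ f → D f ≤ term n + + spread / (suc n * suc (suc n))) (reorder s n) (upper (s ℕ.+ 2 * n) n (40≤ n) (n+2≤ n)))

  lo↑ : ∀ n → term n - width n ≤ term (suc n) - width (suc n)
  lo↑ n = interval-lower (term n) (term (suc n)) (width n) (width (suc n)) (+ spread / (suc n * suc (suc n))) (telescope n)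
    (subst (λ f → term n ≤ D f + + spread / (suc n * suc (suc n))) (reorder s n) (lower (s ℕ.+ 2 * n) n (40≤ n) (n+2≤ n)))

  private
    module I = NestedIntervals term width width≥0 up↓ lo↑ width→0

  limit : ℝ
  limit = I.real

  limit-converges : ∀ {P} → (∀ f → s ℕ.≤ f → P f → ∃[ n ] f ≡ s ℕ.+ 2 * n) → ConvergesAlong P D limit
  limit-converges = I.converges D s (λ _ → refl)

from-40 : ∀ q e → 40 ℕ.+ e ℕ.≤ e ℕ.+ q * 2 → ∃[ n ] e ℕ.+ q * 2 ≡ 40 ℕ.+ e ℕ.+ 2 * n
from-40 q e le = let n , eq = ℕ.m≤n⇒∃[o]m+o≡n 20≤q in
  n , trans (cong (λ q → e ℕ.+ q * 2) (sym eq)) (reorder n e 20)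
  where
  20≤q : 20 ℕ.≤ q
  20≤q = ℕ.*-cancelʳ-≤ 20 q 2 (ℕ.+-cancelˡ-≤ e 40 (q * 2) (ℕ.≤-trans (ℕ.≤-reflexive (ℕ.+-comm e 40)) le))
  reorder : ∀ n e k → e ℕ.+ (k ℕ.+ n) * 2 ≡ k * 2 ℕ.+ e ℕ.+ 2 * n
  reorder = solve-∀

even-index : ∀ f → 40 ℕ.≤ f → Even f → ∃[ n ] f ≡ 40 ℕ.+ 2 * n
even-index f 40≤f (divides q refl) = from-40 q 0 40≤f

odd-index : ∀ f → 41 ℕ.≤ f → Odd f → ∃[ n ] f ≡ 41 ℕ.+ 2 * n
odd-index f 41≤f odd = go (f ℕ./ 2) (f % 2) (m≡m%n+[m/n]*n f 2) (m%n<n f 2)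
  where
  go : ∀ q r → f ≡ r ℕ.+ q * 2 → r ℕ.< 2 → ∃[ n ] f ≡ 41 ℕ.+ 2 * n
  go q 0 eq _ = ⊥-elim (odd (divides q eq))
  go q 1 eq _ = let n , eq′ = from-40 q 1 (subst (41 ℕ.≤_) eq 41≤f) in n , trans eq eq′
  go q (suc (suc _)) _ (s≤s (s≤s ()))

theorem5p6 : ∃₂ λ (γ₀ γ₁ : ℝ) →
    ConvergesAlong Even (λ f → expectedGenus f - (+ (3 * f) / 4)) γ₀
    × ConvergesAlong Odd (λ f → expectedGenus f - (+ (3 * f) / 4)) γ₁
theorem5p6 = EvenLimit.limit , OddLimit.limit , EvenLimit.limit-converges even-index , OddLimit.limit-converges odd-index
  where
  module EvenLimit = Limit deviation deviation-upper deviation-lower 40 ℕ.≤-refl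
  module OddLimit  = Limit deviation deviation-upper deviation-lower 41 (ℕ.n≤1+n 40)
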